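{- There exist an absolute constant $C>0$ and a function $\varepsilon:\mathbb N\to[0,1]$ with $\varepsilon(r)\to0$ as $r\to\infty$ such that the following holds. Let $\mathcal H$ be an $r$-bounded, $\kappa$-spread multi-hypergraph on a finite vertex set $X=V(\mathcal H)$, let $k\ge r$ be an integer, and let $X'=X\times[k]$, where $[k]=\{1,\dots,k\}$. If $p$ is a real number with $0\le p/k\le 1$ and \[ p\ge\frac{C\log r}{\kappa}, \] then with probability at least $1-\varepsilon(r)$, the random set $X'_{p/k}$ contains a set $S'=\{(x_1,i_1),(x_2,i_2),\dots,(x_t,i_t)\}$, where $x_1,\dots,x_t$ are distinct, $\{x_1,x_2,\dots,x_t\}$ is an edge of $\mathcal H$, and $i_1,i_2,\dots,i_t$ are distinct numbers in $[k]$.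
   Context: A (multi-)hypergraph on a finite set $X$ is a non-empty finite collection of subsets of $X$ (edges), with repetitions allowed; $|\mathcal H|$ counts edges with multiplicity. $\mathcal H$ is $r$-bounded if every edge has size at most $r$. $\mathcal H$ is $\kappa$-spread ($\kappa>0$) if for every $S\subseteq X$ the number of edges of $\mathcal H$ (with multiplicity) containing $S$ is at most $\kappa^{ -|S|}|\mathcal H|$. For a finite set $Y$ and $\rho\in[0,1]$, $Y_\rho$ denotes the random subset of $Y$ containing each element independently with probability $\rho$. -}

module Defs where

open import Data.Bool.Base using (if_then_else_)
import Data.Bool.Properties as Bool
open import Data.Empty using (⊥-elim)
open import Data.Fin.Base using (Fin; combine; toℕ; fromℕ<)
import Data.Fin.Properties as Fin
open import Data.Fin.Subset using (Subset; inside; outside; _∈_; ∣_∣; ⁅_⁆; ⋃)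
open import Data.Fin.Subset.Properties using (_⊆?_; _∈?_)
import Data.Integer.Base as ℤ
import Data.Integer.Properties as ℤ
open import Data.List.Base as List using (List; []; _∷_; _++_)
open import Data.List.Membership.Propositional using () renaming (_∈_ to _∈ˡ_)
import Data.List.Membership.DecPropositional as DecMembership
open import Data.List.NonEmpty.Base as List⁺ using (List⁺)
open import Data.List.Relation.Unary.All using (All)
open import Data.Nat.Base as ℕ using (ℕ; zero; suc)
import Data.Nat.Coprimality as Coprimality
import Data.Nat.Properties as ℕ
open import Data.Product.Base using (∃; Σ; _×_; _,_)
open import Data.Rational.Base as ℚ using (ℚ; 0ℚ; 1ℚ; ½; mkℚ)
import Data.Rational.Properties as ℚ
import Data.Rational.Unnormalised.Base as ℚᵘ
import Data.Rational.Unnormalised.Properties as ℚᵘ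
open import Data.Sum.Base using (inj₁; inj₂)
open import Data.Vec.Base as Vec using (Vec; []; _∷_; lookup)
import Data.Vec.Properties as Vec
import Data.Vec.Relation.Unary.AllPairs as AllPairs
open import Data.Vec.Relation.Unary.Unique.Propositional using (Unique)
open import Data.Vec.Relation.Unary.Unique.Propositional.Properties using (lookup-injective)
open import Level using (0ℓ)
open import Relation.Binary.PropositionalEquality
open import Relation.Nullary.Decidable using (Dec; yes; no; dec⇒maybe; map′; ¬?; _×-dec_)
open import Relation.Unary using (Pred; Decidable)
open import Tactic.RingSolver using (solve-∀)
open import Tactic.RingSolver.Core.AlmostCommutativeRing using (AlmostCommutativeRing; fromCommutativeRing)


private
  variable
    n : ℕ

-- Real numbers: Cauchy sequences of rationals with a modulus of convergence.
-- Equality of reals is x ≤ y × y ≤ x, not _≡_.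

IsCauchy : (ℕ → ℚ) → Set
IsCauchy x = ∀ δ → 0ℚ ℚ.< δ →
  ∃ λ N → ∀ m n → N ℕ.≤ m → N ℕ.≤ n → ℚ.∣ x m ℚ.- x n ∣ ℚ.≤ δ

record ℝ : Set where
  constructor mkℝ
  field
    seq    : ℕ → ℚ
    cauchy : IsCauchy seq

open ℝ public

infix 4 _≤_ _<_

_≤_ : ℝ → ℝ → Set
x ≤ y = ∀ δ → 0ℚ ℚ.< δ → ∃ λ N → ∀ n → N ℕ.≤ n → seq x n ℚ.≤ seq y n ℚ.+ δ

_<_ : ℝ → ℝ → Set
x < y = ∃ λ δ → 0ℚ ℚ.< δ × ∃ λ N → ∀ n → N ℕ.≤ n → seq x n ℚ.+ δ ℚ.≤ seq y n

ℚ-ring : AlmostCommutativeRing 0ℓ 0ℓ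
ℚ-ring = fromCommutativeRing ℚ.+-*-commutativeRing (λ q → dec⇒maybe (0ℚ ℚ.≟ q))

ring-identity1 : ∀ a b c d → (a ℚ.+ b) ℚ.- (c ℚ.+ d) ≡ (a ℚ.- c) ℚ.+ (b ℚ.- d)
ring-identity1 = solve-∀ ℚ-ring

ring-identity2 : ∀ a b → (ℚ.- a) ℚ.- (ℚ.- b) ≡ ℚ.- (a ℚ.- b)
ring-identity2 = solve-∀ ℚ-ring

ring-identity3 : ∀ a b → a ≡ b ℚ.+ (a ℚ.- b)
ring-identity3 = solve-∀ ℚ-ring

ring-identity4 : ∀ b d v → b ℚ.* (d ℚ.* v) ≡ d ℚ.* (b ℚ.* v)
ring-identity4 = solve-∀ ℚ-ring

ring-identity5 : ∀ a b c d → a ℚ.* b ℚ.- c ℚ.* d ≡ a ℚ.* (b ℚ.- d) ℚ.+ d ℚ.* (a ℚ.- c)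
ring-identity5 = solve-∀ ℚ-ring

ring-identity6 : ∀ a b c → a ℚ.* (b ℚ.* c) ≡ (b ℚ.* a) ℚ.* c
ring-identity6 = solve-∀ ℚ-ring

ring-identity7 : ∀ a b c d → (a ℚ.* b) ℚ.* (d ℚ.- c) ≡ a ℚ.* (d ℚ.* b) ℚ.- b ℚ.* (c ℚ.* a)
ring-identity7 = solve-∀ ℚ-ring

ring-identity8 : ∀ w d e → (w ℚ.* w) ℚ.* (d ℚ.* (e ℚ.* e)) ≡ d ℚ.* ((e ℚ.* w) ℚ.* (e ℚ.* w))
ring-identity8 = solve-∀ ℚ-ring

ring-identity9 : ∀ a b c → (a ℚ.- (b ℚ.+ c)) ℚ.+ c ≡ a ℚ.- b
ring-identity9 = solve-∀ ℚ-ring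

ring-identity10 : ∀ a b c → (a ℚ.+ b) ℚ.- c ≡ (a ℚ.- c) ℚ.+ b
ring-identity10 = solve-∀ ℚ-ring

ring-identity11 : ∀ a b c → a ℚ.- b ≡ (a ℚ.+ c) ℚ.- (b ℚ.+ c)
ring-identity11 = solve-∀ ℚ-ring

ring-identity12 : ∀ x y → (x ℚ.+ y) ℚ.- x ≡ y
ring-identity12 = solve-∀ ℚ-ring

ring-identity13 : ∀ x y → y ℚ.- x ≡ ℚ.- (x ℚ.- y)
ring-identity13 = solve-∀ ℚ-ring

half-pos : ∀ {δ} → 0ℚ ℚ.< δ → 0ℚ ℚ.< ½ ℚ.* δ
half-pos {δ} 0<δ = subst (ℚ._< ½ ℚ.* δ) (ℚ.*-zeroʳ ½) (ℚ.*-monoʳ-<-pos ½ 0<δ)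

half+half : ∀ δ → ½ ℚ.* δ ℚ.+ ½ ℚ.* δ ≡ δ
half+half δ = trans (sym (ℚ.*-distribʳ-+ δ ½ ½)) (ℚ.*-identityˡ δ)

*-pos : ∀ {p q} → 0ℚ ℚ.< p → 0ℚ ℚ.< q → 0ℚ ℚ.< p ℚ.* q
*-pos {p} {q} 0<p 0<q = subst (ℚ._< p ℚ.* q) (ℚ.*-zeroʳ p)
  (ℚ.*-monoʳ-<-pos p {{ℚ.positive 0<p}} 0<q)

*-mono : ∀ {p q r s} → 0ℚ ℚ.≤ p → 0ℚ ℚ.≤ s → p ℚ.≤ q → r ℚ.≤ s → p ℚ.* r ℚ.≤ q ℚ.* s
*-mono {p} {q} {r} {s} 0≤p 0≤s p≤q r≤s = ℚ.≤-trans
  (ℚ.*-monoˡ-≤-nonNeg p {{ℚ.nonNegative 0≤p}} r≤s)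
  (ℚ.*-monoʳ-≤-nonNeg s {{ℚ.nonNegative 0≤s}} p≤q)

+-cauchy : ∀ {x y} → IsCauchy x → IsCauchy y → IsCauchy (λ n → x n ℚ.+ y n)
+-cauchy {x} {y} cx cy δ 0<δ
  = let N , px = cx (½ ℚ.* δ) (half-pos 0<δ)
        M , py = cy (½ ℚ.* δ) (half-pos 0<δ)
    in N ℕ.⊔ M , λ m n l k → begin
    ℚ.∣ (x m ℚ.+ y m) ℚ.- (x n ℚ.+ y n) ∣
      ≡⟨ cong ℚ.∣_∣ (ring-identity1 (x m) (y m) (x n) (y n)) ⟩
    ℚ.∣ (x m ℚ.- x n) ℚ.+ (y m ℚ.- y n) ∣
      ≤⟨ ℚ.∣p+q∣≤∣p∣+∣q∣ (x m ℚ.- x n) (y m ℚ.- y n) ⟩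
    ℚ.∣ x m ℚ.- x n ∣ ℚ.+ ℚ.∣ y m ℚ.- y n ∣
      ≤⟨ ℚ.+-mono-≤ (px m n (ℕ.m⊔n≤o⇒m≤o N M l) (ℕ.m⊔n≤o⇒m≤o N M k))
                    (py m n (ℕ.m⊔n≤o⇒n≤o N M l) (ℕ.m⊔n≤o⇒n≤o N M k)) ⟩
    ½ ℚ.* δ ℚ.+ ½ ℚ.* δ ≡⟨ half+half δ ⟩
    δ ∎
  where open ℚ.≤-Reasoning

neg-cauchy : ∀ {x} → IsCauchy x → IsCauchy (λ n → ℚ.- x n)
neg-cauchy {x} cx δ 0<δ with N , px ← cx δ 0<δ = N , λ m n l k → begin
    ℚ.∣ (ℚ.- x m) ℚ.- (ℚ.- x n) ∣
      ≡⟨ cong ℚ.∣_∣ (ring-identity2 (x m) (x n)) ⟩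
    ℚ.∣ ℚ.- (x m ℚ.- x n) ∣ ≡⟨ ℚ.∣-p∣≡∣p∣ (x m ℚ.- x n) ⟩
    ℚ.∣ x m ℚ.- x n ∣ ≤⟨ px m n l k ⟩
    δ ∎
  where open ℚ.≤-Reasoning

0<1 : 0ℚ ℚ.< 1ℚ
0<1 = ℚ.positive⁻¹ 1ℚ

p<p+1 : ∀ p → p ℚ.< p ℚ.+ 1ℚ
p<p+1 p = subst (ℚ._< p ℚ.+ 1ℚ) (ℚ.+-identityʳ p) (ℚ.+-monoʳ-< p 0<1)

bounded : ∀ {x} → IsCauchy x →
  ∃ λ B → 0ℚ ℚ.< B × ∃ λ N → ∀ n → N ℕ.≤ n → ℚ.∣ x n ∣ ℚ.≤ B
bounded {x} cx = let N , px = cx 1ℚ 0<1 in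
    ℚ.∣ x N ∣ ℚ.+ 1ℚ , ℚ.≤-<-trans (ℚ.0≤∣p∣ (x N)) (p<p+1 _) , N , λ n l → begin
    ℚ.∣ x n ∣
      ≡⟨ cong ℚ.∣_∣ (ring-identity3 (x n) (x N)) ⟩
    ℚ.∣ x N ℚ.+ (x n ℚ.- x N) ∣ ≤⟨ ℚ.∣p+q∣≤∣p∣+∣q∣ (x N) (x n ℚ.- x N) ⟩
    ℚ.∣ x N ∣ ℚ.+ ℚ.∣ x n ℚ.- x N ∣ ≤⟨ ℚ.+-monoʳ-≤ ℚ.∣ x N ∣ (px n N l ℕ.≤-refl) ⟩
    ℚ.∣ x N ∣ ℚ.+ 1ℚ ∎
  where open ℚ.≤-Reasoning

shrink : ∀ {B δ} → 0ℚ ℚ.< B → 0ℚ ℚ.< δ → ∃ λ η → 0ℚ ℚ.< η × B ℚ.* η ≡ δ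
shrink {B} {δ} 0<B 0<δ = δ ℚ.* w , *-pos 0<δ (ℚ.positive⁻¹ w {{ℚ.1/pos⇒pos B}}) , (begin
    B ℚ.* (δ ℚ.* w) ≡⟨ ring-identity4 B δ w ⟩
    δ ℚ.* (B ℚ.* w) ≡⟨ cong (δ ℚ.*_) (ℚ.*-inverseʳ B) ⟩
    δ ℚ.* 1ℚ        ≡⟨ ℚ.*-identityʳ δ ⟩
    δ ∎)
  where
  open ≡-Reasoning
  instance
    B⁺ : ℚ.Positive B
    B⁺ = ℚ.positive 0<B
    B≠0 : ℚ.NonZero B
    B≠0 = ℚ.pos⇒nonZero B
  w : ℚ
  w = ℚ.1/ B

*-cauchy : ∀ {x y} → IsCauchy x → IsCauchy y → IsCauchy (λ n → x n ℚ.* y n)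
*-cauchy {x} {y} cx cy δ 0<δ
  = let A , 0<A , N₁ , bx = bounded cx
        B , 0<B , N₂ , by = bounded cy
        α , 0<α , eα = shrink 0<B (half-pos 0<δ)
        β , 0<β , eβ = shrink 0<A (half-pos 0<δ)
        N₃ , px = cx α 0<α
        N₄ , py = cy β 0<β
    in (N₁ ℕ.⊔ N₂) ℕ.⊔ (N₃ ℕ.⊔ N₄) , λ m n l k →
    let l₁₂ = ℕ.m⊔n≤o⇒m≤o (N₁ ℕ.⊔ N₂) (N₃ ℕ.⊔ N₄) l
        l₃₄ = ℕ.m⊔n≤o⇒n≤o (N₁ ℕ.⊔ N₂) (N₃ ℕ.⊔ N₄) l
        k₁₂ = ℕ.m⊔n≤o⇒m≤o (N₁ ℕ.⊔ N₂) (N₃ ℕ.⊔ N₄) k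
        k₃₄ = ℕ.m⊔n≤o⇒n≤o (N₁ ℕ.⊔ N₂) (N₃ ℕ.⊔ N₄) k
    in begin
    ℚ.∣ x m ℚ.* y m ℚ.- x n ℚ.* y n ∣
      ≡⟨ cong ℚ.∣_∣ (ring-identity5 (x m) (y m) (x n) (y n)) ⟩
    ℚ.∣ x m ℚ.* (y m ℚ.- y n) ℚ.+ y n ℚ.* (x m ℚ.- x n) ∣
      ≤⟨ ℚ.∣p+q∣≤∣p∣+∣q∣ (x m ℚ.* (y m ℚ.- y n)) (y n ℚ.* (x m ℚ.- x n)) ⟩
    ℚ.∣ x m ℚ.* (y m ℚ.- y n) ∣ ℚ.+ ℚ.∣ y n ℚ.* (x m ℚ.- x n) ∣
      ≡⟨ cong₂ ℚ._+_ (ℚ.∣p*q∣≡∣p∣*∣q∣ (x m) (y m ℚ.- y n)) (ℚ.∣p*q∣≡∣p∣*∣q∣ (y n) (x m ℚ.- x n)) ⟩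
    ℚ.∣ x m ∣ ℚ.* ℚ.∣ y m ℚ.- y n ∣ ℚ.+ ℚ.∣ y n ∣ ℚ.* ℚ.∣ x m ℚ.- x n ∣
      ≤⟨ ℚ.+-mono-≤
           (*-mono (ℚ.0≤∣p∣ (x m)) (ℚ.<⇒≤ 0<β) (bx m (ℕ.m⊔n≤o⇒m≤o N₁ N₂ l₁₂))
             (py m n (ℕ.m⊔n≤o⇒n≤o N₃ N₄ l₃₄) (ℕ.m⊔n≤o⇒n≤o N₃ N₄ k₃₄)))
           (*-mono (ℚ.0≤∣p∣ (y n)) (ℚ.<⇒≤ 0<α) (by n (ℕ.m⊔n≤o⇒n≤o N₁ N₂ k₁₂))
             (px m n (ℕ.m⊔n≤o⇒m≤o N₃ N₄ l₃₄) (ℕ.m⊔n≤o⇒m≤o N₃ N₄ k₃₄))) ⟩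
    A ℚ.* β ℚ.+ B ℚ.* α ≡⟨ cong₂ ℚ._+_ eβ eα ⟩
    ½ ℚ.* δ ℚ.+ ½ ℚ.* δ ≡⟨ half+half δ ⟩
    δ ∎
  where open ℚ.≤-Reasoning

infix  8 -_
infixl 6 _+_ _-_
infixl 7 _*_
infixr 8 _^_

fromℚ : ℚ → ℝ
fromℚ q = mkℝ (λ _ → q) λ δ 0<δ → 0 , λ _ _ _ _ →
  subst (ℚ._≤ δ) (cong ℚ.∣_∣ (sym (ℚ.+-inverseʳ q))) (ℚ.<⇒≤ 0<δ)

fromℕ : ℕ → ℝ
fromℕ m = fromℚ ((ℤ.+ m) ℚ./ 1)

0ℝ 1ℝ : ℝ
0ℝ = fromℚ 0ℚ
1ℝ = fromℚ 1ℚ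

_+_ _*_ : ℝ → ℝ → ℝ
x + y = mkℝ (λ n → seq x n ℚ.+ seq y n) (+-cauchy {seq x} {seq y} (cauchy x) (cauchy y))
x * y = mkℝ (λ n → seq x n ℚ.* seq y n) (*-cauchy {seq x} {seq y} (cauchy x) (cauchy y))

-_ : ℝ → ℝ
- x = mkℝ (λ n → ℚ.- seq x n) (neg-cauchy {seq x} (cauchy x))

_-_ : ℝ → ℝ → ℝ
x - y = x + (- y)

_^_ : ℝ → ℕ → ℝ
x ^ zero  = 1ℝ
x ^ suc m = x * x ^ m

-- The value at 0 is irrelevant: a positive real has only finitely many
-- non-positive terms.
inv₀ : ℚ → ℚ
inv₀ q with q ℚ.≟ 0ℚ
... | yes _  = 0ℚ
... | no q≢0 = (ℚ.1/ q) {{ℚ.≢-nonZero q≢0}}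

inv₀-inverseʳ : ∀ {q} → 0ℚ ℚ.< q → q ℚ.* inv₀ q ≡ 1ℚ
inv₀-inverseʳ {q} 0<q with q ℚ.≟ 0ℚ
... | yes q≡0 = ⊥-elim (ℚ.<-irrefl (sym q≡0) 0<q)
... | no q≢0  = ℚ.*-inverseʳ q {{ℚ.≢-nonZero q≢0}}

inv₀-nonNeg : ∀ {q} → 0ℚ ℚ.< q → 0ℚ ℚ.≤ inv₀ q
inv₀-nonNeg {q} 0<q with q ℚ.≟ 0ℚ
... | yes _  = ℚ.≤-refl
... | no q≢0 = ℚ.<⇒≤ (ℚ.positive⁻¹ (ℚ.1/_ q {{ℚ.≢-nonZero q≢0}})
                        {{ℚ.1/pos⇒pos q {{ℚ.positive 0<q}}}})

inv₀-antimono : ∀ {η q} → 0ℚ ℚ.< η → η ℚ.≤ q → inv₀ q ℚ.≤ inv₀ η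
inv₀-antimono {η} {q} 0<η η≤q = begin
    u                 ≡⟨ sym (ℚ.*-identityʳ u) ⟩
    u ℚ.* 1ℚ          ≡⟨ cong (u ℚ.*_) (sym (inv₀-inverseʳ 0<η)) ⟩
    u ℚ.* (η ℚ.* w)
      ≤⟨ ℚ.*-monoˡ-≤-nonNeg u {{ℚ.nonNegative (inv₀-nonNeg 0<q)}}
           (ℚ.*-monoʳ-≤-nonNeg w {{ℚ.nonNegative (inv₀-nonNeg 0<η)}} η≤q) ⟩
    u ℚ.* (q ℚ.* w)   ≡⟨ ring-identity6 u q w ⟩
    (q ℚ.* u) ℚ.* w   ≡⟨ cong (ℚ._* w) (inv₀-inverseʳ 0<q) ⟩
    1ℚ ℚ.* w          ≡⟨ ℚ.*-identityˡ w ⟩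
    w ∎
  where
  open ℚ.≤-Reasoning
  0<q = ℚ.<-≤-trans 0<η η≤q
  u = inv₀ q
  w = inv₀ η

inv₀-diff : ∀ {p q} → 0ℚ ℚ.< p → 0ℚ ℚ.< q →
  inv₀ p ℚ.- inv₀ q ≡ (inv₀ p ℚ.* inv₀ q) ℚ.* (q ℚ.- p)
inv₀-diff {p} {q} 0<p 0<q = sym (begin
    (u ℚ.* v) ℚ.* (q ℚ.- p)
      ≡⟨ ring-identity7 u v p q ⟩
    u ℚ.* (q ℚ.* v) ℚ.- v ℚ.* (p ℚ.* u)
      ≡⟨ cong₂ (λ a b → u ℚ.* a ℚ.- v ℚ.* b) (inv₀-inverseʳ 0<q) (inv₀-inverseʳ 0<p) ⟩
    u ℚ.* 1ℚ ℚ.- v ℚ.* 1ℚ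
      ≡⟨ cong₂ ℚ._-_ (ℚ.*-identityʳ u) (ℚ.*-identityʳ v) ⟩
    u ℚ.- v ∎)
  where
  open ≡-Reasoning
  u = inv₀ p
  v = inv₀ q

inv-cauchy : ∀ x → 0ℝ < x → IsCauchy (λ n → inv₀ (seq x n))
inv-cauchy x (η , 0<η , N , η≤x) δ 0<δ
  = let M , px = cauchy x (δ ℚ.* (η ℚ.* η)) (*-pos 0<δ (*-pos 0<η 0<η)) in
    N ℕ.⊔ M , λ m n l k →
    let ηm = subst (ℚ._≤ seq x m) (ℚ.+-identityˡ η) (η≤x m (ℕ.m⊔n≤o⇒m≤o N M l))
        ηn = subst (ℚ._≤ seq x n) (ℚ.+-identityˡ η) (η≤x n (ℕ.m⊔n≤o⇒m≤o N M k))
        0<m = ℚ.<-≤-trans 0<η ηm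
        0<n = ℚ.<-≤-trans 0<η ηn
        u = inv₀ (seq x m)
        v = inv₀ (seq x n)
        0≤uv = subst (ℚ._≤ u ℚ.* v) (ℚ.*-zeroʳ u)
                 (ℚ.*-monoˡ-≤-nonNeg u {{ℚ.nonNegative (inv₀-nonNeg 0<m)}} (inv₀-nonNeg 0<n))
        0≤δη² = ℚ.<⇒≤ (*-pos 0<δ (*-pos 0<η 0<η))
    in begin
    ℚ.∣ u ℚ.- v ∣ ≡⟨ cong ℚ.∣_∣ (inv₀-diff 0<m 0<n) ⟩
    ℚ.∣ (u ℚ.* v) ℚ.* (seq x n ℚ.- seq x m) ∣
      ≡⟨ ℚ.∣p*q∣≡∣p∣*∣q∣ (u ℚ.* v) (seq x n ℚ.- seq x m) ⟩
    ℚ.∣ u ℚ.* v ∣ ℚ.* ℚ.∣ seq x n ℚ.- seq x m ∣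
      ≡⟨ cong (ℚ._* ℚ.∣ seq x n ℚ.- seq x m ∣) (ℚ.0≤p⇒∣p∣≡p 0≤uv) ⟩
    (u ℚ.* v) ℚ.* ℚ.∣ seq x n ℚ.- seq x m ∣
      ≤⟨ *-mono 0≤uv 0≤δη²
           (*-mono (inv₀-nonNeg 0<m) (inv₀-nonNeg 0<η) (inv₀-antimono 0<η ηm) (inv₀-antimono 0<η ηn))
           (px n m (ℕ.m⊔n≤o⇒n≤o N M k) (ℕ.m⊔n≤o⇒n≤o N M l)) ⟩
    (inv₀ η ℚ.* inv₀ η) ℚ.* (δ ℚ.* (η ℚ.* η))
      ≡⟨ ring-identity8 (inv₀ η) δ η ⟩
    δ ℚ.* ((η ℚ.* inv₀ η) ℚ.* (η ℚ.* inv₀ η))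
      ≡⟨ cong (λ a → δ ℚ.* (a ℚ.* a)) (inv₀-inverseʳ 0<η) ⟩
    δ ℚ.* (1ℚ ℚ.* 1ℚ) ≡⟨ ℚ.*-identityʳ δ ⟩
    δ ∎
  where open ℚ.≤-Reasoning

infixl 7 _/_[_]

_/_[_] : ℝ → (y : ℝ) → 0ℝ < y → ℝ
x / y [ 0<y ] = x * mkℝ (λ n → inv₀ (seq y n)) (inv-cauchy y 0<y)

fromℕ-pos : ∀ k .{{_ : ℕ.NonZero k}} → 0ℝ < fromℕ k
fromℕ-pos k@(suc _) = q , ℚ.positive⁻¹ q {{ℚ.normalize-pos k 1}} , 0 ,
  λ _ _ → ℚ.≤-reflexive (ℚ.+-identityˡ q)
  where q = (ℤ.+ k) ℚ./ 1

recip : ℕ → ℚ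
recip j = (ℤ.+ 1) ℚ./ suc j

harmonic : ℕ → ℚ
harmonic zero    = 0ℚ
harmonic (suc m) = harmonic m ℚ.+ recip m

-- With M = N + 1, the right Riemann sum of ∫₁ʳ dt/t with mesh 1/M is
-- Σ_{M < j ≤ rM} 1/j = harmonic (rM) - harmonic M.
logSeq : ℕ → ℕ → ℚ
logSeq r N = harmonic (r ℕ.* suc N) ℚ.- harmonic (suc N)

recip≡ : ∀ j → recip j ≡ mkℚ (ℤ.+ 1) j (Coprimality.1-coprimeTo (suc j))
recip≡ j = ℚ.normalize-coprime {1} {j} (Coprimality.1-coprimeTo (suc j))

recip-antimono : ∀ {i j} → i ℕ.≤ j → recip j ℚ.≤ recip i
recip-antimono {i} {j} i≤j rewrite recip≡ i | recip≡ j =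
  ℚ.*≤* (ℤ.*-monoˡ-≤-nonNeg (ℤ.+ 1) (ℤ.+≤+ (ℕ.s≤s i≤j)))

recip-nonNeg : ∀ j → 0ℚ ℚ.≤ recip j
recip-nonNeg j = ℚ.<⇒≤ (ℚ.positive⁻¹ (recip j) {{ℚ.normalize-pos 1 (suc j)}})

recip-archimedean : ∀ δ → 0ℚ ℚ.< δ → ∃ λ N → recip N ℚ.≤ δ
recip-archimedean δ@(mkℚ (ℤ.+ suc a) d _) _ = d , subst (ℚ._≤ δ) (sym (recip≡ d))
  (ℚ.*≤* (ℤ.*-monoʳ-≤-nonNeg (ℤ.+ suc d) {ℤ.+ 1} {ℤ.+ suc a} (ℤ.+≤+ (ℕ.s≤s ℕ.z≤n))))
recip-archimedean (mkℚ (ℤ.+ zero) _ _) (ℚ.*<* (ℤ.+<+ ()))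
recip-archimedean (mkℚ ℤ.-[1+ _ ] _ _) (ℚ.*<* ())

_·_ : ℕ → ℚ → ℚ
zero  · q = 0ℚ
suc m · q = m · q ℚ.+ q

toℚᵘ-· : ∀ m j → ℚ.toℚᵘ (m · recip j) ℚᵘ.≃ ℚᵘ.mkℚᵘ (ℤ.+ m) j
toℚᵘ-· zero    j = ℚᵘ.*≡* refl
toℚᵘ-· (suc m) j = ℚᵘ.≃-trans (ℚ.toℚᵘ-homo-+ (m · recip j) (recip j))
  (ℚᵘ.≃-trans (ℚᵘ.+-cong (toℚᵘ-· m j) (ℚᵘ.≃-reflexive (cong ℚ.toℚᵘ (recip≡ j)))) (ℚᵘ.*≡* (begin
    (M ℤ.* D ℤ.+ ℤ.1ℤ ℤ.* D) ℤ.* D ≡⟨ cong (ℤ._* D) (sym (ℤ.*-distribʳ-+ D M ℤ.1ℤ)) ⟩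
    (M ℤ.+ ℤ.1ℤ) ℤ.* D ℤ.* D       ≡⟨ ℤ.*-assoc (M ℤ.+ ℤ.1ℤ) D D ⟩
    (M ℤ.+ ℤ.1ℤ) ℤ.* (D ℤ.* D)     ≡⟨ cong (λ a → ℤ.+ a ℤ.* (D ℤ.* D)) (ℕ.+-comm m 1) ⟩
    ℤ.+ suc m ℤ.* (D ℤ.* D) ∎)))
  where
  open ≡-Reasoning
  M = ℤ.+ m
  D = ℤ.+ suc j

·-recip : ∀ q N → suc q · recip (N ℕ.+ q ℕ.* suc N) ≡ recip N
·-recip q N = ℚ.toℚᵘ-injective (ℚᵘ.≃-trans (toℚᵘ-· (suc q) (N ℕ.+ q ℕ.* suc N))
  (ℚᵘ.≃-trans (ℚᵘ.*≡* (sym (ℤ.*-identityˡ (ℤ.+ (suc q ℕ.* suc N)))))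
    (ℚᵘ.≃-reflexive (sym (cong ℚ.toℚᵘ (recip≡ N))))))

harmonic-upper : ∀ d a j → j ℕ.≤ a → harmonic (d ℕ.+ a) ℚ.≤ harmonic a ℚ.+ d · recip j
harmonic-upper zero    a j j≤a = ℚ.≤-reflexive (sym (ℚ.+-identityʳ (harmonic a)))
harmonic-upper (suc d) a j j≤a = begin
    harmonic (d ℕ.+ a) ℚ.+ recip (d ℕ.+ a)
      ≤⟨ ℚ.+-mono-≤ (harmonic-upper d a j j≤a)
           (recip-antimono (ℕ.≤-trans j≤a (ℕ.m≤n+m a d))) ⟩
    (harmonic a ℚ.+ d · recip j) ℚ.+ recip j ≡⟨ ℚ.+-assoc (harmonic a) (d · recip j) (recip j) ⟩
    harmonic a ℚ.+ (d · recip j ℚ.+ recip j) ∎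
  where open ℚ.≤-Reasoning

harmonic-lower : ∀ d a j → d ℕ.+ a ℕ.≤ suc j → harmonic a ℚ.+ d · recip j ℚ.≤ harmonic (d ℕ.+ a)
harmonic-lower zero    a j l = ℚ.≤-reflexive (ℚ.+-identityʳ (harmonic a))
harmonic-lower (suc d) a j (ℕ.s≤s l) = begin
    harmonic a ℚ.+ (d · recip j ℚ.+ recip j) ≡⟨ sym (ℚ.+-assoc (harmonic a) (d · recip j) (recip j)) ⟩
    (harmonic a ℚ.+ d · recip j) ℚ.+ recip j
      ≤⟨ ℚ.+-mono-≤ (harmonic-lower d a j (ℕ.m≤n⇒m≤1+n l)) (recip-antimono l) ⟩
    harmonic (d ℕ.+ a) ℚ.+ recip (d ℕ.+ a) ∎
  where open ℚ.≤-Reasoning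

logSeq-step-upper : ∀ q N → let r = suc q in
  logSeq r (suc N) ℚ.+ recip (suc N) ℚ.≤ logSeq r N ℚ.+ recip N
logSeq-step-upper q N = begin
    (harmonic (r ℕ.* suc (suc N)) ℚ.- (h ℚ.+ t)) ℚ.+ t
      ≡⟨ ring-identity9 (harmonic (r ℕ.* suc (suc N))) h t ⟩
    harmonic (r ℕ.* suc (suc N)) ℚ.- h
      ≡⟨ cong (λ a → harmonic a ℚ.- h) (ℕ.*-suc r (suc N)) ⟩
    harmonic (r ℕ.+ r ℕ.* suc N) ℚ.- h
      ≤⟨ ℚ.+-monoˡ-≤ (ℚ.- h) (harmonic-upper r (r ℕ.* suc N) (N ℕ.+ q ℕ.* suc N) (ℕ.n≤1+n _)) ⟩
    (H ℚ.+ r · recip (N ℕ.+ q ℕ.* suc N)) ℚ.- h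
      ≡⟨ cong (λ a → (H ℚ.+ a) ℚ.- h) (·-recip q N) ⟩
    (H ℚ.+ recip N) ℚ.- h
      ≡⟨ ring-identity10 H (recip N) h ⟩
    (H ℚ.- h) ℚ.+ recip N ∎
  where
  open ℚ.≤-Reasoning
  r = suc q
  h = harmonic (suc N)
  H = harmonic (r ℕ.* suc N)
  t = recip (suc N)

logSeq-step-lower : ∀ q N → logSeq (suc q) N ℚ.≤ logSeq (suc q) (suc N)
logSeq-step-lower q N = begin
    H ℚ.- h
      ≡⟨ ring-identity11 H h t ⟩
    (H ℚ.+ t) ℚ.- (h ℚ.+ t)
      ≡⟨ cong (λ a → (H ℚ.+ a) ℚ.- (h ℚ.+ t)) (sym (·-recip q (suc N))) ⟩
    (H ℚ.+ r · recip (suc N ℕ.+ q ℕ.* suc (suc N))) ℚ.- (h ℚ.+ t)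
      ≤⟨ ℚ.+-monoˡ-≤ (ℚ.- (h ℚ.+ t)) (harmonic-lower r (r ℕ.* suc N)
           (suc N ℕ.+ q ℕ.* suc (suc N)) (ℕ.≤-reflexive (sym (ℕ.*-suc r (suc N))))) ⟩
    harmonic (r ℕ.+ r ℕ.* suc N) ℚ.- (h ℚ.+ t)
      ≡⟨ cong (λ a → harmonic a ℚ.- (h ℚ.+ t)) (sym (ℕ.*-suc r (suc N))) ⟩
    harmonic (r ℕ.* suc (suc N)) ℚ.- (h ℚ.+ t) ∎
  where
  open ℚ.≤-Reasoning
  r = suc q
  h = harmonic (suc N)
  H = harmonic (r ℕ.* suc N)
  t = recip (suc N)

logSeq-mono : ∀ q N d → logSeq (suc q) N ℚ.≤ logSeq (suc q) (d ℕ.+ N)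
logSeq-mono q N zero    = ℚ.≤-refl
logSeq-mono q N (suc d) = ℚ.≤-trans (logSeq-mono q N d) (logSeq-step-lower q (d ℕ.+ N))

logSeq-antimono : ∀ q N d →
  logSeq (suc q) (d ℕ.+ N) ℚ.+ recip (d ℕ.+ N) ℚ.≤ logSeq (suc q) N ℚ.+ recip N
logSeq-antimono q N zero    = ℚ.≤-refl
logSeq-antimono q N (suc d) = ℚ.≤-trans (logSeq-step-upper q (d ℕ.+ N)) (logSeq-antimono q N d)

logSeq-upper : ∀ q N d → logSeq (suc q) (d ℕ.+ N) ℚ.≤ logSeq (suc q) N ℚ.+ recip N
logSeq-upper q N d = ℚ.≤-trans
  (subst (ℚ._≤ a ℚ.+ recip (d ℕ.+ N)) (ℚ.+-identityʳ a) (ℚ.+-monoʳ-≤ a (recip-nonNeg (d ℕ.+ N))))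
  (logSeq-antimono q N d)
  where a = logSeq (suc q) (d ℕ.+ N)

-- Two points of an interval [a , a + e] are at distance at most e.
∣-∣-interval : ∀ {a e p q} → a ℚ.≤ p → p ℚ.≤ a ℚ.+ e → a ℚ.≤ q → q ℚ.≤ a ℚ.+ e →
  ℚ.∣ p ℚ.- q ∣ ℚ.≤ e
∣-∣-interval {a} {e} {p} {q} a≤p p≤ a≤q q≤ with ℚ.∣p∣≡p∨∣p∣≡-p (p ℚ.- q)
... | inj₁ eq = subst₂ ℚ._≤_ (sym eq) (ring-identity12 a e)
                  (ℚ.+-mono-≤ p≤ (ℚ.neg-antimono-≤ a≤q))
... | inj₂ eq = subst₂ ℚ._≤_
                  (trans (ring-identity13 p q) (sym eq))
                  (ring-identity12 a e)
                  (ℚ.+-mono-≤ q≤ (ℚ.neg-antimono-≤ a≤p))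

log-cauchy : ∀ q → IsCauchy (logSeq (suc q))
log-cauchy q δ 0<δ with N , N≤δ ← recip-archimedean δ 0<δ = N , λ m n l k → ℚ.≤-trans
  (∣-∣-interval (lo m l) (hi m l) (lo n k) (hi n k)) N≤δ
  where
  lo : ∀ {N} m → N ℕ.≤ m → logSeq (suc q) N ℚ.≤ logSeq (suc q) m
  lo {N} m l = subst (λ z → logSeq (suc q) N ℚ.≤ logSeq (suc q) z) (ℕ.m∸n+n≡m l)
    (logSeq-mono q N (m ℕ.∸ N))
  hi : ∀ {N} m → N ℕ.≤ m → logSeq (suc q) m ℚ.≤ logSeq (suc q) N ℚ.+ recip N
  hi {N} m l = subst (λ z → logSeq (suc q) z ℚ.≤ logSeq (suc q) N ℚ.+ recip N) (ℕ.m∸n+n≡m l)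
    (logSeq-upper q N (m ℕ.∸ N))

-- log r = ∫₁ʳ dt/t, with the convention log 0 = 0.
log : ℕ → ℝ
log zero    = 0ℝ
log (suc q) = mkℝ (logSeq (suc q)) (log-cauchy q)

-- The vertex set is Fin n; edges are listed with multiplicity.
MultiHypergraph : ℕ → Set
MultiHypergraph n = List⁺ (Subset n)

edges : MultiHypergraph n → List (Subset n)
edges = List⁺.toList

degree : MultiHypergraph n → Subset n → ℕ
degree H S = List.length (List.filter (S ⊆?_) (edges H))

Bounded : ℕ → MultiHypergraph n → Set
Bounded r H = All (λ e → ∣ e ∣ ℕ.≤ r) (edges H)

Spread : (κ : ℝ) → 0ℝ < κ → MultiHypergraph n → Set
Spread {n} κ κ>0 H = (S : Subset n) →
  fromℕ (degree H S) ≤ (1ℝ / κ [ κ>0 ]) ^ ∣ S ∣ * fromℕ (List⁺.length H)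

allSubsets : ∀ m → List (Subset m)
allSubsets zero    = [] ∷ []
allSubsets (suc m) = List.map (inside ∷_) (allSubsets m) ++ List.map (outside ∷_) (allSubsets m)

-- The probability that the ρ-random subset of Fin m equals W.
weight : ∀ {m} → ℝ → Subset m → ℝ
weight ρ []      = 1ℝ
weight ρ (b ∷ W) = (if b then ρ else 1ℝ - ρ) * weight ρ W

Pr : ∀ {m} → ℝ → {E : Pred (Subset m) 0ℓ} → Decidable E → ℝ
Pr {m} ρ E? = List.foldr _+_ 0ℝ (List.map (weight ρ) (List.filter E? (allSubsets m)))

toSubset : ∀ {t} → Vec (Fin n) t → Subset n
toSubset xs = ⋃ (List.map ⁅_⁆ (Vec.toList xs))

-- The product X × [k] is identified with Fin (n * k) by (x , i) ↦ combine x i.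
ContainsRainbowEdge : MultiHypergraph n → (k : ℕ) → Pred (Subset (n ℕ.* k)) 0ℓ
ContainsRainbowEdge {n} H k W =
  ∃ λ t → Σ (Vec (Fin n) t) λ xs → Σ (Vec (Fin k) t) λ is →
    Unique xs × toSubset xs ∈ˡ edges H × Unique is ×
    (∀ j → combine (lookup xs j) (lookup is j) ∈ W)

anyVec? : ∀ {ℓ t} {P : Pred (Vec (Fin n) t) ℓ} → Decidable P → Dec (∃ P)
anyVec? {t = zero}  P? = map′ (λ p → [] , p) (λ { ([] , p) → p }) (P? [])
anyVec? {t = suc t} P? = map′ (λ { (x , xs , p) → x ∷ xs , p }) (λ { (x ∷ xs , p) → x , xs , p })
  (Fin.any? λ x → anyVec? λ xs → P? (x ∷ xs))

containsRainbowEdge? : (H : MultiHypergraph n) (k : ℕ) → Decidable (ContainsRainbowEdge H k)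
containsRainbowEdge? {n} H k W = map′
  (λ { (i , w) → toℕ i , w })
  (λ { (t , w@(xs , _ , xs! , _)) →
         let t<1+n = ℕ.s≤s (Fin.injective⇒≤ (λ {i} {j} → lookup-injective xs! i j))
         in fromℕ< t<1+n , subst Witness (sym (Fin.toℕ-fromℕ< t<1+n)) w })
  (Fin.any? {n = suc n} λ i → witness? (toℕ i))
  where
  Witness : ℕ → Set
  Witness t = Σ (Vec (Fin n) t) λ xs → Σ (Vec (Fin k) t) λ is →
    Unique xs × toSubset xs ∈ˡ edges H × Unique is ×
    (∀ j → combine (lookup xs j) (lookup is j) ∈ W)

  open DecMembership (Vec.≡-dec Bool._≟_) using () renaming (_∈?_ to _∈ˡ?_)

  unique? : ∀ {m t} (xs : Vec (Fin m) t) → Dec (Unique xs)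
  unique? = AllPairs.allPairs? λ x y → ¬? (x Fin.≟ y)

  witness? : ∀ t → Dec (Witness t)
  witness? t = anyVec? λ xs → anyVec? λ is →
    unique? xs ×-dec toSubset xs ∈ˡ? edges H ×-dec unique? is ×-dec
    Fin.all? λ j → combine (lookup xs j) (lookup is j) ∈? W

{-# OPTIONS --safe #-}
-- Give every edge e of H one copy for each sequence of r distinct colours, the vertices of e being
-- coloured in order. A prescribed injective colouring of s vertices is met by a proportion
-- (k - s)! / k! ≤ (4 / k)^s of the sequences, so the coloured hypergraph on X × [k] is spread with
-- parameter κ k / 4, and it remains to show that a random set of density C log r / κ contains an
-- edge of any r-bounded κ-spread hypergraph. This is done with the minimum fragments of Park and
-- Pham: expose the random set in independent rounds, replacing each edge by its smallest possible
-- remainder and dropping the edges whose remainder is too large. Each of the about log₂ r first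
-- rounds has density 8 / κ and halves the size of the edges until it is at most w ≈ √(log₂ r); the
-- last round, of density 2 w² / κ, leaves an empty remainder. The expected proportion of dropped
-- edges is at most Σ_{i ≥ 0} 2^(-w 2^i) + 1 / w ≤ 3 / w, and it bounds the probability that no edge
-- survives.
module Submission where

-- The cut-off w balances two costs. A halving round aiming at size c loses an expected proportion
-- of edges bounded only by 2^-c, so halving down to bounded size would leave a failure bound that
-- does not tend to 0. Stopping at w calls for a round that finishes off edges of size w at once: a
-- loss of 1 / w there costs density of order w² / κ. Both w² = O(log r) and w → ∞ hold for w ≈
-- √(log₂ r). Rounds are chained through an inequality in which the original number M of edges stays
-- fixed. A fragment is a subset of the edge it replaces, so degrees never grow and the spread
-- condition relative to M survives, while dropped edges enter only as an additive loss. All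
-- probability is done over ℚ. A real number is a sequence of rationals, the probability of an event
-- is a polynomial in the density evaluated term by term, and 1 / κ and log r are replaced by
-- rational bounds valid at all late indices.

-- Rational arithmetic: powers, indicators and finite sums.

module Rationals where

  open import Data.Bool.Base using (if_then_else_)
  open import Data.List.Base using (List; []; _∷_; _++_; length; filter; map; concatMap)
  open import Data.List.Membership.Propositional using (_∈_)
  open import Data.List.Relation.Unary.Any using (here; there)
  open import Data.Nat.Base as ℕ using (ℕ; zero; suc)
  import Data.Nat.Properties as ℕ
  open import Data.Rational.Base hiding (_>_; _≥_; ∣_∣)
  open import Data.Rational.Properties as ℚ using (≤-refl; ≤-trans)
  import Data.Rational.Unnormalised.Base as ℚᵘ
  import Data.Rational.Unnormalised.Properties as ℚᵘ
  import Data.Integer.Base as ℤ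
  import Data.Integer.Properties as ℤ
  open import Function.Base using (_∘_)
  open import Relation.Binary.PropositionalEquality
  open import Relation.Nullary.Negation using (¬_; contradiction)
  open import Relation.Nullary.Decidable using (Dec; yes; no; does)
  open import Relation.Unary using (Decidable)
  open import Tactic.RingSolver using (solve-∀)
  open import Defs using (ℚ-ring; recip; toℚᵘ-·; _·_)

  0≤1 : 0ℚ ≤ 1ℚ
  0≤1 = ℚ.nonNegative⁻¹ 1ℚ

  *-monoˡ : ∀ {c a b} → 0ℚ ≤ c → a ≤ b → c * a ≤ c * b
  *-monoˡ {c} 0≤c = ℚ.*-monoˡ-≤-nonNeg c {{nonNegative 0≤c}}

  *-monoʳ : ∀ {c a b} → 0ℚ ≤ c → a ≤ b → a * c ≤ b * c
  *-monoʳ {c} 0≤c = ℚ.*-monoʳ-≤-nonNeg c {{nonNegative 0≤c}}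

  *-mono : ∀ {a b c d} → 0ℚ ≤ a → 0ℚ ≤ d → a ≤ b → c ≤ d → a * c ≤ b * d
  *-mono 0≤a 0≤d a≤b c≤d = ≤-trans (*-monoˡ 0≤a c≤d) (*-monoʳ 0≤d a≤b)

  0≤* : ∀ {a b} → 0ℚ ≤ a → 0ℚ ≤ b → 0ℚ ≤ a * b
  0≤* {a} {b} 0≤a 0≤b = subst (_≤ a * b) (ℚ.*-zeroʳ a) (*-monoˡ 0≤a 0≤b)

  0≤+ : ∀ {a b} → 0ℚ ≤ a → 0ℚ ≤ b → 0ℚ ≤ a + b
  0≤+ 0≤a 0≤b = ℚ.+-mono-≤ 0≤a 0≤b

  0<* : ∀ {a b} → 0ℚ < a → 0ℚ < b → 0ℚ < a * b
  0<* {a} {b} 0<a 0<b = ℚ.positive⁻¹ (a * b) {{ℚ.pos*pos⇒pos a {{positive 0<a}} b {{positive 0<b}}}}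

  a≤a+b : ∀ {a b} → 0ℚ ≤ b → a ≤ a + b
  a≤a+b {a} {b} 0≤b = subst (_≤ a + b) (ℚ.+-identityʳ a) (ℚ.+-monoʳ-≤ a 0≤b)

  a+[b-a]≡b : ∀ a b → a + (b - a) ≡ b
  a+[b-a]≡b = solve-∀ ℚ-ring

  p≤q⇒0≤q-p : ∀ {a b} → a ≤ b → 0ℚ ≤ b - a
  p≤q⇒0≤q-p {a} {b} a≤b = subst (_≤ b - a) (ℚ.+-inverseʳ a) (ℚ.+-monoˡ-≤ (- a) a≤b)

  0≤q-p⇒p≤q : ∀ {a b} → 0ℚ ≤ b - a → a ≤ b
  0≤q-p⇒p≤q {a} {b} 0≤b-a = subst (a ≤_) (a+[b-a]≡b a b) (a≤a+b 0≤b-a)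

  pow : ℚ → ℕ → ℚ
  pow x zero    = 1ℚ
  pow x (suc t) = x * pow x t

  0≤pow : ∀ {x} → 0ℚ ≤ x → ∀ t → 0ℚ ≤ pow x t
  0≤pow 0≤x zero    = 0≤1
  0≤pow 0≤x (suc t) = 0≤* 0≤x (0≤pow 0≤x t)

  pow-+ : ∀ x s t → pow x (s ℕ.+ t) ≡ pow x s * pow x t
  pow-+ x zero    t = sym (ℚ.*-identityˡ _)
  pow-+ x (suc s) t = trans (cong (x *_) (pow-+ x s t)) (sym (ℚ.*-assoc x (pow x s) (pow x t)))

  interchange : ∀ a b c d → (a * b) * (c * d) ≡ (a * c) * (b * d)
  interchange = solve-∀ ℚ-ring

  pow-* : ∀ x y t → pow (x * y) t ≡ pow x t * pow y t
  pow-* x y zero    = refl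
  pow-* x y (suc t) = trans (cong (x * y *_) (pow-* x y t)) (interchange x y (pow x t) (pow y t))

  pow-mono : ∀ {x y} → 0ℚ ≤ x → x ≤ y → ∀ t → pow x t ≤ pow y t
  pow-mono 0≤x x≤y zero    = ≤-refl
  pow-mono 0≤x x≤y (suc t) = *-mono 0≤x (0≤pow (≤-trans 0≤x x≤y) t) x≤y (pow-mono 0≤x x≤y t)

  pow≤1 : ∀ {x} → 0ℚ ≤ x → x ≤ 1ℚ → ∀ t → pow x t ≤ 1ℚ
  pow≤1 0≤x x≤1 zero    = ≤-refl
  pow≤1 0≤x x≤1 (suc t) = *-mono 0≤x 0≤1 x≤1 (pow≤1 0≤x x≤1 t)

  pow-antimono : ∀ {x} → 0ℚ ≤ x → x ≤ 1ℚ → ∀ {s t} → s ℕ.≤ t → pow x t ≤ pow x s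
  pow-antimono 0≤x x≤1 {t = t} ℕ.z≤n = pow≤1 0≤x x≤1 t
  pow-antimono 0≤x x≤1 (ℕ.s≤s s≤t)   = *-monoˡ 0≤x (pow-antimono 0≤x x≤1 s≤t)

  1≤pow : ∀ {x} → 1ℚ ≤ x → ∀ t → 1ℚ ≤ pow x t
  1≤pow 1≤x zero    = ≤-refl
  1≤pow 1≤x (suc t) = *-mono 0≤1 (≤-trans 0≤1 (1≤pow 1≤x t)) 1≤x (1≤pow 1≤x t)

  pow-monoʳ : ∀ {x} → 1ℚ ≤ x → ∀ {s t} → s ℕ.≤ t → pow x s ≤ pow x t
  pow-monoʳ 1≤x {t = t} ℕ.z≤n = 1≤pow 1≤x t
  pow-monoʳ 1≤x (ℕ.s≤s s≤t)   = *-monoˡ (≤-trans 0≤1 1≤x) (pow-monoʳ 1≤x s≤t)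

  ι : ℕ → ℚ
  ι m = (ℤ.+ m) / 1

  toℚᵘ-ι : ∀ m → toℚᵘ (ι m) ℚᵘ.≃ ℚᵘ.mkℚᵘ (ℤ.+ m) 0
  toℚᵘ-ι m = ℚ.toℚᵘ-fromℚᵘ (ℚᵘ.mkℚᵘ (ℤ.+ m) 0)

  ι-+ : ∀ m n → ι (m ℕ.+ n) ≡ ι m + ι n
  ι-+ m n = ℚ.toℚᵘ-injective (ℚᵘ.≃-trans (toℚᵘ-ι (m ℕ.+ n)) (ℚᵘ.≃-sym
    (ℚᵘ.≃-trans (ℚ.toℚᵘ-homo-+ (ι m) (ι n)) (ℚᵘ.≃-trans (ℚᵘ.+-cong (toℚᵘ-ι m) (toℚᵘ-ι n))
      (ℚᵘ.*≡* (cong (ℤ._* ℤ.1ℤ) (cong₂ ℤ._+_ (ℤ.*-identityʳ (ℤ.+ m)) (ℤ.*-identityʳ (ℤ.+ n)))))))))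

  ι-* : ∀ m n → ι (m ℕ.* n) ≡ ι m * ι n
  ι-* m n = ℚ.toℚᵘ-injective (ℚᵘ.≃-trans (toℚᵘ-ι (m ℕ.* n)) (ℚᵘ.≃-sym
    (ℚᵘ.≃-trans (ℚ.toℚᵘ-homo-* (ι m) (ι n)) (ℚᵘ.≃-trans (ℚᵘ.*-cong (toℚᵘ-ι m) (toℚᵘ-ι n))
      (ℚᵘ.*≡* (cong (ℤ._* ℤ.1ℤ) (sym (ℤ.pos-* m n))))))))

  0≤ι : ∀ m → 0ℚ ≤ ι m
  0≤ι m = ℚ.nonNegative⁻¹ (ι m) {{ℚ.normalize-nonNeg m 1}}

  ι-mono : ∀ {m n} → m ℕ.≤ n → ι m ≤ ι n
  ι-mono {m} {n} m≤n = subst (ι m ≤_) (trans (sym (ι-+ m (n ℕ.∸ m))) (cong ι (ℕ.m+[n∸m]≡n m≤n)))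
    (a≤a+b (0≤ι (n ℕ.∸ m)))

  0<ι : ∀ m .{{_ : ℕ.NonZero m}} → 0ℚ < ι m
  0<ι m = ℚ.positive⁻¹ (ι m) {{ℚ.normalize-pos m 1}}

  ι-suc : ∀ m → ι (suc m) ≡ ι m + 1ℚ
  ι-suc m = trans (cong ι (ℕ.+-comm 1 m)) (ι-+ m 1)

  ι-^ : ∀ a m → ι (a ℕ.^ m) ≡ pow (ι a) m
  ι-^ a zero    = refl
  ι-^ a (suc m) = trans (ι-* a (a ℕ.^ m)) (cong (ι a *_) (ι-^ a m))

  𝟙 : ∀ {A : Set} → Dec A → ℚ
  𝟙 d = if does d then 1ℚ else 0ℚ

  0≤𝟙 : ∀ {A : Set} (d : Dec A) → 0ℚ ≤ 𝟙 d
  0≤𝟙 (yes _) = 0≤1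
  0≤𝟙 (no _)  = ≤-refl

  𝟙≤1 : ∀ {A : Set} (d : Dec A) → 𝟙 d ≤ 1ℚ
  𝟙≤1 (yes _) = ≤-refl
  𝟙≤1 (no _)  = 0≤1

  𝟙-mono : ∀ {A B : Set} (d : Dec A) (e : Dec B) → (A → B) → 𝟙 d ≤ 𝟙 e
  𝟙-mono (no _)  e       f = 0≤𝟙 e
  𝟙-mono (yes a) (yes _) f = ≤-refl
  𝟙-mono (yes a) (no ¬b) f with () ← ¬b (f a)

  𝟙-false : ∀ {A : Set} (d : Dec A) → ¬ A → 𝟙 d ≡ 0ℚ
  𝟙-false (yes a) ¬a = contradiction a ¬a
  𝟙-false (no _)  ¬a = refl

  𝟙-true : ∀ {A : Set} (d : Dec A) → A → 𝟙 d ≡ 1ℚ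
  𝟙-true (yes _) _ = refl
  𝟙-true (no ¬a) a = contradiction a ¬a

  module _ {A : Set} where

    ∑ : List A → (A → ℚ) → ℚ
    ∑ []       f = 0ℚ
    ∑ (x ∷ xs) f = f x + ∑ xs f

    ∑-cong : ∀ xs {f g : A → ℚ} → (∀ x → f x ≡ g x) → ∑ xs f ≡ ∑ xs g
    ∑-cong []       f≡g = refl
    ∑-cong (x ∷ xs) f≡g = cong₂ _+_ (f≡g x) (∑-cong xs f≡g)

    ∑-mono : ∀ xs {f g : A → ℚ} → (∀ x → f x ≤ g x) → ∑ xs f ≤ ∑ xs g
    ∑-mono []       f≤g = ≤-refl
    ∑-mono (x ∷ xs) f≤g = ℚ.+-mono-≤ (f≤g x) (∑-mono xs f≤g)

    ∑-*ʳ : ∀ xs (f : A → ℚ) c → ∑ xs (λ x → f x * c) ≡ ∑ xs f * c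
    ∑-*ʳ []       f c = sym (ℚ.*-zeroˡ c)
    ∑-*ʳ (x ∷ xs) f c = trans (cong (f x * c +_) (∑-*ʳ xs f c)) (sym (ℚ.*-distribʳ-+ c (f x) (∑ xs f)))

    ∑-++ : ∀ xs ys (f : A → ℚ) → ∑ (xs ++ ys) f ≡ ∑ xs f + ∑ ys f
    ∑-++ []       ys f = sym (ℚ.+-identityˡ _)
    ∑-++ (x ∷ xs) ys f = trans (cong (f x +_) (∑-++ xs ys f)) (sym (ℚ.+-assoc (f x) (∑ xs f) (∑ ys f)))

    0≤∑ : ∀ xs {f : A → ℚ} → (∀ x → 0ℚ ≤ f x) → 0ℚ ≤ ∑ xs f
    0≤∑ []       0≤f = ≤-refl
    0≤∑ (x ∷ xs) 0≤f = 0≤+ (0≤f x) (0≤∑ xs 0≤f)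

    ∑-length : ∀ xs c → ∑ xs (λ _ → c) ≡ ι (length xs) * c
    ∑-length []       c = sym (ℚ.*-zeroˡ c)
    ∑-length (x ∷ xs) c = begin
      c + ∑ xs (λ _ → c)        ≡⟨ cong (c +_) (∑-length xs c) ⟩
      c + ι (length xs) * c     ≡⟨ lemma c (ι (length xs)) ⟩
      (ι (length xs) + 1ℚ) * c  ≡⟨ cong (_* c) (ι-suc (length xs)) ⟨
      ι (suc (length xs)) * c   ∎
      where
      open ≡-Reasoning
      lemma : ∀ c l → c + l * c ≡ (l + 1ℚ) * c
      lemma = solve-∀ ℚ-ring

    ∑-filter : ∀ {P : A → Set} (P? : Decidable P) xs (f : A → ℚ) →
      ∑ (filter P? xs) f ≡ ∑ xs (λ x → 𝟙 (P? x) * f x)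
    ∑-filter P? []       f = refl
    ∑-filter P? (x ∷ xs) f with P? x
    ... | yes _ = cong₂ _+_ (sym (ℚ.*-identityˡ (f x))) (∑-filter P? xs f)
    ... | no _  = trans (∑-filter P? xs f)
      (sym (trans (cong (_+ rest) (ℚ.*-zeroˡ (f x))) (ℚ.+-identityˡ rest)))
      where rest = ∑ xs (λ x → 𝟙 (P? x) * f x)

  ∑-map : ∀ {A B : Set} (g : A → B) xs (f : B → ℚ) → ∑ (map g xs) f ≡ ∑ xs (f ∘ g)
  ∑-map g []       f = refl
  ∑-map g (x ∷ xs) f = cong (f (g x) +_) (∑-map g xs f)

  ∑-concatMap : ∀ {A B : Set} (g : A → List B) xs (f : B → ℚ) →
    ∑ (concatMap g xs) f ≡ ∑ xs (λ x → ∑ (g x) f)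
  ∑-concatMap g []       f = refl
  ∑-concatMap g (x ∷ xs) f = trans (∑-++ (g x) (concatMap g xs) f) (cong (∑ (g x) f +_) (∑-concatMap g xs f))

  ι-length-filter : ∀ {A : Set} {P : A → Set} (P? : Decidable P) xs →
    ι (length (filter P? xs)) ≡ ∑ xs (λ x → 𝟙 (P? x))
  ι-length-filter P? xs = begin
    ι (length (filter P? xs))           ≡⟨ ℚ.*-identityʳ _ ⟨
    ι (length (filter P? xs)) * 1ℚ      ≡⟨ ∑-length (filter P? xs) 1ℚ ⟨
    ∑ (filter P? xs) (λ _ → 1ℚ)         ≡⟨ ∑-filter P? xs (λ _ → 1ℚ) ⟩
    ∑ xs (λ x → 𝟙 (P? x) * 1ℚ)          ≡⟨ ∑-cong xs (λ x → ℚ.*-identityʳ _) ⟩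
    ∑ xs (λ x → 𝟙 (P? x))               ∎
    where open ≡-Reasoning

  ∑-mono-∈ : ∀ {A : Set} (xs : List A) {f g : A → ℚ} → (∀ {x} → x ∈ xs → f x ≤ g x) → ∑ xs f ≤ ∑ xs g
  ∑-mono-∈ []       f≤g = ≤-refl
  ∑-mono-∈ (x ∷ xs) f≤g = ℚ.+-mono-≤ (f≤g (here refl)) (∑-mono-∈ xs (f≤g ∘ there))

  ∑-*ˡ : ∀ {A : Set} (xs : List A) c (f : A → ℚ) → ∑ xs (λ x → c * f x) ≡ c * ∑ xs f
  ∑-*ˡ []       c f = sym (ℚ.*-zeroʳ c)
  ∑-*ˡ (x ∷ xs) c f = trans (cong (c * f x +_) (∑-*ˡ xs c f)) (sym (ℚ.*-distribˡ-+ c (f x) (∑ xs f)))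

  ∑-zero-∈ : ∀ {A : Set} (xs : List A) {f : A → ℚ} → (∀ {x} → x ∈ xs → f x ≡ 0ℚ) → ∑ xs f ≡ 0ℚ
  ∑-zero-∈ []       f≡0 = refl
  ∑-zero-∈ (x ∷ xs) f≡0 = cong₂ _+_ (f≡0 (here refl)) (∑-zero-∈ xs (f≡0 ∘ there))

  ·≡ι* : ∀ m q → m · q ≡ ι m * q
  ·≡ι* zero    q = sym (ℚ.*-zeroˡ q)
  ·≡ι* (suc m) q = trans (cong (_+ q) (·≡ι* m q)) (trans (lemma (ι m) q) (cong (_* q) (sym (ι-suc m))))
    where
    lemma : ∀ m q → m * q + q ≡ (m + 1ℚ) * q
    lemma = solve-∀ ℚ-ring

  ι*recip : ∀ v → ι (suc v) * recip v ≡ 1ℚ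
  ι*recip v = trans (sym (·≡ι* (suc v) (recip v)))
    (ℚ.toℚᵘ-injective (ℚᵘ.≃-trans (toℚᵘ-· (suc v) v) (ℚᵘ.*≡* (ℤ.*-comm (ℤ.+ suc v) ℤ.1ℤ))))

-- Expectations over random subsets, written as weighted sums.

module RandomSubsets where

  open import Data.Fin.Subset using (Subset; inside; outside; _⊆_; ∣_∣; _∪_; _─_)
  open import Data.Fin.Subset.Properties using (drop-∷-⊆; out⊆; s⊆s; ⊆-refl; _⊆?_)
  open import Data.List.Base using (List; []; _∷_)
  open import Data.Nat.Base as ℕ using (ℕ; zero; suc)
  import Data.Nat.Properties as ℕ
  open import Data.Rational.Base hiding (_>_; _≥_; ∣_∣)
  open import Data.Rational.Properties as ℚ using (≤-refl; ≤-reflexive; ≤-trans)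
  open import Data.Vec.Base using ([]; _∷_; here)
  open import Function.Base using (_∘_)
  open import Relation.Binary.PropositionalEquality
  open import Relation.Nullary.Negation using (¬_; contradiction)
  open import Relation.Nullary.Decidable using (Dec; yes; no)
  open import Tactic.RingSolver using (solve-∀)
  open import Defs using (ℚ-ring)
  open Rationals

  private
    variable
      m : ℕ
      a b : ℚ

  -- ∫ a b f is the sum of a^|W| b^(m-|W|) f W over all subsets W of Fin m: with
  -- b = 1 - a it is the expectation over an a-random set, with a = b = 1 a plain sum.
  ∫ : ℚ → ℚ → (Subset m → ℚ) → ℚ
  ∫ {zero}  a b f = f []
  ∫ {suc m} a b f = a * ∫ a b (f ∘ (inside ∷_)) + b * ∫ a b (f ∘ (outside ∷_))

  ∫-cong : {f g : Subset m → ℚ} → (∀ W → f W ≡ g W) → ∫ a b f ≡ ∫ a b g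
  ∫-cong {zero}          f≡g = f≡g []
  ∫-cong {suc m} {a} {b} f≡g = cong₂ (λ x y → a * x + b * y)
    (∫-cong (f≡g ∘ (inside ∷_))) (∫-cong (f≡g ∘ (outside ∷_)))

  ∫-mono : 0ℚ ≤ a → 0ℚ ≤ b → {f g : Subset m → ℚ} → (∀ W → f W ≤ g W) → ∫ a b f ≤ ∫ a b g
  ∫-mono {m = zero}  0≤a 0≤b f≤g = f≤g []
  ∫-mono {m = suc m} 0≤a 0≤b f≤g = ℚ.+-mono-≤
    (*-monoˡ 0≤a (∫-mono 0≤a 0≤b (f≤g ∘ (inside ∷_))))
    (*-monoˡ 0≤b (∫-mono 0≤a 0≤b (f≤g ∘ (outside ∷_))))

  ∫-0 : ∀ a b → ∫ {m} a b (λ _ → 0ℚ) ≡ 0ℚ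
  ∫-0 {zero}  a b = refl
  ∫-0 {suc m} a b rewrite ∫-0 {m} a b = cong₂ _+_ (ℚ.*-zeroʳ a) (ℚ.*-zeroʳ b)

  0≤∫ : 0ℚ ≤ a → 0ℚ ≤ b → {f : Subset m → ℚ} → (∀ W → 0ℚ ≤ f W) → 0ℚ ≤ ∫ a b f
  0≤∫ {a} {b} {m} 0≤a 0≤b {f} 0≤f = subst (_≤ ∫ a b f) (∫-0 {m} a b) (∫-mono 0≤a 0≤b 0≤f)

  ∫-+ : ∀ a b (f g : Subset m → ℚ) → ∫ a b (λ W → f W + g W) ≡ ∫ a b f + ∫ a b g
  ∫-+ {zero}  a b f g = refl
  ∫-+ {suc m} a b f g = trans
    (cong₂ (λ x y → a * x + b * y) (∫-+ a b (f ∘ (inside ∷_)) _) (∫-+ a b (f ∘ (outside ∷_)) _))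
    (lemma a b (∫ a b (f ∘ (inside ∷_))) _ (∫ a b (f ∘ (outside ∷_))) _)
    where
    lemma : ∀ a b x y z w → a * (x + y) + b * (z + w) ≡ (a * x + b * z) + (a * y + b * w)
    lemma = solve-∀ ℚ-ring

  ∫-*ˡ : ∀ a b c (f : Subset m → ℚ) → ∫ a b (λ W → c * f W) ≡ c * ∫ a b f
  ∫-*ˡ {zero}  a b c f = refl
  ∫-*ˡ {suc m} a b c f = trans
    (cong₂ (λ x y → a * x + b * y) (∫-*ˡ a b c (f ∘ (inside ∷_))) (∫-*ˡ a b c (f ∘ (outside ∷_))))
    (lemma a b c (∫ a b (f ∘ (inside ∷_))) (∫ a b (f ∘ (outside ∷_))))
    where
    lemma : ∀ a b c x y → a * (c * x) + b * (c * y) ≡ c * (a * x + b * y)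
    lemma = solve-∀ ℚ-ring

  ∫-swap : ∀ a b c d {m n} (f : Subset m → Subset n → ℚ) →
    ∫ a b (λ W → ∫ c d (f W)) ≡ ∫ c d (λ Z → ∫ a b (λ W → f W Z))
  ∫-swap a b c d {zero}  f = refl
  ∫-swap a b c d {suc m} {n} f = begin
    a * ∫ a b (λ W → ∫ c d (f (inside ∷ W))) + b * ∫ a b (λ W → ∫ c d (f (outside ∷ W)))
      ≡⟨ cong₂ (λ x y → a * x + b * y) (∫-swap a b c d {m} {n} (f ∘ (inside ∷_)))
          (∫-swap a b c d {m} {n} (f ∘ (outside ∷_))) ⟩
    a * ∫ c d (λ Z → ∫ a b (λ W → f (inside ∷ W) Z)) + b * ∫ c d (λ Z → ∫ a b (λ W → f (outside ∷ W) Z))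
      ≡⟨ cong₂ _+_ (∫-*ˡ {n} c d a _) (∫-*ˡ {n} c d b _) ⟨
    ∫ c d (λ Z → a * ∫ a b (λ W → f (inside ∷ W) Z)) + ∫ c d (λ Z → b * ∫ a b (λ W → f (outside ∷ W) Z))
      ≡⟨ ∫-+ {n} c d _ _ ⟨
    ∫ c d (λ Z → ∫ a b (λ W → f W Z)) ∎
    where open ≡-Reasoning

  ∫-∑ : ∀ {A : Set} a b (xs : List A) (f : Subset m → A → ℚ) →
    ∫ a b (λ W → ∑ xs (f W)) ≡ ∑ xs (λ x → ∫ a b (λ W → f W x))
  ∫-∑ {m} a b []       f = ∫-0 {m} a b
  ∫-∑ a b (x ∷ xs) f = trans (∫-+ a b (λ W → f W x) _) (cong (∫ a b (λ W → f W x) +_) (∫-∑ a b xs f))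

  𝔼 : ℚ → (Subset m → ℚ) → ℚ
  𝔼 q = ∫ q (1ℚ - q)

  𝔼-const : ∀ q c → 𝔼 {m} q (λ _ → c) ≡ c
  𝔼-const {zero}  q c = refl
  𝔼-const {suc m} q c rewrite 𝔼-const {m} q c = lemma q c
    where
    lemma : ∀ q c → q * c + (1ℚ - q) * c ≡ c
    lemma = solve-∀ ℚ-ring

  infixl 6 _⊕_

  -- The density 1 - (1 - p)(1 - q) of the union of independent random sets of densities p and q.
  _⊕_ : ℚ → ℚ → ℚ
  p ⊕ q = p + q - p * q

  -- This is what permits exposing a random set in rounds. A point is outside the union only if both
  -- sets omit it, so of the four cases for the first coordinate three give X and one gives Y.
  𝔼-∪ : ∀ p q (f : Subset m → ℚ) → 𝔼 (p ⊕ q) f ≡ 𝔼 p (λ V → 𝔼 q (λ W → f (V ∪ W)))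
  𝔼-∪ {zero}  p q f = refl
  𝔼-∪ {suc m} p q f = begin
    (p ⊕ q) * 𝔼 (p ⊕ q) fᵢ + (1ℚ - (p ⊕ q)) * 𝔼 (p ⊕ q) fₒ
      ≡⟨ cong₂ (λ x y → (p ⊕ q) * x + (1ℚ - (p ⊕ q)) * y) (𝔼-∪ p q fᵢ) (𝔼-∪ p q fₒ) ⟩
    (p ⊕ q) * X + (1ℚ - (p ⊕ q)) * Y
      ≡⟨ lemma p q X Y ⟩
    p * (q * X + (1ℚ - q) * X) + (1ℚ - p) * (q * X + (1ℚ - q) * Y)
      ≡⟨ cong₂ (λ x y → p * x + (1ℚ - p) * y) (linear X X _ _ refl refl) (linear X Y _ _ refl refl) ⟨
    p * 𝔼 p (λ V → q * 𝔼 q (λ W → fᵢ (V ∪ W)) + (1ℚ - q) * 𝔼 q (λ W → fᵢ (V ∪ W)))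
      + (1ℚ - p) * 𝔼 p (λ V → q * 𝔼 q (λ W → fᵢ (V ∪ W)) + (1ℚ - q) * 𝔼 q (λ W → fₒ (V ∪ W))) ∎
    where
    open ≡-Reasoning
    fᵢ fₒ : Subset m → ℚ
    fᵢ = f ∘ (inside ∷_)
    fₒ = f ∘ (outside ∷_)
    X Y : ℚ
    X = 𝔼 p (λ V → 𝔼 q (λ W → fᵢ (V ∪ W)))
    Y = 𝔼 p (λ V → 𝔼 q (λ W → fₒ (V ∪ W)))
    linear : ∀ x y (g h : Subset m → ℚ) → 𝔼 p g ≡ x → 𝔼 p h ≡ y →
      𝔼 p (λ V → q * g V + (1ℚ - q) * h V) ≡ q * x + (1ℚ - q) * y
    linear x y g h refl refl = trans (∫-+ p (1ℚ - p) (λ V → q * g V) _)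
      (cong₂ _+_ (∫-*ˡ p (1ℚ - p) q g) (∫-*ˡ p (1ℚ - p) (1ℚ - q) h))
    lemma : ∀ p q X Y → (p + q - p * q) * X + (1ℚ - (p + q - p * q)) * Y
      ≡ p * (q * X + (1ℚ - q) * X) + (1ℚ - p) * (q * X + (1ℚ - q) * Y)
    lemma = solve-∀ ℚ-ring

  -- Induction on the coordinates takes the place of a coupling: once the other coordinates have
  -- density p, the mass q - p of the first one is moved from inside to outside, where f is larger.
  𝔼-antitone : ∀ {p q} → 0ℚ ≤ p → p ≤ q → q ≤ 1ℚ → {f : Subset m → ℚ} →
    (∀ {V W} → V ⊆ W → f W ≤ f V) → 𝔼 q f ≤ 𝔼 p f
  𝔼-antitone {zero}          0≤p p≤q q≤1     f↓ = ≤-refl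
  𝔼-antitone {suc m} {p} {q} 0≤p p≤q q≤1 {f} f↓ = begin
    q * 𝔼 q fᵢ + (1ℚ - q) * 𝔼 q fₒ
      ≤⟨ ℚ.+-mono-≤ (*-monoˡ 0≤q (𝔼-antitone 0≤p p≤q q≤1 (f↓ ∘ s⊆s)))
           (*-monoˡ 0≤1-q (𝔼-antitone 0≤p p≤q q≤1 (f↓ ∘ s⊆s))) ⟩
    q * 𝔼 p fᵢ + (1ℚ - q) * 𝔼 p fₒ
      ≡⟨ lemma₁ p q (𝔼 p fᵢ) (𝔼 p fₒ) ⟩
    p * 𝔼 p fᵢ + (1ℚ - q) * 𝔼 p fₒ + (q - p) * 𝔼 p fᵢ
      ≤⟨ ℚ.+-monoʳ-≤ (p * 𝔼 p fᵢ + (1ℚ - q) * 𝔼 p fₒ) (*-monoˡ (p≤q⇒0≤q-p p≤q)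
           (∫-mono 0≤p (p≤q⇒0≤q-p (≤-trans p≤q q≤1)) (λ W → f↓ {outside ∷ W} {inside ∷ W} (out⊆ ⊆-refl)))) ⟩
    p * 𝔼 p fᵢ + (1ℚ - q) * 𝔼 p fₒ + (q - p) * 𝔼 p fₒ
      ≡⟨ lemma₂ p q (𝔼 p fᵢ) (𝔼 p fₒ) ⟩
    p * 𝔼 p fᵢ + (1ℚ - p) * 𝔼 p fₒ ∎
    where
    open ℚ.≤-Reasoning
    fᵢ fₒ : Subset m → ℚ
    fᵢ = f ∘ (inside ∷_)
    fₒ = f ∘ (outside ∷_)
    0≤q = ≤-trans 0≤p p≤q
    0≤1-q = p≤q⇒0≤q-p q≤1
    lemma₁ : ∀ p q x y → q * x + (1ℚ - q) * y ≡ p * x + (1ℚ - q) * y + (q - p) * x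
    lemma₁ = solve-∀ ℚ-ring
    lemma₂ : ∀ p q x y → p * x + (1ℚ - q) * y + (q - p) * y ≡ p * x + (1ℚ - p) * y
    lemma₂ = solve-∀ ℚ-ring

  -- The indicator of `T ⊆ S`, recursive on the vectors so that it computes in step with `∫`; `𝟙-⊆?`
  -- links it to the decision procedure.
  sub : Subset m → Subset m → ℚ
  sub []            []            = 1ℚ
  sub (inside  ∷ T) (outside ∷ S) = 0ℚ
  sub (inside  ∷ T) (inside  ∷ S) = sub T S
  sub (outside ∷ T) (_       ∷ S) = sub T S

  0≤sub : ∀ (T S : Subset m) → 0ℚ ≤ sub T S
  0≤sub []            []            = 0≤1
  0≤sub (inside  ∷ T) (outside ∷ S) = ≤-refl
  0≤sub (inside  ∷ T) (inside  ∷ S) = 0≤sub T S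
  0≤sub (outside ∷ T) (_       ∷ S) = 0≤sub T S

  ⊆⇒sub≡1 : ∀ {T S : Subset m} → T ⊆ S → sub T S ≡ 1ℚ
  ⊆⇒sub≡1 {T = []}          {[]}          T⊆S = refl
  ⊆⇒sub≡1 {T = inside  ∷ T} {outside ∷ S} T⊆S with () ← T⊆S here
  ⊆⇒sub≡1 {T = inside  ∷ T} {inside  ∷ S} T⊆S = ⊆⇒sub≡1 (drop-∷-⊆ T⊆S)
  ⊆⇒sub≡1 {T = outside ∷ T} {_       ∷ S} T⊆S = ⊆⇒sub≡1 (drop-∷-⊆ T⊆S)

  ⊈⇒sub≡0 : ∀ {T S : Subset m} → ¬ T ⊆ S → sub T S ≡ 0ℚ
  ⊈⇒sub≡0 {T = []}          {[]}          T⊈S = contradiction (λ ()) T⊈S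
  ⊈⇒sub≡0 {T = inside  ∷ T} {outside ∷ S} T⊈S = refl
  ⊈⇒sub≡0 {T = inside  ∷ T} {inside  ∷ S} T⊈S = ⊈⇒sub≡0 (T⊈S ∘ s⊆s)
  ⊈⇒sub≡0 {T = outside ∷ T} {_       ∷ S} T⊈S = ⊈⇒sub≡0 (T⊈S ∘ out⊆)

  𝟙-⊆? : ∀ (T S : Subset m) → 𝟙 (T ⊆? S) ≡ sub T S
  𝟙-⊆? T S with T ⊆? S
  ... | yes T⊆S = sym (⊆⇒sub≡1 T⊆S)
  ... | no  T⊈S = sym (⊈⇒sub≡0 T⊈S)

  disj : Subset m → Subset m → ℚ
  disj []            []           = 1ℚ
  disj (inside  ∷ T) (inside ∷ W) = 0ℚ
  disj (inside  ∷ T) (outside ∷ W) = disj T W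
  disj (outside ∷ T) (_ ∷ W)      = disj T W

  0≤disj : ∀ (T W : Subset m) → 0ℚ ≤ disj T W
  0≤disj []            []            = 0≤1
  0≤disj (inside  ∷ T) (inside  ∷ W) = ≤-refl
  0≤disj (inside  ∷ T) (outside ∷ W) = 0≤disj T W
  0≤disj (outside ∷ T) (_       ∷ W) = 0≤disj T W

  disj-─ : ∀ (S W : Subset m) → disj (S ─ W) W ≡ 1ℚ
  disj-─ []            []            = refl
  disj-─ (inside  ∷ S) (inside  ∷ W) = disj-─ S W
  disj-─ (inside  ∷ S) (outside ∷ W) = disj-─ S W
  disj-─ (outside ∷ S) (inside  ∷ W) = disj-─ S W
  disj-─ (outside ∷ S) (outside ∷ W) = disj-─ S W

  -- Adding a set T disjoint from W multiplies the probability of W by (q / (1 - q))^|T|.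
  𝔼-shift : ∀ {q} → 0ℚ ≤ q → q ≤ 1ℚ → (T : Subset m) {g : Subset m → ℚ} → (∀ Z → 0ℚ ≤ g Z) →
    pow q ∣ T ∣ * 𝔼 q (λ W → disj T W * g (W ∪ T)) ≤ 𝔼 q g
  𝔼-shift 0≤q q≤1 [] 0≤g = ≤-reflexive (trans (ℚ.*-identityˡ _) (ℚ.*-identityˡ _))
  𝔼-shift {suc m} {q} 0≤q q≤1 (outside ∷ T) {g} 0≤g = begin
    pow q ∣ T ∣ * (q * 𝔼 q aᵢ + (1ℚ - q) * 𝔼 q aₒ)
      ≡⟨ lemma (pow q ∣ T ∣) q (𝔼 q aᵢ) (𝔼 q aₒ) ⟩
    q * (pow q ∣ T ∣ * 𝔼 q aᵢ) + (1ℚ - q) * (pow q ∣ T ∣ * 𝔼 q aₒ)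
      ≤⟨ ℚ.+-mono-≤ (*-monoˡ 0≤q (𝔼-shift 0≤q q≤1 T (0≤g ∘ (inside ∷_))))
           (*-monoˡ (p≤q⇒0≤q-p q≤1) (𝔼-shift 0≤q q≤1 T (0≤g ∘ (outside ∷_)))) ⟩
    q * 𝔼 q (g ∘ (inside ∷_)) + (1ℚ - q) * 𝔼 q (g ∘ (outside ∷_)) ∎
    where
    open ℚ.≤-Reasoning
    aᵢ aₒ : Subset m → ℚ
    aᵢ W = disj T W * g (inside ∷ (W ∪ T))
    aₒ W = disj T W * g (outside ∷ (W ∪ T))
    lemma : ∀ p q x y → p * (q * x + (1ℚ - q) * y) ≡ q * (p * x) + (1ℚ - q) * (p * y)
    lemma = solve-∀ ℚ-ring
  𝔼-shift {suc m} {q} 0≤q q≤1 (inside ∷ T) {g} 0≤g = begin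
    (q * pow q ∣ T ∣) * (q * 𝔼 q (λ W → 0ℚ * g (inside ∷ (W ∪ T))) + (1ℚ - q) * 𝔼 q h)
      ≡⟨ cong (λ x → (q * pow q ∣ T ∣) * (q * x + (1ℚ - q) * 𝔼 q h))
           (trans (∫-cong (λ W → ℚ.*-zeroˡ (g (inside ∷ (W ∪ T))))) (∫-0 {m} q (1ℚ - q))) ⟩
    (q * pow q ∣ T ∣) * (q * 0ℚ + (1ℚ - q) * 𝔼 q h)
      ≡⟨ lemma q (pow q ∣ T ∣) (𝔼 q h) ⟩
    (q * (1ℚ - q)) * (pow q ∣ T ∣ * 𝔼 q h)
      ≤⟨ *-monoˡ (0≤* 0≤q 0≤1-q) (𝔼-shift 0≤q q≤1 T (0≤g ∘ (inside ∷_))) ⟩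
    (q * (1ℚ - q)) * G
      ≤⟨ a≤a+b (0≤* (0≤* 0≤q 0≤q) 0≤G) ⟩
    (q * (1ℚ - q)) * G + q * q * G
      ≡⟨ lemma′ q G ⟩
    q * G
      ≤⟨ a≤a+b (0≤* 0≤1-q (0≤∫ 0≤q 0≤1-q (0≤g ∘ (outside ∷_)))) ⟩
    q * G + (1ℚ - q) * 𝔼 q (g ∘ (outside ∷_)) ∎
    where
    open ℚ.≤-Reasoning
    h : Subset m → ℚ
    h W = disj T W * g (inside ∷ (W ∪ T))
    G : ℚ
    G = 𝔼 q (g ∘ (inside ∷_))
    0≤1-q = p≤q⇒0≤q-p q≤1
    0≤G = 0≤∫ 0≤q 0≤1-q (0≤g ∘ (inside ∷_))
    lemma : ∀ q p x → (q * p) * (q * 0ℚ + (1ℚ - q) * x) ≡ (q * (1ℚ - q)) * (p * x)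
    lemma = solve-∀ ℚ-ring
    lemma′ : ∀ q x → (q * (1ℚ - q)) * x + q * q * x ≡ q * x
    lemma′ = solve-∀ ℚ-ring

  ∑⊆ : (Subset m → ℚ) → ℚ
  ∑⊆ = ∫ 1ℚ 1ℚ

  -- The binomial theorem: expanding the product of 1 + x over the elements of S amounts to choosing
  -- which of them go into T.
  ∑⊆-sub : ∀ (S : Subset m) x → ∑⊆ (λ T → pow x ∣ T ∣ * sub T S) ≡ pow (1ℚ + x) ∣ S ∣
  ∑⊆-sub []            x = refl
  ∑⊆-sub {suc m} (inside  ∷ S) x = begin
    1ℚ * ∑⊆ {m} (λ T → (x * pow x ∣ T ∣) * sub T S) + 1ℚ * ∑⊆ {m} (λ T → pow x ∣ T ∣ * sub T S)
      ≡⟨ cong (λ y → 1ℚ * y + 1ℚ * ∑⊆ {m} (λ T → pow x ∣ T ∣ * sub T S))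
           (trans (∫-cong {m} (λ T → ℚ.*-assoc x (pow x ∣ T ∣) (sub T S))) (∫-*ˡ 1ℚ 1ℚ x (λ T → pow x ∣ T ∣ * sub T S))) ⟩
    1ℚ * (x * ∑⊆ (λ T → pow x ∣ T ∣ * sub T S)) + 1ℚ * ∑⊆ {m} (λ T → pow x ∣ T ∣ * sub T S)
      ≡⟨ cong (λ y → 1ℚ * (x * y) + 1ℚ * y) (∑⊆-sub S x) ⟩
    1ℚ * (x * pow (1ℚ + x) ∣ S ∣) + 1ℚ * pow (1ℚ + x) ∣ S ∣
      ≡⟨ lemma x (pow (1ℚ + x) ∣ S ∣) ⟩
    (1ℚ + x) * pow (1ℚ + x) ∣ S ∣ ∎
    where
    open ≡-Reasoning
    lemma : ∀ x y → 1ℚ * (x * y) + 1ℚ * y ≡ (1ℚ + x) * y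
    lemma = solve-∀ ℚ-ring
  ∑⊆-sub {suc m} (outside ∷ S) x = begin
    1ℚ * ∑⊆ {m} (λ T → (x * pow x ∣ T ∣) * 0ℚ) + 1ℚ * ∑⊆ {m} (λ T → pow x ∣ T ∣ * sub T S)
      ≡⟨ cong₂ (λ y z → 1ℚ * y + 1ℚ * z)
           (trans (∫-cong {m} (λ T → ℚ.*-zeroʳ (x * pow x ∣ T ∣))) (∫-0 {m} 1ℚ 1ℚ)) (∑⊆-sub S x) ⟩
    1ℚ * 0ℚ + 1ℚ * pow (1ℚ + x) ∣ S ∣
      ≡⟨ lemma (pow (1ℚ + x) ∣ S ∣) ⟩
    pow (1ℚ + x) ∣ S ∣ ∎
    where
    open ≡-Reasoning
    lemma : ∀ y → 1ℚ * 0ℚ + 1ℚ * y ≡ y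
    lemma = solve-∀ ℚ-ring

  -- Controls the loss in one round: in `𝔼-lost`, S is the first edge inside Z, T runs over the
  -- possible fragments too large to be kept, and x is the ratio of spread parameter to density.
  tail : ℕ → ℚ → Subset m → ℚ
  tail c x S = ∑⊆ (λ T → 𝟙 (c ℕ.<? ∣ T ∣) * (pow x ∣ T ∣ * sub T S))

  -- Only the empty T fails `0 < ∣ T ∣`, so the full binomial sum loses just its term 1.
  tail-0 : ∀ (S : Subset m) x → tail 0 x S ≡ pow (1ℚ + x) ∣ S ∣ - 1ℚ
  tail-0 []            x = refl
  -- Once T contains the first point, `0 ℕ.<? ∣ T ∣` computes to true, and that half is the
  -- unrestricted sum of `∑⊆-sub`.
  tail-0 {suc m} (inside  ∷ S) x = begin
    1ℚ * ∑⊆ {m} (λ T → 1ℚ * ((x * pow x ∣ T ∣) * sub T S)) + 1ℚ * tail 0 x S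
      ≡⟨ cong₂ (λ y z → 1ℚ * y + 1ℚ * z)
           (trans (∫-cong {m} (λ T → trans (ℚ.*-identityˡ (x * pow x ∣ T ∣ * sub T S))
               (ℚ.*-assoc x (pow x ∣ T ∣) (sub T S))))
             (trans (∫-*ˡ 1ℚ 1ℚ x (λ T → pow x ∣ T ∣ * sub T S)) (cong (x *_) (∑⊆-sub S x))))
           (tail-0 S x) ⟩
    1ℚ * (x * pow (1ℚ + x) ∣ S ∣) + 1ℚ * (pow (1ℚ + x) ∣ S ∣ - 1ℚ)
      ≡⟨ lemma x (pow (1ℚ + x) ∣ S ∣) ⟩
    (1ℚ + x) * pow (1ℚ + x) ∣ S ∣ - 1ℚ ∎
    where
    open ≡-Reasoning
    lemma : ∀ x y → 1ℚ * (x * y) + 1ℚ * (y - 1ℚ) ≡ (1ℚ + x) * y - 1ℚ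
    lemma = solve-∀ ℚ-ring
  tail-0 {suc m} (outside ∷ S) x = begin
    1ℚ * ∑⊆ {m} (λ T → 1ℚ * ((x * pow x ∣ T ∣) * 0ℚ)) + 1ℚ * tail 0 x S
      ≡⟨ cong₂ (λ y z → 1ℚ * y + 1ℚ * z)
           (trans (∫-cong {m} (λ T → trans (ℚ.*-identityˡ (x * pow x ∣ T ∣ * 0ℚ)) (ℚ.*-zeroʳ (x * pow x ∣ T ∣))))
               (∫-0 {m} 1ℚ 1ℚ))
           (tail-0 S x) ⟩
    1ℚ * 0ℚ + 1ℚ * (pow (1ℚ + x) ∣ S ∣ - 1ℚ)
      ≡⟨ lemma (pow (1ℚ + x) ∣ S ∣) ⟩
    pow (1ℚ + x) ∣ S ∣ - 1ℚ ∎
    where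
    open ≡-Reasoning
    lemma : ∀ y → 1ℚ * 0ℚ + 1ℚ * (y - 1ℚ) ≡ y - 1ℚ
    lemma = solve-∀ ℚ-ring

  -- As x ≤ 1, every T that counts weighs at most x^c, and S has 2^|S| subsets; their number is
  -- obtained from `∑⊆-sub` at 1.
  tail-≤ : ∀ c {x} → 0ℚ ≤ x → x ≤ 1ℚ → (S : Subset m) → tail c x S ≤ pow x c * pow (1ℚ + 1ℚ) ∣ S ∣
  tail-≤ c {x} 0≤x x≤1 S = begin
    ∑⊆ (λ T → 𝟙 (c ℕ.<? ∣ T ∣) * (pow x ∣ T ∣ * sub T S))
      ≤⟨ ∫-mono 0≤1 0≤1 (λ T → bound T (c ℕ.<? ∣ T ∣)) ⟩
    ∑⊆ (λ T → pow x c * (pow 1ℚ ∣ T ∣ * sub T S))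
      ≡⟨ ∫-*ˡ 1ℚ 1ℚ (pow x c) (λ T → pow 1ℚ ∣ T ∣ * sub T S) ⟩
    pow x c * ∑⊆ (λ T → pow 1ℚ ∣ T ∣ * sub T S)
      ≡⟨ cong (pow x c *_) (∑⊆-sub S 1ℚ) ⟩
    pow x c * pow (1ℚ + 1ℚ) ∣ S ∣ ∎
    where
    open ℚ.≤-Reasoning
    bound : ∀ T (d : Dec (c ℕ.< ∣ T ∣)) →
      𝟙 d * (pow x ∣ T ∣ * sub T S) ≤ pow x c * (pow 1ℚ ∣ T ∣ * sub T S)
    bound T (yes c<t) = begin
      1ℚ * (pow x ∣ T ∣ * sub T S)       ≡⟨ ℚ.*-identityˡ _ ⟩
      pow x ∣ T ∣ * sub T S              ≤⟨ *-monoʳ (0≤sub T S) (pow-antimono 0≤x x≤1 (ℕ.<⇒≤ c<t)) ⟩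
      pow x c * sub T S                  ≡⟨ cong (pow x c *_) (ℚ.*-identityˡ _) ⟨
      pow x c * (1ℚ * sub T S)           ≤⟨ *-monoˡ (0≤pow 0≤x c) (*-monoʳ (0≤sub T S) (1≤pow ≤-refl ∣ T ∣)) ⟩
      pow x c * (pow 1ℚ ∣ T ∣ * sub T S) ∎
    bound T (no _) = begin
      0ℚ * (pow x ∣ T ∣ * sub T S)       ≡⟨ ℚ.*-zeroˡ (pow x ∣ T ∣ * sub T S) ⟩
      0ℚ                                 ≤⟨ 0≤* (0≤pow 0≤x c) (0≤* (0≤pow 0≤1 ∣ T ∣) (0≤sub T S)) ⟩
      pow x c * (pow 1ℚ ∣ T ∣ * sub T S) ∎

  ∑⊆-∋ : ∀ {f : Subset m → ℚ} → (∀ T → 0ℚ ≤ f T) → ∀ T → f T ≤ ∑⊆ f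
  ∑⊆-∋ {f = f} 0≤f []      = ≤-refl
  ∑⊆-∋ {f = f} 0≤f (inside ∷ T) = begin
    f (inside ∷ T)                     ≤⟨ ∑⊆-∋ (0≤f ∘ (inside ∷_)) T ⟩
    ∑⊆ (f ∘ (inside ∷_))               ≡⟨ ℚ.*-identityˡ _ ⟨
    1ℚ * ∑⊆ (f ∘ (inside ∷_))          ≤⟨ a≤a+b (0≤* 0≤1 (0≤∫ 0≤1 0≤1 (0≤f ∘ (outside ∷_)))) ⟩
    ∑⊆ f                               ∎
    where open ℚ.≤-Reasoning
  ∑⊆-∋ {f = f} 0≤f (outside ∷ T) = begin
    f (outside ∷ T)                    ≤⟨ ∑⊆-∋ (0≤f ∘ (outside ∷_)) T ⟩
    ∑⊆ (f ∘ (outside ∷_))              ≡⟨ ℚ.*-identityˡ _ ⟨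
    1ℚ * ∑⊆ (f ∘ (outside ∷_))         ≤⟨ a≤a+b (0≤* 0≤1 (0≤∫ 0≤1 0≤1 (0≤f ∘ (inside ∷_)))) ⟩
    1ℚ * ∑⊆ (f ∘ (outside ∷_)) + 1ℚ * ∑⊆ (f ∘ (inside ∷_)) ≡⟨ ℚ.+-comm (1ℚ * ∑⊆ (f ∘ (outside ∷_))) _ ⟩
    ∑⊆ f                               ∎
    where open ℚ.≤-Reasoning

-- Minimum fragments and the analysis of one round.

module Fragments where

  open import Data.Fin.Subset using (Subset; inside; outside; _∈_; _∉_; _⊆_; ∣_∣; ⊥; _∪_; _─_)
  open import Data.Fin.Subset.Properties
  open import Data.List.Base using (List; []; _∷_; length; filter; map)
  open import Data.List.Extrema.Nat using (argmin; argmin-all; f[argmin]≤f[xs])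
  open import Data.List.Membership.Propositional using (find; lose) renaming (_∈_ to _∈ˡ_)
  open import Data.List.Membership.Propositional.Properties using (∈-filter⁺; ∈-filter⁻; ∈-map⁻)
  open import Data.List.Properties using (length-map)
  open import Data.List.Relation.Unary.All as All using (All; []; _∷_)
  open import Data.List.Relation.Unary.All.Properties using (all-filter)
  open import Data.List.Relation.Unary.Any as Any using (Any; here; there; any?)
  open import Data.Nat.Base as ℕ using (ℕ; suc)
  import Data.Nat.Properties as ℕ
  open import Data.Product.Base using (_,_; proj₁; proj₂)
  open import Data.Rational.Base hiding (_>_; _≥_; ∣_∣)
  open import Data.Rational.Properties as ℚ using (≤-refl; ≤-reflexive; ≤-trans)
  open import Data.Sum.Base using (inj₁; inj₂; [_,_]′)
  open import Data.Vec.Base using ([]; _∷_; here; there)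
  open import Function.Base using (_∘_; id)
  open import Relation.Binary.PropositionalEquality
  open import Relation.Nullary.Negation using (contradiction)
  open import Relation.Nullary.Decidable using (Dec; yes; no; ¬?)
  open import Tactic.RingSolver using (solve-∀)
  open import Defs using (ℚ-ring)
  open Rationals
  open RandomSubsets

  private
    variable
      m : ℕ

  x∈p─q⇒x∉q : ∀ {x} (p q : Subset m) → x ∈ p ─ q → x ∉ q
  x∈p─q⇒x∉q (inside  ∷ p) (outside ∷ q) here       ()
  x∈p─q⇒x∉q (_       ∷ p) (_       ∷ q) (there x∈) (there x∈q) = x∈p─q⇒x∉q p q x∈ x∈q

  p⊆q∪r⇒p─r⊆q : ∀ (p q r : Subset m) → p ⊆ q ∪ r → p ─ r ⊆ q
  p⊆q∪r⇒p─r⊆q p q r p⊆q∪r x∈ = [ id , (λ x∈r → contradiction x∈r (x∈p─q⇒x∉q p r x∈)) ]′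
    (x∈p∪q⁻ q r (p⊆q∪r (p─q⊆p p r x∈)))

  p─q⊆r⇒p⊆q∪r : ∀ (p q r : Subset m) → p ─ q ⊆ r → p ⊆ q ∪ r
  p─q⊆r⇒p⊆q∪r p q r p─q⊆r {x} x∈p with x ∈? q
  ... | yes x∈q = x∈p∪q⁺ (inj₁ x∈q)
  ... | no  x∉q = x∈p∪q⁺ (inj₂ (p─q⊆r (x∈p∧x∉q⇒x∈p─q x∈p x∉q)))

  p⊆q∧∣q∣≤∣p∣⇒q⊆p : ∀ {p q : Subset m} → p ⊆ q → ∣ q ∣ ℕ.≤ ∣ p ∣ → q ⊆ p
  p⊆q∧∣q∣≤∣p∣⇒q⊆p {p = p} p⊆q ∣q∣≤∣p∣ {x} x∈q with x ∈? p
  ... | yes x∈p = x∈p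
  ... | no  x∉p = contradiction (p⊂q⇒∣p∣<∣q∣ (p⊆q , x , x∈q , x∉p)) (ℕ.≤⇒≯ ∣q∣≤∣p∣)

  sub-monoʳ : ∀ (U : Subset m) {S T} → S ⊆ T → sub U S ≤ sub U T
  sub-monoʳ U {S} {T} S⊆T = subst₂ _≤_ (𝟙-⊆? U S) (𝟙-⊆? U T)
    (𝟙-mono (U ⊆? S) (U ⊆? T) (λ U⊆S → ⊆-trans U⊆S S⊆T))

  deg : List (Subset m) → Subset m → ℚ
  deg F U = ∑ F (sub U)

  -- `s` plays the part of 1 / κ. M is not tied to `length F`, so that shrinking or dropping edges
  -- preserves the property with the same M.
  SpreadBy : ℚ → ℚ → List (Subset m) → Set
  SpreadBy {m} s M F = (U : Subset m) → deg F U ≤ pow s ∣ U ∣ * M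

  BoundedBy : ℕ → List (Subset m) → Set
  BoundedBy b = All (λ S → ∣ S ∣ ℕ.≤ b)

  miss : List (Subset m) → Subset m → ℚ
  miss F W = 𝟙 (¬? (any? (_⊆? W) F))

  -- core (filter (_⊆? Z) F) T says that T is contained in the first edge of F inside Z.
  core : List (Subset m) → Subset m → ℚ
  core []      T = 0ℚ
  core (K ∷ _) T = sub T K

  0≤core : ∀ (L : List (Subset m)) T → 0ℚ ≤ core L T
  0≤core []      T = ≤-refl
  0≤core (K ∷ _) T = 0≤sub T K

  core-≡1 : ∀ {L : List (Subset m)} {K T} → K ∈ˡ L → (∀ {K′} → K′ ∈ˡ L → T ⊆ K′) → core L T ≡ 1ℚ
  core-≡1 {L = _ ∷ _} _ T⊆ = ⊆⇒sub≡1 (T⊆ (here refl))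

  module _ {m : ℕ} (F : List (Subset m)) where

    -- S is the starting value of `argmin`. It lies inside `S ∪ W`, so for an edge S it is one of
    -- the competitors anyway.
    kernel : Subset m → Subset m → Subset m
    kernel S W = argmin (λ K → ∣ K ─ W ∣) S (filter (_⊆? (S ∪ W)) F)

    -- The minimum fragment of Park and Pham.
    frag : Subset m → Subset m → Subset m
    frag S W = kernel S W ─ W

    module _ {S} (S∈F : S ∈ˡ F) (W : Subset m) where

      kernel∈F : kernel S W ∈ˡ F
      kernel∈F = argmin-all (λ K → ∣ K ─ W ∣) {P = _∈ˡ F} S∈F (All.tabulate (proj₁ ∘ ∈-filter⁻ (_⊆? (S ∪ W)) {xs = F}))

      kernel⊆ : kernel S W ⊆ S ∪ W
      kernel⊆ = argmin-all (λ K → ∣ K ─ W ∣) {P = _⊆ S ∪ W} (p⊆p∪q W)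
          (All.tabulate (proj₂ ∘ ∈-filter⁻ (_⊆? (S ∪ W)) {xs = F}))

      frag-min : ∀ {K} → K ∈ˡ F → K ⊆ S ∪ W → ∣ frag S W ∣ ℕ.≤ ∣ K ─ W ∣
      frag-min K∈F K⊆ = All.lookup (f[argmin]≤f[xs] {f = λ K → ∣ K ─ W ∣} S (filter (_⊆? (S ∪ W)) F))
          (∈-filter⁺ (_⊆? (S ∪ W)) K∈F K⊆)

      frag⊆ : frag S W ⊆ S
      frag⊆ = p⊆q∪r⇒p─r⊆q (kernel S W) S W kernel⊆

      -- Minimality: an edge K inside W ∪ T, T being the fragment, has K ─ W ⊆ T and hence K ─ W = T.
      frag⊆edge : ∀ {K} → K ∈ˡ F → K ⊆ W ∪ frag S W → frag S W ⊆ K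
      frag⊆edge {K} K∈F K⊆ = ⊆-trans (p⊆q∧∣q∣≤∣p∣⇒q⊆p K─W⊆ (frag-min K∈F K⊆S∪W)) (p─q⊆p K W)
        where
        K─W⊆ : K ─ W ⊆ frag S W
        K─W⊆ = p⊆q∪r⇒p─r⊆q K (frag S W) W (subst (K ⊆_) (∪-comm W (frag S W)) K⊆)
        K⊆S∪W : K ⊆ S ∪ W
        K⊆S∪W x∈K = [ x∈p∪q⁺ ∘ inj₂ , x∈p∪q⁺ ∘ inj₁ ∘ frag⊆ ]′ (x∈p∪q⁻ W (frag S W) (K⊆ x∈K))

      -- The kernel shows that some edge lies inside `W ∪ frag S W`. Every such edge contains the
      -- fragment, hence so does the first one, which is found from the union alone, without knowing
      -- S.
      frag-core : core (filter (_⊆? (W ∪ frag S W)) F) (frag S W) ≡ 1ℚ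
      frag-core = core-≡1
        (∈-filter⁺ (_⊆? (W ∪ frag S W)) kernel∈F (p─q⊆r⇒p⊆q∪r (kernel S W) W (frag S W) ⊆-refl))
        (λ K∈ → let K∈F , K⊆ = ∈-filter⁻ (_⊆? (W ∪ frag S W)) {xs = F} K∈ in frag⊆edge K∈F K⊆)

    lost : ℕ → Subset m → ℚ
    lost c W = ∑ F (λ S → 𝟙 (c ℕ.<? ∣ frag S W ∣))

    next : ℕ → Subset m → List (Subset m)
    next c W = filter (λ T → ∣ T ∣ ℕ.≤? c) (map (λ S → frag S W) F)

    next-bounded : ∀ c W → BoundedBy c (next c W)
    next-bounded c W = all-filter (λ T → ∣ T ∣ ℕ.≤? c) (map (λ S → frag S W) F)

    -- A fragment lies in its edge and contains U only if the edge does, so degrees can only drop.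
    next-spread : ∀ {s M} c W → SpreadBy s M F → SpreadBy s M (next c W)
    next-spread {s} {M} c W F-spread U = begin
      ∑ (next c W) (sub U)
        ≡⟨ ∑-filter (λ T → ∣ T ∣ ℕ.≤? c) (map (λ S → frag S W) F) (sub U) ⟩
      ∑ (map (λ S → frag S W) F) (λ T → 𝟙 (∣ T ∣ ℕ.≤? c) * sub U T)
        ≡⟨ ∑-map (λ S → frag S W) F _ ⟩
      ∑ F (λ S → 𝟙 (∣ frag S W ∣ ℕ.≤? c) * sub U (frag S W))
        ≤⟨ ∑-mono-∈ F (λ {S} S∈F → ≤-trans
             (*-mono (0≤𝟙 (∣ frag S W ∣ ℕ.≤? c)) (0≤sub U S) (𝟙≤1 (∣ frag S W ∣ ℕ.≤? c)) (sub-monoʳ U (frag⊆ S∈F W)))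
             (≤-reflexive (ℚ.*-identityˡ (sub U S)))) ⟩
      ∑ F (sub U)
        ≤⟨ F-spread U ⟩
      pow s ∣ U ∣ * M ∎
      where open ℚ.≤-Reasoning

    next-length : ∀ c W → ι (length F) ≤ ι (length (next c W)) + lost c W
    next-length c W = begin
      ι (length F)
        ≡⟨ cong ι (length-map (λ S → frag S W) F) ⟨
      ι (length L)
        ≤⟨ split L ⟩
      ∑ L (λ T → 𝟙 (∣ T ∣ ℕ.≤? c)) + ∑ L (λ T → 𝟙 (c ℕ.<? ∣ T ∣))
        ≡⟨ cong₂ _+_ (sym (ι-length-filter (λ T → ∣ T ∣ ℕ.≤? c) L)) (∑-map (λ S → frag S W) F _) ⟩
      ι (length (next c W)) + lost c W ∎
      where
      open ℚ.≤-Reasoning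
      L = map (λ S → frag S W) F
      one : ∀ {t} (d : Dec (t ℕ.≤ c)) (e : Dec (c ℕ.< t)) → 1ℚ ≤ 𝟙 d + 𝟙 e
      one (yes _) e       = a≤a+b (0≤𝟙 e)
      one (no _)  (yes _) = ≤-refl
      one (no ≰)  (no ≮)  = contradiction (ℕ.≮⇒≥ ≮) ≰
      shuffle : ∀ a b c d → (a + b) + (c + d) ≡ (a + c) + (b + d)
      shuffle = solve-∀ ℚ-ring
      split : ∀ L → ι (length L) ≤ ∑ L (λ T → 𝟙 (∣ T ∣ ℕ.≤? c)) + ∑ L (λ T → 𝟙 (c ℕ.<? ∣ T ∣))
      split []      = ≤-refl
      split (T ∷ L) = begin
        ι (suc (length L))        ≡⟨ trans (ι-suc (length L)) (ℚ.+-comm (ι (length L)) 1ℚ) ⟩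
        1ℚ + ι (length L)         ≤⟨ ℚ.+-mono-≤ (one (∣ T ∣ ℕ.≤? c) (c ℕ.<? ∣ T ∣)) (split L) ⟩
        (𝟙 (∣ T ∣ ℕ.≤? c) + 𝟙 (c ℕ.<? ∣ T ∣)) + (∑ L (λ T → 𝟙 (∣ T ∣ ℕ.≤? c)) + ∑ L (λ T → 𝟙 (c ℕ.<? ∣ T ∣)))
                                  ≡⟨ shuffle (𝟙 (∣ T ∣ ℕ.≤? c)) _ _ _ ⟩
        _ ∎

    -- If W contains a surviving fragment `frag S V`, then `V ∪ W` contains the kernel it came from,
    -- and that is an edge of F.
    miss-next : ∀ c V W → miss F (V ∪ W) ≤ miss (next c V) W
    miss-next c V W = 𝟙-mono (¬? (any? (_⊆? (V ∪ W)) F)) (¬? (any? (_⊆? W) (next c V))) λ F-misses next-hits →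
      let T , T∈next , T⊆W = find next-hits
          T∈map , _ = ∈-filter⁻ (λ T → ∣ T ∣ ℕ.≤? c) {xs = map (λ S → frag S V) F} T∈next
          S , S∈F , T≡frag = ∈-map⁻ (λ S → frag S V) T∈map
      in F-misses (lose (kernel∈F S∈F V) (p─q⊆r⇒p⊆q∪r (kernel S V) V W (subst (_⊆ W) T≡frag T⊆W)))

    -- Sum over the possible fragments T first and substitute Z = W ∪ T: the first edge inside Z
    -- depends on Z only and contains T, so few T are possible, and at most deg T edges S contain T.
    𝔼-lost : ∀ {s M q x b τ} c → 0ℚ ≤ M → 0ℚ ≤ q → q ≤ 1ℚ → 0ℚ ≤ x → s ≡ q * x → 0ℚ ≤ τ →
      (∀ S → ∣ S ∣ ℕ.≤ b → tail c x S ≤ τ) → BoundedBy b F → SpreadBy s M F →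
      𝔼 q (lost c) ≤ M * τ
    𝔼-lost {s} {M} {q} {x} {b} {τ} c 0≤M 0≤q q≤1 0≤x s≡qx 0≤τ tail≤τ F-bounded F-spread = begin
      𝔼 q (lost c)
        ≤⟨ ∫-mono 0≤q 0≤1-q (λ W → ∑-mono-∈ F (λ S∈F → expand S∈F W)) ⟩
      𝔼 q (λ W → ∑ F (λ S → ∑⊆ (λ T → h T * (sub T S * a T W))))
        ≡⟨ ∫-cong {m} (λ W → sym (∫-∑ 1ℚ 1ℚ F (λ T S → h T * (sub T S * a T W)))) ⟩
      𝔼 q (λ W → ∑⊆ (λ T → ∑ F (λ S → h T * (sub T S * a T W))))
        ≡⟨ ∫-cong {m} (λ W → ∫-cong {m} (λ T → collect T (a T W))) ⟩
      𝔼 q (λ W → ∑⊆ (λ T → h T * deg F T * a T W))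
        ≡⟨ ∫-swap q (1ℚ - q) 1ℚ 1ℚ {m} {m} (λ W T → h T * deg F T * a T W) ⟩
      ∑⊆ (λ T → 𝔼 q (λ W → h T * deg F T * a T W))
        ≤⟨ ∫-mono 0≤1 0≤1 shift ⟩
      ∑⊆ (λ T → 𝔼 q (λ Z → h T * (M * pow x ∣ T ∣) * g T Z))
        ≡⟨ ∫-swap q (1ℚ - q) 1ℚ 1ℚ {m} {m} (λ Z T → h T * (M * pow x ∣ T ∣) * g T Z) ⟨
      𝔼 q (λ Z → ∑⊆ (λ T → h T * (M * pow x ∣ T ∣) * g T Z))
        ≤⟨ ∫-mono 0≤q 0≤1-q (λ Z → bound (filter (_⊆? Z) F) (proj₁ ∘ ∈-filter⁻ (_⊆? Z) {xs = F})) ⟩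
      𝔼 {m} q (λ _ → M * τ)
        ≡⟨ 𝔼-const {m} q (M * τ) ⟩
      M * τ ∎
      where
      open ℚ.≤-Reasoning
      0≤1-q = p≤q⇒0≤q-p q≤1
      h : Subset m → ℚ
      h T = 𝟙 (c ℕ.<? ∣ T ∣)
      0≤h : ∀ T → 0ℚ ≤ h T
      0≤h T = 0≤𝟙 (c ℕ.<? ∣ T ∣)
      g a : Subset m → Subset m → ℚ
      g T Z = core (filter (_⊆? Z) F) T
      a T W = disj T W * g T (W ∪ T)
      0≤a : ∀ T W → 0ℚ ≤ a T W
      0≤a T W = 0≤* (0≤disj T W) (0≤core (filter (_⊆? (W ∪ T)) F) T)

      -- Of the sum only the term T = `frag S W` is kept: there `sub`, `disj` and `core` are all 1.
      expand : ∀ {S} → S ∈ˡ F → ∀ W → h (frag S W) ≤ ∑⊆ (λ T → h T * (sub T S * a T W))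
      expand {S} S∈F W = begin
        h T₀                             ≡⟨ ℚ.*-identityʳ (h T₀) ⟨
        h T₀ * (1ℚ * (1ℚ * 1ℚ))
          ≡⟨ cong₂ (λ y z → h T₀ * (y * (z * 1ℚ))) (⊆⇒sub≡1 (frag⊆ S∈F W)) (disj-─ (kernel S W) W) ⟨
        h T₀ * (sub T₀ S * (disj T₀ W * 1ℚ)) ≡⟨ cong (λ y → h T₀ * (sub T₀ S * (disj T₀ W * y))) (frag-core S∈F W) ⟨
        h T₀ * (sub T₀ S * a T₀ W)       ≤⟨ ∑⊆-∋ (λ T → 0≤* (0≤h T) (0≤* (0≤sub T S) (0≤a T W))) T₀ ⟩
        ∑⊆ (λ T → h T * (sub T S * a T W)) ∎
        where T₀ = frag S W

      reassoc : ∀ h y z → h * (y * z) ≡ y * (h * z)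
      reassoc = solve-∀ ℚ-ring

      collect : ∀ T z → ∑ F (λ S → h T * (sub T S * z)) ≡ h T * deg F T * z
      collect T z = trans (∑-cong F (λ S → reassoc (h T) (sub T S) z))
        (trans (∑-*ʳ F (sub T) (h T * z)) (reassoc′ (deg F T) (h T) z))
        where
        reassoc′ : ∀ d h z → d * (h * z) ≡ h * d * z
        reassoc′ = solve-∀ ℚ-ring

      -- The spread bound s^|T| M splits as q^|T| x^|T| M, and the factor q^|T| is exactly what
      -- `𝔼-shift` charges for passing from W to Z = W ∪ T.
      shift : ∀ T → 𝔼 q (λ W → h T * deg F T * a T W) ≤ 𝔼 q (λ Z → h T * (M * pow x ∣ T ∣) * g T Z)
      shift T = begin
        𝔼 q (λ W → h T * deg F T * a T W)      ≡⟨ ∫-*ˡ q (1ℚ - q) (h T * deg F T) (a T) ⟩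
        h T * deg F T * 𝔼 q (a T)
          ≤⟨ *-monoʳ (0≤∫ 0≤q 0≤1-q (0≤a T)) (*-monoˡ (0≤h T) (F-spread T)) ⟩
        h T * (pow s ∣ T ∣ * M) * 𝔼 q (a T)
          ≡⟨ cong (λ y → h T * (y * M) * 𝔼 q (a T)) (trans (cong (λ y → pow y ∣ T ∣) s≡qx) (pow-* q x ∣ T ∣)) ⟩
        h T * (pow q ∣ T ∣ * pow x ∣ T ∣ * M) * 𝔼 q (a T)
          ≡⟨ regroup (h T) (pow q ∣ T ∣) (pow x ∣ T ∣) M (𝔼 q (a T)) ⟩
        h T * (M * pow x ∣ T ∣) * (pow q ∣ T ∣ * 𝔼 q (a T))
          ≤⟨ *-monoˡ (0≤* (0≤h T) (0≤* 0≤M (0≤pow 0≤x ∣ T ∣)))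
               (𝔼-shift 0≤q q≤1 T (λ Z → 0≤core (filter (_⊆? Z) F) T)) ⟩
        h T * (M * pow x ∣ T ∣) * 𝔼 q (g T)
          ≡⟨ ∫-*ˡ q (1ℚ - q) (h T * (M * pow x ∣ T ∣)) (g T) ⟨
        𝔼 q (λ Z → h T * (M * pow x ∣ T ∣) * g T Z) ∎
        where
        regroup : ∀ h p y M e → h * (p * y * M) * e ≡ h * (M * y) * (p * e)
        regroup = solve-∀ ℚ-ring

      -- For L the list of edges inside Z, `core` confines T to the subsets of the first edge K, and
      -- what is left is `tail c x K`.
      bound : ∀ L → (∀ {K} → K ∈ˡ L → K ∈ˡ F) → ∑⊆ (λ T → h T * (M * pow x ∣ T ∣) * core L T) ≤ M * τ
      bound [] _ = begin
        ∑⊆ (λ T → h T * (M * pow x ∣ T ∣) * 0ℚ)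
          ≡⟨ trans (∫-cong {m} (λ T → ℚ.*-zeroʳ (h T * (M * pow x ∣ T ∣)))) (∫-0 {m} 1ℚ 1ℚ) ⟩
        0ℚ     ≤⟨ 0≤* 0≤M 0≤τ ⟩
        M * τ  ∎
      bound (K ∷ L) L⊆F = begin
        ∑⊆ (λ T → h T * (M * pow x ∣ T ∣) * sub T K)
          ≡⟨ ∫-cong {m} (λ T → regroup (h T) M (pow x ∣ T ∣) (sub T K)) ⟩
        ∑⊆ (λ T → M * (h T * (pow x ∣ T ∣ * sub T K)))
          ≡⟨ ∫-*ˡ 1ℚ 1ℚ M (λ T → h T * (pow x ∣ T ∣ * sub T K)) ⟩
        M * tail c x K
          ≤⟨ *-monoˡ 0≤M (tail≤τ K (All.lookup F-bounded (L⊆F (here refl)))) ⟩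
        M * τ  ∎
        where
        regroup : ∀ h M y z → h * (M * y) * z ≡ M * (h * (y * z))
        regroup = solve-∀ ℚ-ring

  -- With M = length F it says that the Q-random set misses all edges with probability at most η;
  -- allowing length F < M makes it stable under losing edges.
  Covers : ℕ → ℚ → ℕ → ℚ → ℚ → Set
  Covers m s b Q η = (F : List (Subset m)) (M : ℚ) → 0ℚ ≤ M → BoundedBy b F → SpreadBy s M F →
    M * 𝔼 Q (miss F) + ι (length F) ≤ M + M * η

  -- An empty F is always missed, but contributes length 0. Otherwise its edges are empty sets,
  -- which are never missed, and the spread condition at ⊥ gives `length F ≤ M`.
  covers-zero : ∀ {s} → Covers m s 0 0ℚ 0ℚ
  covers-zero {m} [] M 0≤M _ _ = ≤-reflexive (trans (cong (λ y → M * y + 0ℚ) (𝔼-const {m} 0ℚ 1ℚ)) (lemma M))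
    where
    lemma : ∀ M → M * 1ℚ + 0ℚ ≡ M + M * 0ℚ
    lemma = solve-∀ ℚ-ring
  covers-zero {m} {s} F@(S ∷ F′) M 0≤M (∣S∣≤0 ∷ _) F-spread = begin
    M * 𝔼 0ℚ (miss F) + ι (length F)
      ≡⟨ cong (λ y → M * y + ι (length F)) (trans (∫-cong {m} hit) (∫-0 {m} 0ℚ (1ℚ - 0ℚ))) ⟩
    M * 0ℚ + ι (length F)
      ≤⟨ ℚ.+-monoʳ-≤ (M * 0ℚ) F≤M ⟩
    M * 0ℚ + M
      ≡⟨ lemma M ⟩
    M + M * 0ℚ ∎
    where
    open ℚ.≤-Reasoning
    lemma : ∀ M → M * 0ℚ + M ≡ M + M * 0ℚ
    lemma = solve-∀ ℚ-ring
    S⊆ : ∀ {W} → S ⊆ W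
    S⊆ = ⊆-trans (p⊆q∧∣q∣≤∣p∣⇒q⊆p (⊆-min S) (ℕ.≤-trans ∣S∣≤0 ℕ.z≤n)) (⊆-min _)
    hit : ∀ W → miss F W ≡ 0ℚ
    hit W = 𝟙-false (¬? (any? (_⊆? W) F)) (λ ¬a → ¬a (here S⊆))
    F≤M : ι (length F) ≤ M
    F≤M = begin
      ι (length F)             ≡⟨ ℚ.*-identityʳ _ ⟨
      ι (length F) * 1ℚ        ≡⟨ ∑-length F 1ℚ ⟨
      ∑ F (λ _ → 1ℚ)           ≡⟨ ∑-cong F (λ S → sym (⊆⇒sub≡1 (⊆-min S))) ⟩
      ∑ F (sub ⊥)              ≤⟨ F-spread ⊥ ⟩
      pow s ∣ ⊥ {m} ∣ * M      ≡⟨ cong (λ t → pow s t * M) (∣⊥∣≡0 m) ⟩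
      1ℚ * M                   ≡⟨ ℚ.*-identityˡ M ⟩
      M                        ∎

  -- For a fixed outcome V of the first round the hypothesis applies to `next F c V` with the same
  -- M. The missing edges `lost F c V` are added on the right, and their expectation is at most M τ.
  covers-step : ∀ {s b c Q η q x τ} → Covers m s c Q η →
    0ℚ ≤ Q → Q ≤ 1ℚ → 0ℚ ≤ q → q ≤ 1ℚ → 0ℚ ≤ x → s ≡ q * x → 0ℚ ≤ τ →
    (∀ (S : Subset m) → ∣ S ∣ ℕ.≤ b → tail c x S ≤ τ) → Covers m s b (q ⊕ Q) (τ + η)
  covers-step {m} {s} {b} {c} {Q} {η} {q} {x} {τ} covers 0≤Q Q≤1 0≤q q≤1 0≤x s≡qx 0≤τ tail≤τ
      F M 0≤M F-bounded F-spread = begin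
    M * 𝔼 (q ⊕ Q) (miss F) + ℓ
      ≡⟨ cong (λ y → M * y + ℓ) (𝔼-∪ q Q (miss F)) ⟩
    M * 𝔼 q (λ V → 𝔼 Q (λ W → miss F (V ∪ W))) + ℓ
      ≡⟨ cong₂ _+_ (∫-*ˡ {m} q (1ℚ - q) M _) (𝔼-const {m} q ℓ) ⟨
    𝔼 q (λ V → M * 𝔼 Q (λ W → miss F (V ∪ W))) + 𝔼 {m} q (λ _ → ℓ)
      ≡⟨ ∫-+ {m} q (1ℚ - q) _ _ ⟨
    𝔼 q (λ V → M * 𝔼 Q (λ W → miss F (V ∪ W)) + ℓ)
      ≤⟨ ∫-mono 0≤q (p≤q⇒0≤q-p q≤1) pointwise ⟩
    𝔼 q (λ V → (M + M * η) + lost F c V)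
      ≡⟨ ∫-+ {m} q (1ℚ - q) _ _ ⟩
    𝔼 {m} q (λ _ → M + M * η) + 𝔼 q (lost F c)
      ≡⟨ cong (_+ 𝔼 q (lost F c)) (𝔼-const {m} q (M + M * η)) ⟩
    (M + M * η) + 𝔼 q (lost F c)
      ≤⟨ ℚ.+-monoʳ-≤ (M + M * η) (𝔼-lost F c 0≤M 0≤q q≤1 0≤x s≡qx 0≤τ tail≤τ F-bounded F-spread) ⟩
    (M + M * η) + M * τ
      ≡⟨ lemma M η τ ⟩
    M + M * (τ + η) ∎
    where
    open ℚ.≤-Reasoning
    ℓ = ι (length F)
    lemma : ∀ M η τ → (M + M * η) + M * τ ≡ M + M * (τ + η)
    lemma = solve-∀ ℚ-ring
    pointwise : ∀ V → M * 𝔼 Q (λ W → miss F (V ∪ W)) + ℓ ≤ (M + M * η) + lost F c V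
    pointwise V = begin
      M * 𝔼 Q (λ W → miss F (V ∪ W)) + ℓ
        ≤⟨ ℚ.+-mono-≤ (*-monoˡ 0≤M (∫-mono 0≤Q (p≤q⇒0≤q-p Q≤1) (miss-next F c V))) (next-length F c V) ⟩
      M * 𝔼 Q (miss (next F c V)) + (ι (length (next F c V)) + lost F c V)
        ≡⟨ ℚ.+-assoc (M * 𝔼 Q (miss (next F c V))) (ι (length (next F c V))) (lost F c V) ⟨
      M * 𝔼 Q (miss (next F c V)) + ι (length (next F c V)) + lost F c V
        ≤⟨ ℚ.+-monoˡ-≤ (lost F c V)
             (covers (next F c V) M 0≤M (next-bounded F c V) (next-spread F c V F-spread)) ⟩
      (M + M * η) + lost F c V ∎

  miss-antitone : ∀ (F : List (Subset m)) {V W} → V ⊆ W → miss F W ≤ miss F V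
  miss-antitone F {V} {W} V⊆W = 𝟙-mono (¬? (any? (_⊆? W) F)) (¬? (any? (_⊆? V) F))
    (λ ¬W → ¬W ∘ Any.map {P = _⊆ V} {Q = _⊆ W} (λ S⊆V → ⊆-trans S⊆V V⊆W))

  covers-mono : ∀ {s b Q Q′ η η′} → 0ℚ ≤ Q → Q ≤ Q′ → Q′ ≤ 1ℚ → η ≤ η′ →
    Covers m s b Q η → Covers m s b Q′ η′
  covers-mono {m} {s} {b} {Q} {Q′} {η} {η′} 0≤Q Q≤Q′ Q′≤1 η≤η′ covers F M 0≤M F-bounded F-spread = begin
    M * 𝔼 Q′ (miss F) + ι (length F)
      ≤⟨ ℚ.+-monoˡ-≤ (ι (length F)) (*-monoˡ 0≤M (𝔼-antitone 0≤Q Q≤Q′ Q′≤1 (miss-antitone F))) ⟩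
    M * 𝔼 Q (miss F) + ι (length F)
      ≤⟨ covers F M 0≤M F-bounded F-spread ⟩
    M + M * η
      ≤⟨ ℚ.+-monoʳ-≤ M (*-monoˡ 0≤M η≤η′) ⟩
    M + M * η′ ∎
    where open ℚ.≤-Reasoning

-- The sequence of rounds, its total density and its total loss.

module Rounds where

  open import Data.Fin.Subset using (Subset; ∣_∣)
  open import Data.List.Base using (List; length)
  open import Data.Nat.Base as ℕ using (ℕ; zero; suc)
  import Data.Nat.Properties as ℕ
  open import Data.Nat.Tactic.RingSolver renaming (solve-∀ to solve-∀ᴺ)
  open import Data.Rational.Base hiding (_>_; _≥_; ∣_∣)
  open import Data.Rational.Properties as ℚ using (≤-refl; ≤-reflexive; ≤-trans)
  open import Relation.Binary.PropositionalEquality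
  open import Tactic.RingSolver using (solve-∀)
  open import Defs using (ℚ-ring; recip; recip-nonNeg)
  open Rationals
  open RandomSubsets
  open Fragments

  private
    variable
      m : ℕ

  recip≤1 : ∀ v → recip v ≤ 1ℚ
  recip≤1 v = begin
    recip v               ≡⟨ ℚ.*-identityˡ _ ⟨
    1ℚ * recip v          ≤⟨ *-monoʳ (recip-nonNeg v) (ι-mono {1} {suc v} (ℕ.s≤s ℕ.z≤n)) ⟩
    ι (suc v) * recip v   ≡⟨ ι*recip v ⟩
    1ℚ ∎
    where open ℚ.≤-Reasoning

  0≤½ : 0ℚ ≤ ½
  0≤½ = ℚ.nonNegative⁻¹ ½

  ½≤1 : ½ ≤ 1ℚ
  ½≤1 = ℚ.≤ᵇ⇒≤ _

  ι*pow½≤1 : ∀ t → ι t * pow ½ t ≤ 1ℚ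
  ι*pow½≤1 zero    = ≤-trans (≤-reflexive (ℚ.*-zeroˡ 1ℚ)) 0≤1
  ι*pow½≤1 (suc t) = begin
    ι (suc t) * (½ * pow ½ t)             ≡⟨ cong (_* (½ * pow ½ t)) (ι-suc t) ⟩
    (ι t + 1ℚ) * (½ * pow ½ t)            ≡⟨ lemma (ι t) ½ (pow ½ t) ⟩
    ½ * (ι t * pow ½ t) + ½ * pow ½ t     ≤⟨ ℚ.+-mono-≤ (*-monoˡ 0≤½ (ι*pow½≤1 t)) (*-monoˡ 0≤½ (pow≤1 0≤½ ½≤1 t)) ⟩
    ½ * 1ℚ + ½ * 1ℚ                       ≡⟨⟩
    1ℚ ∎
    where
    open ℚ.≤-Reasoning
    lemma : ∀ t h p → (t + 1ℚ) * (h * p) ≡ h * (t * p) + h * p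
    lemma = solve-∀ ℚ-ring

  pow½≤recip : ∀ v → pow ½ (suc v) ≤ recip v
  pow½≤recip v = begin
    pow ½ (suc v)                            ≡⟨ ℚ.*-identityʳ _ ⟨
    pow ½ (suc v) * 1ℚ                       ≡⟨ cong (pow ½ (suc v) *_) (ι*recip v) ⟨
    pow ½ (suc v) * (ι (suc v) * recip v)    ≡⟨ lemma (pow ½ (suc v)) (ι (suc v)) (recip v) ⟩
    (ι (suc v) * pow ½ (suc v)) * recip v    ≤⟨ *-monoʳ (recip-nonNeg v) (ι*pow½≤1 (suc v)) ⟩
    1ℚ * recip v                             ≡⟨ ℚ.*-identityˡ _ ⟩
    recip v ∎
    where
    open ℚ.≤-Reasoning
    lemma : ∀ a b c → a * (b * c) ≡ (b * a) * c
    lemma = solve-∀ ℚ-ring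

  2ℚ : ℚ
  2ℚ = 1ℚ + 1ℚ

  0≤2 : 0ℚ ≤ 2ℚ
  0≤2 = 0≤+ 0≤1 0≤1

  1≤2 : 1ℚ ≤ 2ℚ
  1≤2 = a≤a+b {1ℚ} {1ℚ} 0≤1

  -- A converse to Bernoulli's inequality: while 2tx ≤ 1, the cross term x · 2tx of the induction
  -- step is at most x, and the doubled linear term has room for it.
  pow-1+≤ : ∀ {x} t → 0ℚ ≤ x → 2ℚ * (ι t * x) ≤ 1ℚ → pow (1ℚ + x) t ≤ 1ℚ + 2ℚ * (ι t * x)
  pow-1+≤ {x} zero    0≤x _ = a≤a+b {1ℚ} (0≤* 0≤2 (0≤* (0≤ι 0) 0≤x))
  pow-1+≤ {x} (suc t) 0≤x 2tx≤1 = begin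
    (1ℚ + x) * pow (1ℚ + x) t                  ≤⟨ *-monoˡ (0≤+ 0≤1 0≤x) (pow-1+≤ t 0≤x 2tx≤1′) ⟩
    (1ℚ + x) * (1ℚ + 2ℚ * (ι t * x))           ≡⟨ lemma₁ x (2ℚ * (ι t * x)) ⟩
    (1ℚ + 2ℚ * (ι t * x) + x) + x * (2ℚ * (ι t * x)) ≤⟨ ℚ.+-monoʳ-≤ (1ℚ + 2ℚ * (ι t * x) + x) (*-monoˡ 0≤x 2tx≤1′) ⟩
    (1ℚ + 2ℚ * (ι t * x) + x) + x * 1ℚ         ≡⟨ lemma₂ x (ι t) ⟩
    1ℚ + 2ℚ * ((ι t + 1ℚ) * x)                 ≡⟨ cong (λ y → 1ℚ + 2ℚ * (y * x)) (ι-suc t) ⟨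
    1ℚ + 2ℚ * (ι (suc t) * x)                  ∎
    where
    open ℚ.≤-Reasoning
    2tx≤1′ : 2ℚ * (ι t * x) ≤ 1ℚ
    2tx≤1′ = ≤-trans (*-monoˡ 0≤2 (*-monoʳ 0≤x (ι-mono (ℕ.n≤1+n t)))) 2tx≤1
    lemma₁ : ∀ x y → (1ℚ + x) * (1ℚ + y) ≡ (1ℚ + y + x) + x * y
    lemma₁ = solve-∀ ℚ-ring
    lemma₂ : ∀ x t → (1ℚ + (1ℚ + 1ℚ) * (t * x) + x) + x * 1ℚ ≡ 1ℚ + (1ℚ + 1ℚ) * ((t + 1ℚ) * x)
    lemma₂ = solve-∀ ℚ-ring

  -- Since `q ⊕ Q ≤ q + Q` and a larger density misses less often, the densities of the rounds may
  -- simply be added.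
  covers-add : ∀ {s b c Q η q x τ} → Covers m s c Q η → 0ℚ ≤ Q → 0ℚ ≤ q → q + Q ≤ 1ℚ →
    0ℚ ≤ x → s ≡ q * x → 0ℚ ≤ τ → (∀ (S : Subset m) → ∣ S ∣ ℕ.≤ b → tail c x S ≤ τ) →
    Covers m s b (q + Q) (τ + η)
  covers-add {Q = Q} {q = q} covers 0≤Q 0≤q q+Q≤1 0≤x s≡qx 0≤τ tail≤τ = covers-mono 0≤q⊕Q q⊕Q≤ q+Q≤1 ≤-refl
    (covers-step covers 0≤Q (≤-trans Q≤q+Q q+Q≤1) 0≤q q≤1 0≤x s≡qx 0≤τ tail≤τ)
    where
    q≤1 = ≤-trans (a≤a+b 0≤Q) q+Q≤1
    Q≤q+Q : Q ≤ q + Q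
    Q≤q+Q = subst (Q ≤_) (ℚ.+-comm Q q) (a≤a+b 0≤q)
    lemma : ∀ q Q → q + (1ℚ - q) * Q ≡ q + Q - q * Q
    lemma = solve-∀ ℚ-ring
    0≤q⊕Q : 0ℚ ≤ q ⊕ Q
    0≤q⊕Q = subst (0ℚ ≤_) (lemma q Q) (0≤+ 0≤q (0≤* (p≤q⇒0≤q-p q≤1) 0≤Q))
    lemma′ : ∀ q Q → (q + Q - q * Q) + q * Q ≡ q + Q
    lemma′ = solve-∀ ℚ-ring
    q⊕Q≤ : q ⊕ Q ≤ q + Q
    q⊕Q≤ = subst (q ⊕ Q ≤_) (lemma′ q Q) (a≤a+b (0≤* 0≤q 0≤Q))

  ⅛ : ℚ
  ⅛ = recip 7

  module _ {m : ℕ} {s : ℚ} (0≤s : 0ℚ ≤ s) (v : ℕ) where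

    private
      w : ℕ
      w = suc v
      r : ℚ
      r = recip v
      0≤r : 0ℚ ≤ r
      0≤r = recip-nonNeg v

    density : ℕ → ℕ
    density j = 8 ℕ.* j ℕ.+ 2 ℕ.* (w ℕ.* w)

    -- The loss 1 / w of the last round (`r` is 1 / w) plus the sum of 2^-(w + i) over i < j, in
    -- closed form so that the induction telescopes.
    failure : ℕ → ℚ
    failure j = r + (2ℚ * pow ½ w - 2ℚ * pow ½ (w ℕ.+ j))

    -- The last round: edges of size at most w and density 2 w² s, so that x = 1 / (2 w²).
    covers-last : ι (density 0) * s ≤ 1ℚ → Covers m s w (ι (density 0) * s) r
    covers-last q≤1 = subst₂ (Covers m s w) (ℚ.+-identityʳ q) (ℚ.+-identityʳ r)
      (covers-add {s = s} {b = w} {q = q} {x = x} covers-zero ≤-refl 0≤q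
        (subst (_≤ 1ℚ) (sym (ℚ.+-identityʳ q)) q≤1) 0≤x s≡qx 0≤r tail≤)
      where
      q x : ℚ
      q = ι (density 0) * s
      x = ½ * (r * r)
      0≤q = 0≤* (0≤ι (density 0)) 0≤s
      0≤x = 0≤* 0≤½ (0≤* 0≤r 0≤r)
      s≡qx : s ≡ q * x
      s≡qx = sym (begin
        ι (2 ℕ.* (w ℕ.* w)) * s * x
          ≡⟨ cong (λ y → y * s * x) (trans (ι-* 2 (w ℕ.* w)) (cong (ι 2 *_) (ι-* w w))) ⟩
        ι 2 * (ι w * ι w) * s * (½ * (r * r))
          ≡⟨ lemma (ι 2) (ι w) s ½ r ⟩
        (ι 2 * ½) * ((ι w * r) * (ι w * r)) * s
          ≡⟨ cong (λ y → (ι 2 * ½) * (y * y) * s) (ι*recip v) ⟩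
        (ι 2 * ½) * (1ℚ * 1ℚ) * s
          ≡⟨ ℚ.*-identityˡ s ⟩
        s ∎)
        where
        open ≡-Reasoning
        lemma : ∀ t w s h r → t * (w * w) * s * (h * (r * r)) ≡ (t * h) * ((w * r) * (w * r)) * s
        lemma = solve-∀ ℚ-ring
      2wx≡r : 2ℚ * (ι w * x) ≡ r
      2wx≡r = begin
        2ℚ * (ι w * (½ * (r * r)))   ≡⟨ lemma 2ℚ (ι w) ½ r ⟩
        (2ℚ * ½) * ((ι w * r) * r)   ≡⟨ cong (λ y → (2ℚ * ½) * (y * r)) (ι*recip v) ⟩
        (2ℚ * ½) * (1ℚ * r)          ≡⟨ trans (ℚ.*-identityˡ (1ℚ * r)) (ℚ.*-identityˡ r) ⟩
        r ∎
        where
        open ≡-Reasoning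
        lemma : ∀ t w h r → t * (w * (h * (r * r))) ≡ (t * h) * ((w * r) * r)
        lemma = solve-∀ ℚ-ring
      -- With cut-off 0 only empty fragments survive. The loss is (1 + x)^w - 1 ≤ 2wx, and x = 1 /
      -- (2w²) makes this 1 / w.
      tail≤ : ∀ (S : Subset m) → ∣ S ∣ ℕ.≤ w → tail 0 x S ≤ r
      tail≤ S ∣S∣≤w = begin
        tail 0 x S                   ≡⟨ tail-0 S x ⟩
        pow (1ℚ + x) ∣ S ∣ - 1ℚ      ≤⟨ ℚ.+-monoˡ-≤ (- 1ℚ) (pow-monoʳ (a≤a+b {1ℚ} 0≤x) ∣S∣≤w) ⟩
        pow (1ℚ + x) w - 1ℚ          ≤⟨ ℚ.+-monoˡ-≤ (- 1ℚ) (pow-1+≤ w 0≤x (subst (_≤ 1ℚ) (sym 2wx≡r) (recip≤1 v))) ⟩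
        1ℚ + 2ℚ * (ι w * x) - 1ℚ     ≡⟨ cong (λ y → 1ℚ + y - 1ℚ) 2wx≡r ⟩
        1ℚ + r - 1ℚ                  ≡⟨ lemma r ⟩
        r ∎
        where
        open ℚ.≤-Reasoning
        lemma : ∀ r → 1ℚ + r - 1ℚ ≡ r
        lemma = solve-∀ ℚ-ring

    -- Weakens the loss 2^-(2^j w) of a halving round to 2^-(w + j), the term of a geometric series.
    j+w≤2^j*w : ∀ j → w ℕ.+ j ℕ.≤ 2 ℕ.^ j ℕ.* w
    j+w≤2^j*w zero    = ℕ.≤-refl
    j+w≤2^j*w (suc j) = begin
      w ℕ.+ suc j                        ≡⟨ ℕ.+-suc w j ⟩
      suc (w ℕ.+ j)                      ≤⟨ ℕ.+-mono-≤ (ℕ.s≤s (ℕ.z≤n {v ℕ.+ j})) ℕ.≤-refl ⟩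
      (w ℕ.+ j) ℕ.+ (w ℕ.+ j)            ≤⟨ ℕ.+-mono-≤ (j+w≤2^j*w j) (j+w≤2^j*w j) ⟩
      2 ℕ.^ j ℕ.* w ℕ.+ 2 ℕ.^ j ℕ.* w    ≡⟨ double (2 ℕ.^ j) w ⟨
      2 ℕ.^ suc j ℕ.* w                  ∎
      where
      open ℕ.≤-Reasoning
      double : ∀ a b → (2 ℕ.* a) ℕ.* b ≡ a ℕ.* b ℕ.+ a ℕ.* b
      double = solve-∀ᴺ

    -- A halving round has density 8 s, so that x = 1/8.
    covers-rounds : ∀ j → ι (density j) * s ≤ 1ℚ → Covers m s (2 ℕ.^ j ℕ.* w) (ι (density j) * s) (failure j)
    covers-rounds zero q≤1 = subst₂ (λ b → Covers m s b (ι (density 0) * s)) (sym (ℕ.*-identityˡ w)) r≡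
      (covers-last q≤1)
      where
      lemma : ∀ r y → r ≡ r + (y - y)
      lemma = solve-∀ ℚ-ring
      r≡ : r ≡ failure 0
      r≡ = trans (lemma r (2ℚ * pow ½ w)) (cong (λ k → r + (2ℚ * pow ½ w - 2ℚ * pow ½ k)) (sym (ℕ.+-identityʳ w)))
    covers-rounds (suc j) q≤1 = subst (λ Q → Covers m s (2 ℕ.^ suc j ℕ.* w) Q (failure (suc j))) (sym split)
      (covers-mono (0≤+ 0≤8s 0≤Q) ≤-refl 8s+Q≤1 failure≤
        (covers-add {c = c} {q = ι 8 * s} {x = ⅛} (covers-rounds j Q≤1) 0≤Q 0≤8s 8s+Q≤1 (recip-nonNeg 7) s≡8s⅛
            (0≤pow 0≤½ c) tail≤))
      where
      c = 2 ℕ.^ j ℕ.* w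
      Q = ι (density j) * s
      0≤Q = 0≤* (0≤ι (density j)) 0≤s
      0≤8s = 0≤* (0≤ι 8) 0≤s
      density-suc : ∀ j a → 8 ℕ.* suc j ℕ.+ a ≡ 8 ℕ.+ (8 ℕ.* j ℕ.+ a)
      density-suc = solve-∀ᴺ
      split : ι (density (suc j)) * s ≡ ι 8 * s + Q
      split = trans (cong (λ d → ι d * s) (density-suc j (2 ℕ.* (w ℕ.* w))))
        (trans (cong (_* s) (ι-+ 8 (density j))) (ℚ.*-distribʳ-+ s (ι 8) (ι (density j))))
      8s+Q≤1 : ι 8 * s + Q ≤ 1ℚ
      8s+Q≤1 = subst (_≤ 1ℚ) split q≤1
      Q≤1 : Q ≤ 1ℚ
      Q≤1 = ≤-trans (subst (Q ≤_) (ℚ.+-comm Q (ι 8 * s)) (a≤a+b 0≤8s)) 8s+Q≤1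
      s≡8s⅛ : s ≡ ι 8 * s * ⅛
      s≡8s⅛ = sym (trans (lemma (ι 8) s ⅛) (trans (cong (_* s) (ι*recip 7)) (ℚ.*-identityˡ s)))
        where
        lemma : ∀ a s b → a * s * b ≡ (a * b) * s
        lemma = solve-∀ ℚ-ring
      -- An edge of size at most 2c has at most 4^c subsets, and those that count weigh at most 8^-c
      -- each: the 8 is twice the 4, so that 2^-c remains.
      tail≤ : ∀ (S : Subset m) → ∣ S ∣ ℕ.≤ 2 ℕ.^ suc j ℕ.* w → tail c ⅛ S ≤ pow ½ c
      tail≤ S ∣S∣≤ = begin
        tail c ⅛ S                        ≤⟨ tail-≤ c (recip-nonNeg 7) (recip≤1 7) S ⟩
        pow ⅛ c * pow 2ℚ ∣ S ∣
          ≤⟨ *-monoˡ (0≤pow (recip-nonNeg 7) c) (pow-monoʳ 1≤2 (ℕ.≤-trans ∣S∣≤ (ℕ.≤-reflexive (double (2 ℕ.^ j) w)))) ⟩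
        pow ⅛ c * pow 2ℚ (c ℕ.+ c)        ≡⟨ cong (pow ⅛ c *_) (trans (pow-+ 2ℚ c c) (sym (pow-* 2ℚ 2ℚ c))) ⟩
        pow ⅛ c * pow (2ℚ * 2ℚ) c         ≡⟨ pow-* ⅛ (2ℚ * 2ℚ) c ⟨
        pow ½ c                           ∎
        where
        open ℚ.≤-Reasoning
        double : ∀ a b → (2 ℕ.* a) ℕ.* b ≡ a ℕ.* b ℕ.+ a ℕ.* b
        double = solve-∀ᴺ
      failure≤ : pow ½ c + failure j ≤ failure (suc j)
      failure≤ = begin
        pow ½ c + failure j                         ≤⟨ ℚ.+-monoˡ-≤ (failure j) (pow-antimono 0≤½ ½≤1 (j+w≤2^j*w j)) ⟩
        P + (r + (a - 2ℚ * P))                      ≡⟨ lemma P r a ⟩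
        r + (a - 1ℚ * P)
          ≡⟨ cong (λ y → r + (a - y)) (trans (ℚ.*-assoc 2ℚ ½ P) (cong (λ k → 2ℚ * pow ½ k) (sym (ℕ.+-suc w j)))) ⟩
        failure (suc j)                             ∎
        where
        open ℚ.≤-Reasoning
        P = pow ½ (w ℕ.+ j)
        a = 2ℚ * pow ½ w
        lemma : ∀ P r a → P + (r + (a - (1ℚ + 1ℚ) * P)) ≡ r + (a - 1ℚ * P)
        lemma = solve-∀ ℚ-ring

    failure≤ : ∀ j → failure j ≤ ι 3 * r
    failure≤ j = begin
      r + (2ℚ * pow ½ w - 2ℚ * pow ½ (w ℕ.+ j))
        ≤⟨ ℚ.+-monoʳ-≤ r (ℚ.+-mono-≤ (*-monoˡ 0≤2 (pow½≤recip v)) (ℚ.neg-antimono-≤ (0≤* 0≤2 (0≤pow 0≤½ (w ℕ.+ j))))) ⟩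
      r + (2ℚ * r - 0ℚ)
        ≡⟨ lemma r ⟩
      (1ℚ + 1ℚ + 1ℚ) * r
        ≡⟨⟩
      ι 3 * r ∎
      where
      open ℚ.≤-Reasoning
      lemma : ∀ r → r + ((1ℚ + 1ℚ) * r - 0ℚ) ≡ (1ℚ + 1ℚ + 1ℚ) * r
      lemma = solve-∀ ℚ-ring

    -- For M = `length F` the count cancels against M in `Covers`, and dividing by M leaves the
    -- probability itself.
    𝔼-miss≤ : ∀ j {Q} (F : List (Subset m)) → 0ℚ < ι (length F) → BoundedBy (2 ℕ.^ j ℕ.* w) F →
      SpreadBy s (ι (length F)) F → ι (density j) * s ≤ Q → Q ≤ 1ℚ → 𝔼 Q (miss F) ≤ ι 3 * recip v
    𝔼-miss≤ j {Q} F 0<M F-bounded F-spread d≤Q Q≤1 =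
      ℚ.*-cancelˡ-≤-pos M {{positive 0<M}} (0≤q-p⇒p≤q (subst (0ℚ ≤_) (lemma M (𝔼 Q (miss F)) (ι 3 * r))
        (p≤q⇒0≤q-p (covers-mono {η = failure j} 0≤d d≤Q Q≤1 (failure≤ j) (covers-rounds j (≤-trans d≤Q Q≤1)) F M
            (0≤ι (length F)) F-bounded F-spread))))
      where
      M = ι (length F)
      0≤d = 0≤* (0≤ι (density j)) 0≤s
      lemma : ∀ M e y → M + M * y - (M * e + M) ≡ M * y - M * e
      lemma = solve-∀ ℚ-ring

-- Counting sequences of distinct colours with prescribed entries.

module Counting where

  open import Data.Fin.Base using (Fin)
  open import Data.Fin.Properties using (_≟_)
  open import Data.List.Base as List using (List; []; _∷_; length; filter; map; concatMap; allFin)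
  open import Data.List.Membership.Propositional using (find; _∈_; _∉_)
  open import Data.List.Membership.Propositional.Properties using (∈-filter⁻; ∈-map⁻; ∈-concatMap⁻; ∈-allFin)
  open import Data.List.Properties using (length-filter; filter-all; length-tabulate; filter-accept; filter-reject)
  open import Data.List.Relation.Unary.All.Properties using (¬Any⇒All¬; All¬⇒¬Any)
  open import Data.List.Relation.Unary.Any using (here; there)
  open import Data.List.Relation.Unary.AllPairs using ([]; _∷_)
  open import Data.List.Relation.Unary.Unique.Propositional using (Unique)
  open import Data.List.Relation.Unary.Unique.Propositional.Properties as Unique using (allFin⁺)
  open import Data.Maybe.Base using (Maybe; just; nothing)
  open import Data.Nat.Base as ℕ using (ℕ; zero; suc)
  import Data.Nat.Properties as ℕ
  open import Data.Nat.Tactic.RingSolver renaming (solve-∀ to solve-∀ᴺ)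
  open import Data.Product.Base using (Σ; _×_; _,_; proj₁; proj₂)
  open import Data.Rational.Base hiding (_>_; _≥_; ∣_∣)
  open import Data.Rational.Properties as ℚ using (≤-refl; ≤-reflexive; ≤-trans)
  open import Data.Sum.Base using (inj₁; inj₂)
  open import Function.Base using (_∘_; id)
  open import Relation.Binary.PropositionalEquality
  open import Relation.Nullary.Negation using (¬_; contradiction)
  open import Relation.Nullary.Decidable using (Dec; yes; no; ¬?)
  open import Relation.Unary using (Decidable; Pred)
  open import Level using (0ℓ)
  open import Tactic.RingSolver using (solve-∀)
  open import Defs using (ℚ-ring; recip; recip-nonNeg)
  open Rationals

  -- The product n (n - 1) ... (n - r + 1). Truncation in `ℕ.pred` does no harm: by then the factor
  -- 0 has occurred.
  falling : ℕ → ℕ → ℕ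
  falling n zero    = 1
  falling n (suc r) = n ℕ.* falling (ℕ.pred n) r

  falling-mono : ∀ {m n} r → m ℕ.≤ n → falling m r ℕ.≤ falling n r
  falling-mono zero    m≤n = ℕ.≤-refl
  falling-mono (suc r) m≤n = ℕ.*-mono-≤ m≤n (falling-mono r (ℕ.pred-mono-≤ m≤n))

  -- Bernoulli's inequality (1 - 1/(k+1))^j ≥ 1 - j/(k+1), cleared of denominators; for j > k the
  -- left side is 0.
  bernoulli : ∀ k j → suc k ℕ.^ j ℕ.* (suc k ℕ.∸ j) ℕ.≤ k ℕ.^ j ℕ.* suc k
  bernoulli k zero    = ℕ.≤-refl
  bernoulli k (suc j) = begin
    suc k ℕ.* suc k ℕ.^ j ℕ.* (k ℕ.∸ j)       ≡⟨ lemma₁ (suc k) (suc k ℕ.^ j) (k ℕ.∸ j) ⟩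
    suc k ℕ.^ j ℕ.* (suc k ℕ.* (k ℕ.∸ j))     ≤⟨ ℕ.*-monoʳ-≤ (suc k ℕ.^ j) (step k j) ⟩
    suc k ℕ.^ j ℕ.* (k ℕ.* (suc k ℕ.∸ j))     ≡⟨ lemma₂ (suc k ℕ.^ j) k (suc k ℕ.∸ j) ⟩
    k ℕ.* (suc k ℕ.^ j ℕ.* (suc k ℕ.∸ j))     ≤⟨ ℕ.*-monoʳ-≤ k (bernoulli k j) ⟩
    k ℕ.* (k ℕ.^ j ℕ.* suc k)                 ≡⟨ ℕ.*-assoc k (k ℕ.^ j) (suc k) ⟨
    k ℕ.* k ℕ.^ j ℕ.* suc k                   ∎
    where
    open ℕ.≤-Reasoning
    lemma₁ : ∀ a b c → a ℕ.* b ℕ.* c ≡ b ℕ.* (a ℕ.* c)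
    lemma₁ = solve-∀ᴺ
    lemma₂ : ∀ a b c → a ℕ.* (b ℕ.* c) ≡ b ℕ.* (a ℕ.* c)
    lemma₂ = solve-∀ᴺ
    step : ∀ k j → suc k ℕ.* (k ℕ.∸ j) ℕ.≤ k ℕ.* (suc k ℕ.∸ j)
    step k j with ℕ.≤-total j k
    ... | inj₂ k≤j rewrite ℕ.m≤n⇒m∸n≡0 k≤j = ℕ.≤-trans (ℕ.≤-reflexive (ℕ.*-zeroʳ (suc k))) ℕ.z≤n
    ... | inj₁ j≤k rewrite ℕ.+-∸-assoc 1 j≤k = begin
      (k ℕ.∸ j) ℕ.+ k ℕ.* (k ℕ.∸ j)  ≤⟨ ℕ.+-monoˡ-≤ (k ℕ.* (k ℕ.∸ j)) (ℕ.m∸n≤m k j) ⟩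
      k ℕ.+ k ℕ.* (k ℕ.∸ j)          ≡⟨ ℕ.*-suc k (k ℕ.∸ j) ⟨
      k ℕ.* suc (k ℕ.∸ j)            ∎

  -- When 2j ≤ k + 1, the factor `suc k ∸ j` of `bernoulli` is at least half of `suc k`, which then
  -- cancels.
  [1+k]^j≤2k^j : ∀ k j → j ℕ.+ j ℕ.≤ suc k → suc k ℕ.^ j ℕ.≤ 2 ℕ.* k ℕ.^ j
  [1+k]^j≤2k^j k j 2j≤1+k = ℕ.*-cancelʳ-≤ _ _ (suc k) (begin
    suc k ℕ.^ j ℕ.* suc k                               ≤⟨ ℕ.*-monoʳ-≤ (suc k ℕ.^ j) half ⟩
    suc k ℕ.^ j ℕ.* (2 ℕ.* (suc k ℕ.∸ j))               ≡⟨ lemma (suc k ℕ.^ j) 2 (suc k ℕ.∸ j) ⟩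
    2 ℕ.* (suc k ℕ.^ j ℕ.* (suc k ℕ.∸ j))               ≤⟨ ℕ.*-monoʳ-≤ 2 (bernoulli k j) ⟩
    2 ℕ.* (k ℕ.^ j ℕ.* suc k)                           ≡⟨ ℕ.*-assoc 2 (k ℕ.^ j) (suc k) ⟨
    2 ℕ.* k ℕ.^ j ℕ.* suc k                             ∎)
    where
    open ℕ.≤-Reasoning
    lemma : ∀ a b c → a ℕ.* (b ℕ.* c) ≡ b ℕ.* (a ℕ.* c)
    lemma = solve-∀ᴺ
    half : suc k ℕ.≤ 2 ℕ.* (suc k ℕ.∸ j)
    half = begin
      suc k                                ≡⟨ ℕ.m∸n+n≡m (ℕ.m+n≤o⇒m≤o j 2j≤1+k) ⟨
      (suc k ℕ.∸ j) ℕ.+ j                  ≤⟨ ℕ.+-monoʳ-≤ (suc k ℕ.∸ j) (ℕ.m+n≤o⇒m≤o∸n j 2j≤1+k) ⟩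
      (suc k ℕ.∸ j) ℕ.+ (suc k ℕ.∸ j)      ≡⟨ cong ((suc k ℕ.∸ j) ℕ.+_) (ℕ.+-identityʳ (suc k ℕ.∸ j)) ⟨
      2 ℕ.* (suc k ℕ.∸ j)                  ∎

  -- (1 + 1/k)^s ≤ 4, from two applications of Bernoulli's inequality with exponents about s/2.
  [1+k]^s≤4k^s : ∀ k s → s ℕ.≤ k → suc k ℕ.^ s ℕ.≤ 4 ℕ.* k ℕ.^ s
  [1+k]^s≤4k^s k s s≤k = begin
    suc k ℕ.^ s                                 ≡⟨ cong (suc k ℕ.^_) (ℕ.⌊n/2⌋+⌈n/2⌉≡n s) ⟨
    suc k ℕ.^ (a ℕ.+ b)                         ≡⟨ ℕ.^-distribˡ-+-* (suc k) a b ⟩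
    suc k ℕ.^ a ℕ.* suc k ℕ.^ b                 ≤⟨ ℕ.*-mono-≤ ([1+k]^j≤2k^j k a 2a≤) ([1+k]^j≤2k^j k b 2b≤) ⟩
    2 ℕ.* k ℕ.^ a ℕ.* (2 ℕ.* k ℕ.^ b)           ≡⟨ lemma (k ℕ.^ a) (k ℕ.^ b) ⟩
    4 ℕ.* (k ℕ.^ a ℕ.* k ℕ.^ b)                 ≡⟨ cong (4 ℕ.*_) (ℕ.^-distribˡ-+-* k a b) ⟨
    4 ℕ.* k ℕ.^ (a ℕ.+ b)                       ≡⟨ cong (λ t → 4 ℕ.* k ℕ.^ t) (ℕ.⌊n/2⌋+⌈n/2⌉≡n s) ⟩
    4 ℕ.* k ℕ.^ s                               ∎
    where
    open ℕ.≤-Reasoning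
    a = ℕ.⌊ s /2⌋
    b = ℕ.⌈ s /2⌉
    lemma : ∀ a b → 2 ℕ.* a ℕ.* (2 ℕ.* b) ≡ 4 ℕ.* (a ℕ.* b)
    lemma = solve-∀ᴺ
    2⌊n/2⌋≤n : ∀ n → ℕ.⌊ n /2⌋ ℕ.+ ℕ.⌊ n /2⌋ ℕ.≤ n
    2⌊n/2⌋≤n n = ℕ.≤-trans (ℕ.+-monoʳ-≤ ℕ.⌊ n /2⌋ (ℕ.⌊n/2⌋-mono (ℕ.n≤1+n n))) (ℕ.≤-reflexive (ℕ.⌊n/2⌋+⌈n/2⌉≡n n))
    2a≤ : a ℕ.+ a ℕ.≤ suc k
    2a≤ = ℕ.≤-trans (2⌊n/2⌋≤n s) (ℕ.≤-trans s≤k (ℕ.n≤1+n k))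
    2b≤ : b ℕ.+ b ℕ.≤ suc k
    2b≤ = ℕ.≤-trans (2⌊n/2⌋≤n (suc s)) (ℕ.s≤s s≤k)

  -- The bound (k - s)! / k! ≤ (4 / k)^s without denominators. Each induction step trades (k + 1)^s
  -- for k^s, and that costs one factor 4.
  falling-ratio : ∀ k r s → s ℕ.≤ r → r ℕ.≤ k →
    k ℕ.^ s ℕ.* falling (k ℕ.∸ s) (r ℕ.∸ s) ℕ.≤ 4 ℕ.^ s ℕ.* falling k r
  falling-ratio k       r       zero    _           _           = ℕ.≤-refl
  falling-ratio (suc k) (suc r) (suc s) (ℕ.s≤s s≤r) (ℕ.s≤s r≤k) = begin
    suc k ℕ.* suc k ℕ.^ s ℕ.* f
      ≤⟨ ℕ.*-monoˡ-≤ f (ℕ.*-monoʳ-≤ (suc k) ([1+k]^s≤4k^s k s (ℕ.≤-trans s≤r r≤k))) ⟩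
    suc k ℕ.* (4 ℕ.* k ℕ.^ s) ℕ.* f              ≡⟨ lemma (suc k) 4 (k ℕ.^ s) f ⟩
    4 ℕ.* suc k ℕ.* (k ℕ.^ s ℕ.* f)              ≤⟨ ℕ.*-monoʳ-≤ (4 ℕ.* suc k) (falling-ratio k r s s≤r r≤k) ⟩
    4 ℕ.* suc k ℕ.* (4 ℕ.^ s ℕ.* falling k r)    ≡⟨ lemma′ 4 (suc k) (4 ℕ.^ s) (falling k r) ⟩
    4 ℕ.* 4 ℕ.^ s ℕ.* (suc k ℕ.* falling k r)    ∎
    where
    open ℕ.≤-Reasoning
    f = falling (k ℕ.∸ s) (r ℕ.∸ s)
    lemma : ∀ a b c d → a ℕ.* (b ℕ.* c) ℕ.* d ≡ b ℕ.* a ℕ.* (c ℕ.* d)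
    lemma = solve-∀ᴺ
    lemma′ : ∀ a b c d → a ℕ.* b ℕ.* (c ℕ.* d) ≡ a ℕ.* c ℕ.* (b ℕ.* d)
    lemma′ = solve-∀ᴺ

  module _ {A : Set} {P R : Pred A 0ℓ} (P? : Decidable P) (R? : Decidable R) where

    length-filter-mono : (∀ {x} → R x → P x) → ∀ xs → length (filter R? xs) ℕ.≤ length (filter P? xs)
    length-filter-mono R⇒P []       = ℕ.z≤n
    length-filter-mono R⇒P (x ∷ xs) with R? x | P? x
    ... | yes _  | yes _  = ℕ.s≤s (length-filter-mono R⇒P xs)
    ... | yes Rx | no ¬Px = contradiction (R⇒P Rx) ¬Px
    ... | no _   | yes _  = ℕ.m≤n⇒m≤1+n (length-filter-mono R⇒P xs)
    ... | no _   | no _   = length-filter-mono R⇒P xs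

    length-filter-strict : (∀ {x} → R x → P x) → ∀ {x xs} → x ∈ xs → P x → ¬ R x →
      length (filter R? xs) ℕ.< length (filter P? xs)
    length-filter-strict R⇒P {x} {xs = _ ∷ xs} (here refl) Px ¬Rx
      rewrite filter-accept P? {xs = xs} Px | filter-reject R? {xs = xs} ¬Rx = ℕ.s≤s (length-filter-mono R⇒P xs)
    length-filter-strict R⇒P {x} {xs = y ∷ xs} (there x∈) Px ¬Rx with R? y | P? y
    ... | yes _  | yes _  = ℕ.s≤s (length-filter-strict R⇒P x∈ Px ¬Rx)
    ... | yes Ry | no ¬Py = contradiction (R⇒P Ry) ¬Py
    ... | no _   | yes _  = ℕ.m≤n⇒m≤1+n (length-filter-strict R⇒P x∈ Px ¬Rx)
    ... | no _   | no _   = length-filter-strict R⇒P x∈ Px ¬Rx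

    length-filter-filter : ∀ xs → length (filter P? (filter R? xs)) ℕ.≤ length (filter P? xs)
    length-filter-filter []       = ℕ.z≤n
    length-filter-filter (x ∷ xs) with R? x
    length-filter-filter (x ∷ xs) | yes _ with P? x
    ... | yes _ = ℕ.s≤s (length-filter-filter xs)
    ... | no _  = length-filter-filter xs
    length-filter-filter (x ∷ xs) | no _ with P? x
    ... | yes _ = ℕ.m≤n⇒m≤1+n (length-filter-filter xs)
    ... | no _  = length-filter-filter xs

    length-filter-filter-strict : ∀ {x xs} → x ∈ xs → P x → ¬ R x →
      length (filter P? (filter R? xs)) ℕ.< length (filter P? xs)
    length-filter-filter-strict {xs = _ ∷ xs} (here refl) Px ¬Rx
      rewrite filter-accept P? {xs = xs} Px | filter-reject R? {xs = xs} ¬Rx = ℕ.s≤s (length-filter-filter xs)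
    length-filter-filter-strict {xs = y ∷ xs} (there x∈) Px ¬Rx with R? y
    length-filter-filter-strict {xs = y ∷ xs} (there x∈) Px ¬Rx | yes _ with P? y
    ... | yes _ = ℕ.s≤s (length-filter-filter-strict x∈ Px ¬Rx)
    ... | no _  = length-filter-filter-strict x∈ Px ¬Rx
    length-filter-filter-strict {xs = y ∷ xs} (there x∈) Px ¬Rx | no _ with P? y
    ... | yes _ = ℕ.m≤n⇒m≤1+n (length-filter-filter-strict x∈ Px ¬Rx)
    ... | no _  = length-filter-filter-strict x∈ Px ¬Rx

  module Injections (k : ℕ) where

    open import Data.List.Membership.DecPropositional (_≟_ {k}) using (_∈?_)

    open import Data.List.Relation.Unary.Unique.DecPropositional (_≟_ {k}) using (unique?)

    remove : Fin k → List (Fin k) → List (Fin k)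
    remove c = filter (λ d → ¬? (c ≟ d))

    pred-length≤ : ∀ c {D} → Unique D → ℕ.pred (length D) ℕ.≤ length (remove c D)
    pred-length≤ c [] = ℕ.z≤n
    pred-length≤ c {d ∷ D} (d∉D ∷ D!) with c ≟ d
    ... | yes refl = ℕ.≤-reflexive (cong length (sym (filter-all (λ d → ¬? (c ≟ d)) d∉D)))
    ... | no  _    = ℕ.≤-trans (n≤1+pred[n] (length D)) (ℕ.s≤s (pred-length≤ c D!))
      where
      n≤1+pred[n] : ∀ n → n ℕ.≤ suc (ℕ.pred n)
      n≤1+pred[n] zero    = ℕ.z≤n
      n≤1+pred[n] (suc n) = ℕ.≤-refl

    injs : List (Fin k) → ℕ → List (List (Fin k))
    injs D zero    = [] ∷ []
    injs D (suc r) = concatMap (λ c → map (c ∷_) (injs (remove c D) r)) D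

    ∑-injs : ∀ D r (f : List (Fin k) → ℚ) →
      ∑ (injs D (suc r)) f ≡ ∑ D (λ c → ∑ (injs (remove c D) r) (f ∘ (c ∷_)))
    ∑-injs D r f = trans (∑-concatMap (λ c → map (c ∷_) (injs (remove c D) r)) D f)
      (∑-cong D (λ c → ∑-map (c ∷_) (injs (remove c D) r) f))

    ∈-injs⁻ : ∀ D r {cs} → cs ∈ injs D (suc r) →
      Σ (Fin k) λ c → Σ (List (Fin k)) λ cs′ → c ∈ D × cs′ ∈ injs (remove c D) r × cs ≡ c ∷ cs′
    ∈-injs⁻ D r cs∈ =
      let c , c∈D , cs∈map = find (∈-concatMap⁻ (λ c → map (c ∷_) (injs (remove c D) r)) {xs = D} cs∈)
          cs′ , cs′∈ , cs≡ = ∈-map⁻ (c ∷_) cs∈map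
      in c , cs′ , c∈D , cs′∈ , cs≡

    injs-⊆ : ∀ D r {cs} → cs ∈ injs D r → ∀ {c} → c ∈ cs → c ∈ D
    injs-⊆ D zero (here refl) ()
    injs-⊆ D (suc r) cs∈ c∈ with ∈-injs⁻ D r cs∈
    ... | c , cs′ , c∈D , cs′∈ , refl with c∈
    ...   | here refl = c∈D
    ...   | there c∈′ = proj₁ (∈-filter⁻ (λ d → ¬? (c ≟ d)) {xs = D} (injs-⊆ (remove c D) r cs′∈ c∈′))

    ∉-remove : ∀ c D → c ∉ remove c D
    ∉-remove c D c∈ = proj₂ (∈-filter⁻ (λ d → ¬? (c ≟ d)) {xs = D} c∈) refl

    injs-unique : ∀ D r {cs} → cs ∈ injs D r → Unique cs
    injs-unique D zero (here refl) = []
    injs-unique D (suc r) cs∈ with ∈-injs⁻ D r cs∈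
    ... | c , cs′ , c∈D , cs′∈ , refl =
      ¬Any⇒All¬ cs′ (λ c∈ → ∉-remove c D (injs-⊆ (remove c D) r cs′∈ c∈)) ∷ injs-unique (remove c D) r cs′∈

    injs-length : ∀ D r {cs} → cs ∈ injs D r → length cs ≡ r
    injs-length D zero (here refl) = refl
    injs-length D (suc r) cs∈ with ∈-injs⁻ D r cs∈
    ... | c , cs′ , c∈D , cs′∈ , refl = cong suc (injs-length (remove c D) r cs′∈)

    falling≤∣injs∣ : ∀ {D} r → Unique D → ι (falling (length D) r) ≤ ∑ (injs D r) (λ _ → 1ℚ)
    falling≤∣injs∣ zero D! = ≤-refl
    falling≤∣injs∣ {D} (suc r) D! = begin
      ι (length D ℕ.* falling (ℕ.pred (length D)) r)
        ≡⟨ ι-* (length D) (falling (ℕ.pred (length D)) r) ⟩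
      ι (length D) * ι (falling (ℕ.pred (length D)) r)
        ≡⟨ ∑-length D (ι (falling (ℕ.pred (length D)) r)) ⟨
      ∑ D (λ _ → ι (falling (ℕ.pred (length D)) r))
        ≤⟨ ∑-mono D (λ c → ≤-trans (ι-mono (falling-mono r (pred-length≤ c D!)))
             (falling≤∣injs∣ r (Unique.filter⁺ (λ d → ¬? (c ≟ d)) D!))) ⟩
      ∑ D (λ c → ∑ (injs (remove c D) r) (λ _ → 1ℚ))
        ≡⟨ ∑-injs D r (λ _ → 1ℚ) ⟨
      ∑ (injs D (suc r)) (λ _ → 1ℚ) ∎
      where open ℚ.≤-Reasoning

    -- `just d` prescribes the colour d at a position and `nothing` leaves it open, as are all
    -- positions past the end of the pattern.
    Pattern : Set
    Pattern = List (Maybe (Fin k))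

    match : Pattern → List (Fin k) → ℚ
    match []            cs       = 1ℚ
    match (_ ∷ π)       []       = 0ℚ
    match (nothing ∷ π) (c ∷ cs) = match π cs
    match (just d ∷ π)  (c ∷ cs) = 𝟙 (c ≟ d) * match π cs

    0≤match : ∀ π cs → 0ℚ ≤ match π cs
    0≤match []            cs       = 0≤1
    0≤match (_ ∷ π)       []       = ≤-refl
    0≤match (nothing ∷ π) (c ∷ cs) = 0≤match π cs
    0≤match (just d ∷ π)  (c ∷ cs) = 0≤* (0≤𝟙 (c ≟ d)) (0≤match π cs)

    fixed : Pattern → List (Fin k)
    fixed []            = []
    fixed (nothing ∷ π) = fixed π
    fixed (just d ∷ π)  = d ∷ fixed π

    fixed≤ : ∀ π → length (fixed π) ℕ.≤ length π
    fixed≤ []            = ℕ.z≤n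
    fixed≤ (nothing ∷ π) = ℕ.m≤n⇒m≤1+n (fixed≤ π)
    fixed≤ (just _ ∷ π)  = ℕ.s≤s (fixed≤ π)

    match-∉ : ∀ {d} π {cs} → d ∈ fixed π → d ∉ cs → match π cs ≡ 0ℚ
    match-∉ (nothing ∷ π) {[]}     d∈ d∉ = refl
    match-∉ (just _ ∷ π)  {[]}     d∈ d∉ = refl
    match-∉ (nothing ∷ π) {c ∷ cs} d∈ d∉ = match-∉ π d∈ (d∉ ∘ there)
    match-∉ (just d ∷ π)  {c ∷ cs} (here refl) d∉ =
      trans (cong (_* match π cs) (𝟙-false (c ≟ d) (λ c≡d → d∉ (here (sym c≡d))))) (ℚ.*-zeroˡ (match π cs))
    match-∉ (just d ∷ π)  {c ∷ cs} (there d∈) d∉ =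
      trans (cong (𝟙 (c ≟ d) *_) (match-∉ π d∈ (d∉ ∘ there))) (ℚ.*-zeroʳ (𝟙 (c ≟ d)))

    -- If a colour matched at one position is prescribed again later, it is no longer available in a
    -- sequence of distinct colours.
    match-unique : ∀ π {cs} → Unique cs → ¬ Unique (fixed π) → match π cs ≡ 0ℚ
    match-unique []            _  ¬! = contradiction [] ¬!
    match-unique (nothing ∷ π) [] ¬! = refl
    match-unique (just _ ∷ π)  [] ¬! = refl
    match-unique (nothing ∷ π) (_ ∷ cs!) ¬! = match-unique π cs! ¬!
    match-unique (just d ∷ π) {c ∷ cs} (c∉cs ∷ cs!) ¬! with c ≟ d
    ... | no _     = ℚ.*-zeroˡ (match π cs)
    ... | yes refl with c ∈? fixed π
    ...   | yes c∈ = trans (ℚ.*-identityˡ (match π cs)) (match-∉ π c∈ (All¬⇒¬Any c∉cs))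
    ...   | no  c∉ = trans (ℚ.*-identityˡ (match π cs))
                       (match-unique π cs! (λ π! → ¬! (¬Any⇒All¬ (fixed π) c∉ ∷ π!)))

    free : List (Fin k) → Pattern → ℕ
    free D π = length (filter (λ c → ¬? (c ∈? fixed π)) D)

    free-remove : ∀ {c D} π → c ∈ D → c ∉ fixed π → free (remove c D) π ℕ.≤ ℕ.pred (free D π)
    free-remove {c} {D} π c∈D c∉π = ℕ.suc[m]≤n⇒m≤pred[n]
      (length-filter-filter-strict (λ c → ¬? (c ∈? fixed π)) (λ d → ¬? (c ≟ d)) c∈D c∉π (λ c≢c → c≢c refl))

    free-just : ∀ {d} D π → free (remove d D) π ℕ.≤ free D (just d ∷ π)
    free-just {d} []      π = ℕ.z≤n
    free-just {d} (c ∷ D) π with d ≟ c | c ≟ d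
    ... | yes refl | yes _ = free-just D π
    ... | yes refl | no ≢  = contradiction refl ≢
    ... | no ≢ | yes refl  = contradiction refl ≢
    ... | no _ | no _ with c ∈? fixed π
    ...   | yes _ = free-just D π
    ...   | no _  = ℕ.s≤s (free-just D π)

    free-unique : ∀ {D} π → (∀ c → c ∈ D) → Unique (fixed π) → free D π ℕ.+ length (fixed π) ℕ.≤ length D
    free-unique {D} []            all! _ = ℕ.≤-trans (ℕ.≤-reflexive (ℕ.+-identityʳ _)) (length-filter (λ c → ¬? (c ∈? [])) D)
    free-unique {D} (nothing ∷ π) all! π! = free-unique π all! π!
    free-unique {D} (just d ∷ π)  all! (d∉ ∷ π!) = begin
      free D (just d ∷ π) ℕ.+ suc (length (fixed π))  ≡⟨ ℕ.+-suc _ (length (fixed π)) ⟩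
      suc (free D (just d ∷ π)) ℕ.+ length (fixed π)
        ≤⟨ ℕ.+-monoˡ-≤ (length (fixed π)) (length-filter-strict (λ c → ¬? (c ∈? fixed π)) (λ c → ¬? (c ∈? (d ∷ fixed π)))
             (λ c∉ → c∉ ∘ there) (all! d) (All¬⇒¬Any d∉) (λ d∉′ → d∉′ (here refl))) ⟩
      free D π ℕ.+ length (fixed π)                   ≤⟨ free-unique π all! π! ⟩
      length D                                        ∎
      where open ℕ.≤-Reasoning

    -- The number of open positions in a sequence of length r, recursive in step with `injs`;
    -- `rest≡` gives the closed form.
    rest : Pattern → ℕ → ℕ
    rest []            r       = r
    rest (_ ∷ π)       zero    = 0
    rest (nothing ∷ π) (suc r) = suc (rest π r)
    rest (just _ ∷ π)  (suc r) = rest π r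

    rest≡ : ∀ π {r} → length π ℕ.≤ r → rest π r ≡ r ℕ.∸ length (fixed π)
    rest≡ []            _ = refl
    rest≡ (nothing ∷ π) (ℕ.s≤s π≤r) = trans (cong suc (rest≡ π π≤r)) (sym (ℕ.+-∸-assoc 1 (ℕ.≤-trans (fixed≤ π) π≤r)))
    rest≡ (just _ ∷ π)  (ℕ.s≤s π≤r) = rest≡ π π≤r

    count : List (Fin k) → ℕ → Pattern → ℚ
    count D r π = ∑ (injs D r) (match π)

    count-∉ : ∀ {D d} r π → d ∈ fixed π → d ∉ D → count D r π ≡ 0ℚ
    count-∉ {D} r π d∈ d∉ = ∑-zero-∈ (injs D r) (λ cs∈ → match-∉ π d∈ (d∉ ∘ injs-⊆ D r cs∈))

    ∑-𝟙≤ : ∀ {D d} {f : Fin k → ℚ} → (∀ c → 0ℚ ≤ f c) → Unique D → ∑ D (λ c → 𝟙 (c ≟ d) * f c) ≤ f d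
    ∑-𝟙≤ {d = d} 0≤f [] = 0≤f d
    ∑-𝟙≤ {c ∷ D} {d} {f} 0≤f (c∉D ∷ D!) with c ≟ d
    ... | no _ = ≤-trans (≤-reflexive (trans (cong (_+ ∑ D _) (ℚ.*-zeroˡ (f c))) (ℚ.+-identityˡ _))) (∑-𝟙≤ {D} {d} 0≤f D!)
    ... | yes refl = ≤-reflexive (trans
      (cong₂ _+_ (ℚ.*-identityˡ (f c)) (∑-zero-∈ D (λ {c′} c′∈ →
        trans (cong (_* f c′) (𝟙-false (c′ ≟ c) (λ c′≡c → All¬⇒¬Any c∉D (subst (_∈ D) c′≡c c′∈)))) (ℚ.*-zeroˡ (f c′)))))
      (ℚ.+-identityʳ (f c)))

    mutual

      -- Position by position: a prescribed one admits a single colour, which is then removed from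
      -- D, and an open one admits at most `free D π` colours.
      count≤ : ∀ {D} r π → Unique D → count D r π ≤ ι (falling (free D π) (rest π r))
      count≤ zero    []                D! = ≤-refl
      count≤ zero    (_ ∷ π)           D! = 0≤1
      count≤ {D} (suc r) []            D! = ≤-trans (≤-reflexive (∑-injs D r (match []))) (count≤-free r [] D!)
      count≤ {D} (suc r) (nothing ∷ π) D! = ≤-trans (≤-reflexive (∑-injs D r (match (nothing ∷ π)))) (count≤-free r π D!)
      count≤ {D} (suc r) (just d ∷ π)  D! = begin
        count D (suc r) (just d ∷ π)
          ≡⟨ ∑-injs D r (match (just d ∷ π)) ⟩
        ∑ D (λ c → ∑ (injs (remove c D) r) (λ cs → 𝟙 (c ≟ d) * match π cs))
          ≡⟨ ∑-cong D (λ c → ∑-*ˡ (injs (remove c D) r) (𝟙 (c ≟ d)) (match π)) ⟩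
        ∑ D (λ c → 𝟙 (c ≟ d) * count (remove c D) r π)
          ≤⟨ ∑-𝟙≤ {D} {d} (λ c → 0≤∑ (injs (remove c D) r) (0≤match π)) D! ⟩
        count (remove d D) r π
          ≤⟨ count≤ r π (Unique.filter⁺ (λ c → ¬? (d ≟ c)) D!) ⟩
        ι (falling (free (remove d D) π) (rest π r))
          ≤⟨ ι-mono (falling-mono (rest π r) (free-just D π)) ⟩
        ι (falling (free D (just d ∷ π)) (rest π r)) ∎
        where open ℚ.≤-Reasoning

      -- A colour that π prescribes later cannot fill the open position, since it would then be
      -- missing; any other choice uses up one free colour.
      count≤-free : ∀ {D} r π → Unique D →
        ∑ D (λ c → count (remove c D) r π) ≤ ι (falling (free D π) (suc (rest π r)))
      count≤-free {D} r π D! = begin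
        ∑ D (λ c → count (remove c D) r π)
          ≤⟨ ∑-mono-∈ D (λ {c} c∈D → bound c∈D (c ∈? fixed π)) ⟩
        ∑ D (λ c → 𝟙 (¬? (c ∈? fixed π)) * N)
          ≡⟨ ∑-*ʳ D (λ c → 𝟙 (¬? (c ∈? fixed π))) N ⟩
        ∑ D (λ c → 𝟙 (¬? (c ∈? fixed π))) * N
          ≡⟨ cong (_* N) (ι-length-filter (λ c → ¬? (c ∈? fixed π)) D) ⟨
        ι (free D π) * N
          ≡⟨ ι-* (free D π) (falling (ℕ.pred (free D π)) (rest π r)) ⟨
        ι (falling (free D π) (suc (rest π r))) ∎
        where
        open ℚ.≤-Reasoning
        N = ι (falling (ℕ.pred (free D π)) (rest π r))
        bound : ∀ {c} → c ∈ D → (d : Dec (c ∈ fixed π)) → count (remove c D) r π ≤ 𝟙 (¬? d) * N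
        bound {c} c∈D (yes c∈π) = ≤-reflexive (trans (count-∉ r π c∈π (∉-remove c D)) (sym (ℚ.*-zeroˡ N)))
        bound {c} c∈D (no c∉π)  = begin
          count (remove c D) r π                        ≤⟨ count≤ r π (Unique.filter⁺ (λ d → ¬? (c ≟ d)) D!) ⟩
          ι (falling (free (remove c D) π) (rest π r))  ≤⟨ ι-mono (falling-mono (rest π r) (free-remove π c∈D c∉π)) ⟩
          N                                             ≡⟨ ℚ.*-identityˡ N ⟨
          1ℚ * N                                        ∎

    sequences : ℕ → List (List (Fin k))
    sequences = injs (allFin k)

    -- Prescribed colours that repeat rule out every match. If they are distinct, at most k - s of
    -- the k colours are free for the r - s open positions.
    count-falling : ∀ {r} π → length π ℕ.≤ r →
      count (allFin k) r π ≤ ι (falling (k ℕ.∸ length (fixed π)) (r ℕ.∸ length (fixed π)))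
    count-falling {r} π π≤r with unique? (fixed π)
    ... | no  ¬! = ≤-trans (≤-reflexive (∑-zero-∈ (sequences r)
        (λ cs∈ → match-unique π (injs-unique (allFin k) r cs∈) ¬!)))
            (0≤ι (falling (k ℕ.∸ length (fixed π)) (r ℕ.∸ length (fixed π))))
    ... | yes π! = begin
      count (allFin k) r π                          ≤⟨ count≤ r π (allFin⁺ k) ⟩
      ι (falling (free (allFin k) π) (rest π r))    ≡⟨ cong (λ t → ι (falling (free (allFin k) π) t)) (rest≡ π π≤r) ⟩
      ι (falling (free (allFin k) π) (r ℕ.∸ length (fixed π)))
        ≤⟨ ι-mono (falling-mono (r ℕ.∸ length (fixed π)) (ℕ.m+n≤o⇒m≤o∸n (free (allFin k) π)
             (ℕ.≤-trans (free-unique π ∈-allFin π!) (ℕ.≤-reflexive (length-tabulate id))))) ⟩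
      ι (falling (k ℕ.∸ length (fixed π)) (r ℕ.∸ length (fixed π))) ∎
      where open ℚ.≤-Reasoning

    falling≤∣sequences∣ : ∀ r → ι (falling k r) ≤ ι (length (sequences r))
    falling≤∣sequences∣ r = begin
      ι (falling k r)                     ≡⟨ cong (λ t → ι (falling t r)) (length-tabulate {n = k} id) ⟨
      ι (falling (length (allFin k)) r)   ≤⟨ falling≤∣injs∣ r (allFin⁺ k) ⟩
      ∑ (sequences r) (λ _ → 1ℚ)          ≡⟨ ∑-length (sequences r) 1ℚ ⟩
      ι (length (sequences r)) * 1ℚ       ≡⟨ ℚ.*-identityʳ _ ⟩
      ι (length (sequences r))            ∎
      where open ℚ.≤-Reasoning

  module _ (k′ : ℕ) where

    private
      k = suc k′

    open Injections k

    -- Inserting 1 = (k · 1/k)^s turns the denominator-free `falling-ratio` into a bound by (4 /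
    -- k)^s.
    count-sequences : ∀ r → r ℕ.≤ k → ∀ π → length π ℕ.≤ r →
      ∑ (sequences r) (match π) ≤ pow (ι 4 * recip k′) (length (fixed π)) * ι (length (sequences r))
    count-sequences r r≤k π π≤r = begin
      X                                               ≡⟨ ℚ.*-identityʳ X ⟨
      X * 1ℚ                                          ≡⟨ cong (X *_) (pow-1 s) ⟨
      X * pow 1ℚ s                                    ≡⟨ cong (λ y → X * pow y s) (ι*recip k′) ⟨
      X * pow (ι k * R) s                             ≡⟨ cong (X *_) (pow-* (ι k) R s) ⟩
      X * (pow (ι k) s * pow R s)                     ≡⟨ lemma₁ X (pow (ι k) s) (pow R s) ⟩
      pow R s * (pow (ι k) s * X)
        ≤⟨ *-monoˡ (0≤pow 0≤R s) (*-monoˡ (0≤pow (0≤ι k) s) (count-falling π π≤r)) ⟩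
      pow R s * (pow (ι k) s * ι (falling (k ℕ.∸ s) (r ℕ.∸ s)))
        ≡⟨ cong (pow R s *_) (trans (ι-* (k ℕ.^ s) (falling (k ℕ.∸ s) (r ℕ.∸ s)))
            (cong (_* ι (falling (k ℕ.∸ s) (r ℕ.∸ s))) (ι-^ k s))) ⟨
      pow R s * ι (k ℕ.^ s ℕ.* falling (k ℕ.∸ s) (r ℕ.∸ s))
        ≤⟨ *-monoˡ (0≤pow 0≤R s) (ι-mono (falling-ratio k r s (ℕ.≤-trans (fixed≤ π) π≤r) r≤k)) ⟩
      pow R s * ι (4 ℕ.^ s ℕ.* falling k r)
        ≡⟨ cong (pow R s *_) (trans (ι-* (4 ℕ.^ s) (falling k r)) (cong (_* ι (falling k r)) (ι-^ 4 s))) ⟩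
      pow R s * (pow (ι 4) s * ι (falling k r))
        ≡⟨ lemma₂ (pow R s) (pow (ι 4) s) (ι (falling k r)) ⟩
      (pow (ι 4) s * pow R s) * ι (falling k r)
        ≡⟨ cong (_* ι (falling k r)) (pow-* (ι 4) R s) ⟨
      pow (ι 4 * R) s * ι (falling k r)
        ≤⟨ *-monoˡ (0≤pow (0≤* (0≤ι 4) 0≤R) s) (falling≤∣sequences∣ r) ⟩
      pow (ι 4 * R) s * ι (length (sequences r)) ∎
      where
      open ℚ.≤-Reasoning
      s = length (fixed π)
      R = recip k′
      0≤R = recip-nonNeg k′
      X = ∑ (sequences r) (match π)
      pow-1 : ∀ s → pow 1ℚ s ≡ 1ℚ
      pow-1 zero    = refl
      pow-1 (suc s) = trans (ℚ.*-identityˡ (pow 1ℚ s)) (pow-1 s)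
      lemma₁ : ∀ x y z → x * (y * z) ≡ z * (y * x)
      lemma₁ = solve-∀ ℚ-ring
      lemma₂ : ∀ x y z → x * (y * z) ≡ (y * x) * z
      lemma₂ = solve-∀ ℚ-ring

-- Coloured copies of edges and the spread of the coloured hypergraph.

module Colourings where

  open import Data.Bool.Base using (Bool)
  open import Data.Fin.Base using (Fin; zero; suc; combine; _↑ˡ_; _↑ʳ_)
  open import Data.Fin.Properties using (_≟_; suc-injective)
  open import Data.Fin.Subset using (Subset; inside; outside; _∈_; _⊆_; ∣_∣; ⊥; _∪_; ⁅_⁆)
  open import Data.Fin.Subset.Properties
  open import Data.List.Base as List using (List; []; _∷_; length; map; concatMap; allFin)
  open import Data.List.Membership.Propositional using (find) renaming (_∈_ to _∈ˡ_)
  open import Data.List.Membership.Propositional.Properties using (∈-map⁻; ∈-concatMap⁻)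
  open import Data.List.Relation.Unary.All as All using (All; []; _∷_)
  open import Data.List.Relation.Unary.AllPairs using ([]; _∷_)
  open import Data.List.Relation.Unary.Any using (here; there)
  import Data.List.Relation.Unary.Unique.Propositional as List using (Unique)
  open import Data.Maybe.Base using (just; nothing)
  open import Data.Nat.Base as ℕ using (ℕ; zero; suc)
  import Data.Nat.Properties as ℕ
  open import Data.Product.Base using (Σ; _×_; _,_)
  open import Data.Rational.Base hiding (_>_; _≥_; ∣_∣)
  open import Data.Rational.Properties as ℚ using (≤-refl; ≤-reflexive; ≤-trans)
  open import Data.Sum.Base using (_⊎_; inj₁; inj₂)
  open import Data.Vec.Base as Vec using (Vec; []; _∷_; here; there; _++_; take; drop; lookup)
  import Data.Vec.Properties as Vec
  import Data.Vec.Relation.Unary.All as VecAll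
  import Data.Vec.Relation.Unary.All.Properties as VecAll
  open import Data.Vec.Relation.Unary.AllPairs using ([]; _∷_)
  open import Data.Vec.Relation.Unary.Unique.Propositional using (Unique)
  import Data.Vec.Relation.Unary.Unique.Propositional.Properties as Unique
  open import Function.Base using (_∘_)
  open import Relation.Binary.PropositionalEquality
  open import Relation.Nullary.Decidable using (Dec; yes; no)
  open import Tactic.RingSolver using (solve-∀)
  open import Defs using (ℚ-ring; recip; recip-nonNeg; toSubset; MultiHypergraph; edges; ContainsRainbowEdge)
  open Rationals
  open RandomSubsets
  open Fragments
  open Counting

  private
    variable
      n k m : ℕ

  ∣++∣ : ∀ (u : Subset k) (v : Subset m) → ∣ u ++ v ∣ ≡ ∣ u ∣ ℕ.+ ∣ v ∣
  ∣++∣ []            v = refl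
  ∣++∣ (inside  ∷ u) v = cong suc (∣++∣ u v)
  ∣++∣ (outside ∷ u) v = ∣++∣ u v

  ∣take∣+∣drop∣ : ∀ k (U : Subset (k ℕ.+ m)) → ∣ U ∣ ≡ ∣ take k U ∣ ℕ.+ ∣ drop k U ∣
  ∣take∣+∣drop∣ zero    U             = refl
  ∣take∣+∣drop∣ (suc k) (inside  ∷ U) = cong suc (∣take∣+∣drop∣ k U)
  ∣take∣+∣drop∣ (suc k) (outside ∷ U) = ∣take∣+∣drop∣ k U

  sub-++ : ∀ (U : Subset (k ℕ.+ m)) (x : Subset k) y → sub U (x ++ y) ≡ sub (take k U) x * sub (drop k U) y
  sub-++ U             []            y = sym (ℚ.*-identityˡ (sub U y))
  sub-++ (inside  ∷ U) (inside  ∷ x) y = sub-++ U x y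
  sub-++ {suc k} (inside  ∷ U) (outside ∷ x) y = sym (ℚ.*-zeroˡ (sub (drop k U) y))
  sub-++ (outside ∷ U) (_       ∷ x) y = sub-++ U x y

  -- Block x of the vector is the fibre of pairs (x , i), in agreement with `combine`. A vertex that
  -- finds no colour left gets an empty block, which does not happen when there are at least |e|
  -- colours.
  colour : Subset n → List (Fin k) → Subset (n ℕ.* k)
  colour []            cs       = []
  colour (outside ∷ e) cs       = ⊥ ++ colour e cs
  colour (inside  ∷ e) []       = ⊥ ++ colour e []
  colour (inside  ∷ e) (c ∷ cs) = ⁅ c ⁆ ++ colour e cs

  ∣colour∣≤ : ∀ (e : Subset n) (cs : List (Fin k)) → ∣ colour e cs ∣ ℕ.≤ ∣ e ∣
  ∣colour∣≤         []            cs       = ℕ.z≤n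
  ∣colour∣≤ {k = k} (outside ∷ e) cs       rewrite ∣++∣ (⊥ {k}) (colour e cs) | ∣⊥∣≡0 k = ∣colour∣≤ e cs
  ∣colour∣≤ {k = k} (inside  ∷ e) []       rewrite ∣++∣ (⊥ {k}) (colour {k = k} e []) | ∣⊥∣≡0 k = ℕ.m≤n⇒m≤1+n
      (∣colour∣≤ {k = k} e [])
  ∣colour∣≤         (inside  ∷ e) (c ∷ cs) rewrite ∣++∣ ⁅ c ⁆ (colour e cs) | ∣⁅x⁆∣≡1 c = ℕ.s≤s (∣colour∣≤ e cs)

  elements : (e : Subset n) → Vec (Fin n) ∣ e ∣
  elements []            = []
  elements (inside  ∷ e) = zero ∷ Vec.map suc (elements e)
  elements (outside ∷ e) = Vec.map suc (elements e)

  elements-unique : (e : Subset n) → Unique (elements e)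
  elements-unique []            = []
  elements-unique (inside  ∷ e) = VecAll.map⁺ (VecAll.universal (λ _ ()) (elements e)) ∷ Unique.map⁺ suc-injective
      (elements-unique e)
  elements-unique (outside ∷ e) = Unique.map⁺ suc-injective (elements-unique e)

  toSubset-map-suc : ∀ {t} (xs : Vec (Fin n) t) → toSubset (Vec.map suc xs) ≡ outside ∷ toSubset xs
  toSubset-map-suc []       = refl
  toSubset-map-suc (x ∷ xs) = cong (⁅ suc x ⁆ ∪_) (toSubset-map-suc xs)

  toSubset-elements : (e : Subset n) → toSubset (elements e) ≡ e
  toSubset-elements []            = refl
  toSubset-elements (inside  ∷ e) = trans (cong (⁅ zero ⁆ ∪_) (toSubset-map-suc (elements e)))
    (cong (inside ∷_) (trans (∪-identityˡ (toSubset (elements e))) (toSubset-elements e)))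
  toSubset-elements (outside ∷ e) = trans (toSubset-map-suc (elements e)) (cong (outside ∷_) (toSubset-elements e))

  prefix : ∀ {A : Set} {t} (xs : List A) → t ℕ.≤ length xs → Vec A t
  prefix xs t≤ = Vec.truncate t≤ (Vec.fromList xs)

  prefix-all : ∀ {A : Set} {P : A → Set} {t} {xs : List A} (t≤ : t ℕ.≤ length xs) → All P xs → VecAll.All P (prefix xs t≤)
  prefix-all {t = zero} _ _ = VecAll.[]
  prefix-all {t = suc _} {_ ∷ _} (ℕ.s≤s t≤) (px ∷ pxs) = px VecAll.∷ prefix-all t≤ pxs

  prefix-unique : ∀ {A : Set} {t} {xs : List A} (t≤ : t ℕ.≤ length xs) → List.Unique xs → Unique (prefix xs t≤)
  prefix-unique {t = zero} _ _ = []
  prefix-unique {t = suc _} {_ ∷ _} (ℕ.s≤s t≤) (x∉ ∷ xs!) = prefix-all t≤ x∉ ∷ prefix-unique t≤ xs!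

  ∈-++ˡ : ∀ {x} {p : Subset k} {q : Subset m} → x ∈ p → x ↑ˡ m ∈ p ++ q
  ∈-++ˡ here       = here
  ∈-++ˡ (there x∈) = there (∈-++ˡ x∈)

  ∈-++ʳ : ∀ (p : Subset k) {q : Subset m} {x} → x ∈ q → k ↑ʳ x ∈ p ++ q
  ∈-++ʳ []      x∈ = x∈
  ∈-++ʳ (_ ∷ p) x∈ = there (∈-++ʳ p x∈)

  ∈-colour : ∀ (e : Subset n) (cs : List (Fin k)) (e≤ : ∣ e ∣ ℕ.≤ length cs) j →
    combine (lookup (elements e) j) (lookup (prefix cs e≤) j) ∈ colour e cs
  ∈-colour (outside ∷ e) cs e≤ j =
    subst (λ x → combine x (lookup (prefix cs e≤) j) ∈ colour (outside ∷ e) cs)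
      (sym (Vec.lookup-map j suc (elements e))) (∈-++ʳ ⊥ (∈-colour e cs e≤ j))
  ∈-colour (inside ∷ e) (c ∷ cs) (ℕ.s≤s e≤) zero    = ∈-++ˡ (x∈⁅x⁆ c)
  ∈-colour (inside ∷ e) (c ∷ cs) (ℕ.s≤s e≤) (suc j) =
    subst (λ x → combine x (lookup (prefix cs e≤) j) ∈ colour (inside ∷ e) (c ∷ cs))
      (sym (Vec.lookup-map j suc (elements e))) (∈-++ʳ ⁅ c ⁆ (∈-colour e cs e≤ j))

  colour⊆⇒rainbow : ∀ (H : MultiHypergraph n) {W} {e} {cs : List (Fin k)} → e ∈ˡ edges H → ∣ e ∣ ℕ.≤ length cs →
    List.Unique cs → colour e cs ⊆ W → ContainsRainbowEdge H k W
  colour⊆⇒rainbow H {e = e} {cs} e∈H e≤ cs! ⊆W =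
    ∣ e ∣ , elements e , prefix cs e≤ , elements-unique e ,
    subst (_∈ˡ edges H) (sym (toSubset-elements e)) e∈H , prefix-unique e≤ cs! ,
    λ j → ⊆W (∈-colour e cs e≤ j)

  -- The trace of U on one fibre. Coloured edges meet a fibre in at most one point, so a row with
  -- `many` points keeps U out of every copy of every edge.
  data Row (u : Subset k) : Set where
    empty  : u ≡ ⊥ → Row u
    single : ∀ c → u ≡ ⁅ c ⁆ → Row u
    many   : sub u ⊥ ≡ 0ℚ → (∀ c → sub u ⁅ c ⁆ ≡ 0ℚ) → Row u

  sub-⁅⁆-⊥ : ∀ (c : Fin k) → sub ⁅ c ⁆ ⊥ ≡ 0ℚ
  sub-⁅⁆-⊥ zero    = refl
  sub-⁅⁆-⊥ (suc c) = sub-⁅⁆-⊥ c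

  row : (u : Subset k) → Row u
  row [] = empty refl
  row (inside ∷ u) with row u
  ... | empty refl    = single zero refl
  ... | single c refl = many refl λ { zero → sub-⁅⁆-⊥ c ; (suc _) → refl }
  ... | many u⊈⊥ _    = many refl λ { zero → u⊈⊥ ; (suc _) → refl }
  row (outside ∷ u) with row u
  ... | empty refl    = empty refl
  ... | single c refl = single (suc c) refl
  ... | many u⊈⊥ u⊈⁅⁆ = many u⊈⊥ λ { zero → u⊈⊥ ; (suc c) → u⊈⁅⁆ c }

  mark : {u : Subset k} → Row u → Bool
  mark (empty _)    = outside
  mark (single _ _) = inside
  mark (many _ _)   = inside

  -- The projection of U to the vertex set.
  shadow : Subset (n ℕ.* k) → Subset n
  shadow {zero}      U = []
  shadow {suc n} {k} U = mark (row (take k U)) ∷ shadow {n} (drop k U)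

  open Injections using (Pattern; match; fixed)

  -- U has at most one point in each fibre, and only over vertices of e. `pattern′` lists along
  -- these vertices the colours that U demands; `shadow≡` expresses that U projects injectively.
  record Compatible (e : Subset n) (U : Subset (n ℕ.* k)) : Set where
    constructor compatible
    field
      pattern′  : Pattern k
      length≤   : length pattern′ ℕ.≤ ∣ e ∣
      fixed≡    : length (fixed k pattern′) ≡ ∣ U ∣
      sub≤match : ∀ cs → ∣ e ∣ ℕ.≤ length cs → sub U (colour e cs) ≤ match k pattern′ cs
      shadow⊆   : sub (shadow {n} U) e ≡ 1ℚ
      shadow≡   : ∣ shadow {n} U ∣ ≡ ∣ U ∣

  -- Vertex by vertex: two points of U in one fibre, or a point over a vertex outside e, exclude all
  -- copies of e at once; any other fibre extends the pattern.
  compatible? : ∀ (e : Subset n) (U : Subset (n ℕ.* k)) →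
    (∀ cs → ∣ e ∣ ℕ.≤ length cs → sub U (colour e cs) ≡ 0ℚ) ⊎ Compatible e U
  compatible? []            [] = inj₂ (compatible [] ℕ.z≤n refl (λ _ _ → ≤-refl) refl refl)
  compatible? {suc n} {k} (b ∷ e) U = go b (row (take k U)) refl (compatible? e (drop k U))
    where
    u = take k U
    U′ = drop k U
    zeroˡ : ∀ x cs → sub u x ≡ 0ℚ → sub U (x ++ colour e cs) ≡ 0ℚ
    zeroˡ x cs eq = trans (sub-++ U x (colour e cs)) (trans (cong (_* sub U′ (colour e cs)) eq)
        (ℚ.*-zeroˡ (sub U′ (colour e cs))))
    zeroʳ : ∀ x cs → sub U′ (colour e cs) ≡ 0ℚ → sub U (x ++ colour e cs) ≡ 0ℚ
    zeroʳ x cs eq = trans (sub-++ U x (colour e cs)) (trans (cong (sub u x *_) eq) (ℚ.*-zeroʳ (sub u x)))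
    oneˡ : ∀ x cs → u ≡ ⊥ → sub U (x ++ colour e cs) ≡ sub U′ (colour e cs)
    oneˡ x cs u≡⊥ = trans (sub-++ U x (colour e cs))
      (trans (cong (_* sub U′ (colour e cs)) (⊆⇒sub≡1 (subst (_⊆ x) (sym u≡⊥) (⊆-min x)))) (ℚ.*-identityˡ _))
    ∣U∣-empty : u ≡ ⊥ → ∣ U′ ∣ ≡ ∣ U ∣
    ∣U∣-empty u≡⊥ = sym (trans (∣take∣+∣drop∣ k U) (cong (ℕ._+ ∣ U′ ∣) (trans (cong ∣_∣ u≡⊥) (∣⊥∣≡0 k))))
    ∣U∣-single : ∀ {c} → u ≡ ⁅ c ⁆ → suc ∣ U′ ∣ ≡ ∣ U ∣
    ∣U∣-single {c} u≡ = sym (trans (∣take∣+∣drop∣ k U) (cong (ℕ._+ ∣ U′ ∣) (trans (cong ∣_∣ u≡) (∣⁅x⁆∣≡1 c))))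
    sub-single : ∀ {c} c′ → u ≡ ⁅ c ⁆ → sub u ⁅ c′ ⁆ ≤ 𝟙 (c′ ≟ c)
    sub-single {c} c′ u≡ = subst (_≤ 𝟙 (c′ ≟ c)) (trans (𝟙-⊆? ⁅ c ⁆ ⁅ c′ ⁆) (cong (λ v → sub v ⁅ c′ ⁆) (sym u≡)))
      (𝟙-mono (⁅ c ⁆ ⊆? ⁅ c′ ⁆) (c′ ≟ c) (λ ⊆ → sym (x∈⁅y⁆⇒x≡y c′ (⊆ (x∈⁅x⁆ c)))))

    go : ∀ b (ρ : Row u) → row u ≡ ρ →
      (∀ cs → ∣ e ∣ ℕ.≤ length cs → sub U′ (colour e cs) ≡ 0ℚ) ⊎ Compatible e U′ →
      (∀ cs → ∣ b ∷ e ∣ ℕ.≤ length cs → sub U (colour (b ∷ e) cs) ≡ 0ℚ) ⊎ Compatible (b ∷ e) U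
    go outside _ _ (inj₁ z) = inj₁ λ cs e≤ → zeroʳ ⊥ cs (z cs e≤)
    go inside  _ _ (inj₁ z) = inj₁ λ { (c ∷ cs) (ℕ.s≤s e≤) → zeroʳ ⁅ c ⁆ cs (z cs e≤) }
    go outside (many u⊈⊥ _) _ _ = inj₁ λ cs _ → zeroˡ ⊥ cs u⊈⊥
    go inside  (many _ u⊈) _ _ = inj₁ λ { (c ∷ cs) _ → zeroˡ ⁅ c ⁆ cs (u⊈ c) }
    go outside (single c u≡) _ _ = inj₁ λ cs _ → zeroˡ ⊥ cs (trans (cong (λ v → sub v ⊥) u≡) (sub-⁅⁆-⊥ c))
    go outside (empty u≡⊥) eq (inj₂ (compatible π π≤ fixed≡ sub≤ shadow⊆ shadow≡)) = inj₂ (compatible π π≤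
      (trans fixed≡ (∣U∣-empty u≡⊥))
      (λ cs e≤ → ≤-trans (≤-reflexive (oneˡ ⊥ cs u≡⊥)) (sub≤ cs e≤))
      (trans (cong (λ ρ → sub (mark ρ ∷ shadow {n} U′) (outside ∷ e)) eq) shadow⊆)
      (trans (cong (λ ρ → ∣ mark ρ ∷ shadow {n} U′ ∣) eq) (trans shadow≡ (∣U∣-empty u≡⊥))))
    go inside (empty u≡⊥) eq (inj₂ (compatible π π≤ fixed≡ sub≤ shadow⊆ shadow≡)) = inj₂ (compatible (nothing ∷ π) (ℕ.s≤s π≤)
      (trans fixed≡ (∣U∣-empty u≡⊥))
      (λ { (c ∷ cs) (ℕ.s≤s e≤) → ≤-trans (≤-reflexive (oneˡ ⁅ c ⁆ cs u≡⊥)) (sub≤ cs e≤) })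
      (trans (cong (λ ρ → sub (mark ρ ∷ shadow {n} U′) (inside ∷ e)) eq) shadow⊆)
      (trans (cong (λ ρ → ∣ mark ρ ∷ shadow {n} U′ ∣) eq) (trans shadow≡ (∣U∣-empty u≡⊥))))
    go inside (single d u≡) eq (inj₂ (compatible π π≤ fixed≡ sub≤ shadow⊆ shadow≡)) = inj₂
        (compatible (just d ∷ π) (ℕ.s≤s π≤)
      (trans (cong suc fixed≡) (∣U∣-single u≡))
      (λ { (c ∷ cs) (ℕ.s≤s e≤) → ≤-trans (≤-reflexive (sub-++ U ⁅ c ⁆ (colour e cs)))
             (*-mono (0≤sub u ⁅ c ⁆) (≤-trans (0≤sub U′ (colour e cs)) (sub≤ cs e≤)) (sub-single c u≡) (sub≤ cs e≤)) })
      (trans (cong (λ ρ → sub (mark ρ ∷ shadow {n} U′) (inside ∷ e)) eq) shadow⊆)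
      (trans (cong (λ ρ → ∣ mark ρ ∷ shadow {n} U′ ∣) eq) (trans (cong suc shadow≡) (∣U∣-single u≡))))

  module _ {n k′ r : ℕ} (r≤k : r ℕ.≤ suc k′) (F : List (Subset n)) (F-bounded : BoundedBy r F) where

    private
      K = suc k′
      β = ι 4 * recip k′
      0≤β = 0≤* (0≤ι 4) (recip-nonNeg k′)

    open Injections K using (sequences; injs-length; injs-unique; falling≤∣sequences∣)

    private
      N = ι (length (sequences r))

    -- Every edge gets one copy for each sequence of r distinct colours, whatever its size, so that
    -- all edges have the same number of copies.
    coloured : List (Subset (n ℕ.* K))
    coloured = concatMap (λ e → map (colour e) (sequences r)) F

    ∑-coloured : ∀ f → ∑ coloured f ≡ ∑ F (λ e → ∑ (sequences r) (f ∘ colour e))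
    ∑-coloured f = trans (∑-concatMap (λ e → map (colour e) (sequences r)) F f)
      (∑-cong F (λ e → ∑-map (colour e) (sequences r) f))

    length-coloured : ι (length coloured) ≡ ι (length F) * N
    length-coloured = begin
      ι (length coloured)                        ≡⟨ ℚ.*-identityʳ _ ⟨
      ι (length coloured) * 1ℚ                   ≡⟨ ∑-length coloured 1ℚ ⟨
      ∑ coloured (λ _ → 1ℚ)                      ≡⟨ ∑-coloured (λ _ → 1ℚ) ⟩
      ∑ F (λ e → ∑ (sequences r) (λ _ → 1ℚ))     ≡⟨ ∑-length F (∑ (sequences r) (λ _ → 1ℚ)) ⟩
      ι (length F) * ∑ (sequences r) (λ _ → 1ℚ)
        ≡⟨ cong (ι (length F) *_) (trans (∑-length (sequences r) 1ℚ) (ℚ.*-identityʳ N)) ⟩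
      ι (length F) * N                           ∎
      where open ≡-Reasoning

    ∈-coloured⁻ : ∀ {S} → S ∈ˡ coloured → Σ (Subset n) λ e → Σ
        (List (Fin K)) λ cs → e ∈ˡ F × cs ∈ˡ sequences r × S ≡ colour e cs
    ∈-coloured⁻ S∈ =
      let e , e∈F , S∈map = find (∈-concatMap⁻ (λ e → map (colour e) (sequences r)) {xs = F} S∈)
          cs , cs∈ , S≡ = ∈-map⁻ (colour e) S∈map
      in e , cs , e∈F , cs∈ , S≡

    coloured-bounded : BoundedBy r coloured
    coloured-bounded = All.tabulate λ S∈ → let e , cs , e∈F , cs∈ , S≡ = ∈-coloured⁻ S∈ in
      ℕ.≤-trans (ℕ.≤-reflexive (cong ∣_∣ S≡)) (ℕ.≤-trans (∣colour∣≤ e cs) (All.lookup F-bounded e∈F))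

    -- An edge with a copy containing U must contain the shadow of U, which has |U| vertices. There
    -- are at most σ^|U| |F| such edges, and a proportion of at most β^|U| of the copies of each
    -- contains U.
    coloured-spread : ∀ {σ} → 0ℚ ≤ σ → SpreadBy σ (ι (length F)) F → SpreadBy (β * σ) (ι (length coloured)) coloured
    coloured-spread {σ} 0≤σ F-spread U = begin
      ∑ coloured (sub U)
        ≡⟨ ∑-coloured (sub U) ⟩
      ∑ F (λ e → ∑ (sequences r) (λ cs → sub U (colour e cs)))
        ≤⟨ ∑-mono-∈ F (λ {e} e∈F → copies e (All.lookup F-bounded e∈F) (compatible? e U)) ⟩
      -- That |S| = |U| is known only once some edge is compatible with U; the indicator carries
      -- this fact out of the sum over e.
      ∑ F (λ e → sub S e * (𝟙 (∣ S ∣ ℕ.≟ ∣ U ∣) * (pow β ∣ U ∣ * N)))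
        ≡⟨ ∑-*ʳ F (sub S) _ ⟩
      deg F S * (𝟙 (∣ S ∣ ℕ.≟ ∣ U ∣) * (pow β ∣ U ∣ * N))
        ≤⟨ total (∣ S ∣ ℕ.≟ ∣ U ∣) ⟩
      pow (β * σ) ∣ U ∣ * (ι (length F) * N)
        ≡⟨ cong (pow (β * σ) ∣ U ∣ *_) length-coloured ⟨
      pow (β * σ) ∣ U ∣ * ι (length coloured) ∎
      where
      open ℚ.≤-Reasoning
      S = shadow {n} {K} U
      0≤N = 0≤ι (length (sequences r))
      copies : ∀ e → ∣ e ∣ ℕ.≤ r →
        (∀ cs → ∣ e ∣ ℕ.≤ length cs → sub U (colour e cs) ≡ 0ℚ) ⊎ Compatible e U →
        ∑ (sequences r) (λ cs → sub U (colour e cs)) ≤ sub S e * (𝟙 (∣ S ∣ ℕ.≟ ∣ U ∣) * (pow β ∣ U ∣ * N))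
      copies e e≤r (inj₁ z) = begin
        ∑ (sequences r) (λ cs → sub U (colour e cs))
          ≡⟨ ∑-zero-∈ (sequences r) (λ {cs} cs∈ → z cs (ℕ.≤-trans e≤r
              (ℕ.≤-reflexive (sym (injs-length (allFin K) r cs∈))))) ⟩
        0ℚ
          ≤⟨ 0≤* (0≤sub S e) (0≤* (0≤𝟙 (∣ S ∣ ℕ.≟ ∣ U ∣)) (0≤* (0≤pow 0≤β ∣ U ∣) 0≤N)) ⟩
        sub S e * (𝟙 (∣ S ∣ ℕ.≟ ∣ U ∣) * (pow β ∣ U ∣ * N)) ∎
      copies e e≤r (inj₂ (compatible π π≤ fixed≡ sub≤ shadow⊆ shadow≡)) = begin
        ∑ (sequences r) (λ cs → sub U (colour e cs))
          ≤⟨ ∑-mono-∈ (sequences r) (λ {cs} cs∈ → sub≤ cs (ℕ.≤-trans e≤r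
              (ℕ.≤-reflexive (sym (injs-length (allFin K) r cs∈))))) ⟩
        ∑ (sequences r) (match K π)
          ≤⟨ count-sequences k′ r r≤k π (ℕ.≤-trans π≤ e≤r) ⟩
        pow β (length (fixed K π)) * N
          ≡⟨ cong (λ t → pow β t * N) fixed≡ ⟩
        pow β ∣ U ∣ * N
          ≡⟨ trans (ℚ.*-identityˡ _) (ℚ.*-identityˡ (pow β ∣ U ∣ * N)) ⟨
        1ℚ * (1ℚ * (pow β ∣ U ∣ * N))
          ≡⟨ cong₂ (λ x y → x * (y * (pow β ∣ U ∣ * N))) shadow⊆ (𝟙-true (∣ S ∣ ℕ.≟ ∣ U ∣) shadow≡) ⟨
        sub S e * (𝟙 (∣ S ∣ ℕ.≟ ∣ U ∣) * (pow β ∣ U ∣ * N)) ∎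
      total : (d : Dec (∣ S ∣ ≡ ∣ U ∣)) → deg F S * (𝟙 d * (pow β ∣ U ∣ * N)) ≤ pow (β * σ) ∣ U ∣ * (ι (length F) * N)
      total (no _) = begin
        deg F S * (0ℚ * (pow β ∣ U ∣ * N))        ≡⟨ lemma (deg F S) (pow β ∣ U ∣ * N) ⟩
        0ℚ                                        ≤⟨ 0≤* (0≤pow (0≤* 0≤β 0≤σ) ∣ U ∣) (0≤* (0≤ι (length F)) 0≤N) ⟩
        pow (β * σ) ∣ U ∣ * (ι (length F) * N)    ∎
        where
        lemma : ∀ x y → x * (0ℚ * y) ≡ 0ℚ
        lemma = solve-∀ ℚ-ring
      total (yes ∣S∣≡∣U∣) = begin
        deg F S * (1ℚ * (pow β ∣ U ∣ * N))
          ≤⟨ *-monoʳ (0≤* 0≤1 (0≤* (0≤pow 0≤β ∣ U ∣) 0≤N)) (F-spread S) ⟩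
        pow σ ∣ S ∣ * ι (length F) * (1ℚ * (pow β ∣ U ∣ * N))
          ≡⟨ cong (λ t → pow σ t * ι (length F) * (1ℚ * (pow β ∣ U ∣ * N))) ∣S∣≡∣U∣ ⟩
        pow σ ∣ U ∣ * ι (length F) * (1ℚ * (pow β ∣ U ∣ * N))
          ≡⟨ lemma (pow σ ∣ U ∣) (ι (length F)) (pow β ∣ U ∣) N ⟩
        pow β ∣ U ∣ * pow σ ∣ U ∣ * (ι (length F) * N)
          ≡⟨ cong (_* (ι (length F) * N)) (pow-* β σ ∣ U ∣) ⟨
        pow (β * σ) ∣ U ∣ * (ι (length F) * N) ∎
        where
        lemma : ∀ s l b N → s * l * (1ℚ * (b * N)) ≡ b * s * (l * N)
        lemma = solve-∀ ℚ-ring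

    -- As r ≤ k, sequences of r distinct colours exist.
    0<∣coloured∣ : 0 ℕ.< length F → 0ℚ < ι (length coloured)
    0<∣coloured∣ 0<F = subst (0ℚ <_) (sym length-coloured) (0<* (0<ι (length F) {{ℕ.>-nonZero 0<F}}) 0<N)
      where
      falling-pos : ∀ k r → r ℕ.≤ k → 0 ℕ.< falling k r
      falling-pos k       zero    _           = ℕ.s≤s ℕ.z≤n
      falling-pos (suc k) (suc r) (ℕ.s≤s r≤k) = ℕ.*-mono-< {0} {suc k} {0} (ℕ.s≤s ℕ.z≤n) (falling-pos k r r≤k)
      0<N : 0ℚ < N
      0<N = ℚ.<-≤-trans (0<ι (falling K r) {{ℕ.>-nonZero (falling-pos K r r≤k)}}) (falling≤∣sequences∣ r)

-- Probabilities as expectations at rational densities, and a lower bound for log r.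

module RainbowProbability where

  open import Data.Bool.Base using (if_then_else_)
  open import Data.Fin.Subset using (Subset; inside; outside; _⊆_; ∣_∣)
  open import Data.Fin.Subset.Properties using (_⊆?_)
  open import Data.List.Base as List using (List; []; _∷_; length; filter; map)
  open import Data.List.Membership.Propositional using (find)
  import Data.List.Relation.Unary.All as All
  open import Data.List.Relation.Unary.Any using (Any; any?)
  open import Data.Nat.Base as ℕ using (ℕ; zero; suc)
  import Data.Nat.Properties as ℕ
  open import Data.Product.Base using (∃; _×_; _,_)
  open import Data.Rational.Base hiding (_>_; _≥_) renaming (∣_∣ to ∣_∣ℚ)
  open import Data.Rational.Properties as ℚ using (≤-refl; ≤-reflexive; ≤-trans)
  open import Data.Sum.Base using (inj₁; inj₂)
  open import Data.Vec.Base using ([]; _∷_)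
  open import Function.Base using (_∘_)
  open import Level using (0ℓ)
  open import Relation.Binary.PropositionalEquality
  open import Relation.Nullary.Negation using (contradiction)
  open import Relation.Nullary.Decidable using (Dec; yes; no; does; ¬?)
  open import Relation.Unary using (Decidable; Pred)
  open import Tactic.RingSolver using (solve-∀)
  open import Defs using (ℚ-ring; recip; recip-nonNeg; harmonic; harmonic-lower; logSeq; ·-recip; half-pos;
    allSubsets; Pr; weight; seq; ℝ; MultiHypergraph; edges; Bounded; containsRainbowEdge?)
  import Defs
  open Rationals
  open RandomSubsets
  open Fragments
  open Rounds
  open Counting
  open Colourings

  private
    variable
      m : ℕ

  limit-≤ : ∀ {a b} → (∀ δ → 0ℚ < δ → a ≤ b + δ) → a ≤ b
  limit-≤ {a} {b} a≤b+δ with a ℚ.≤? b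
  ... | yes a≤b = a≤b
  ... | no  a≰b = contradiction (ℚ.<-≤-trans gap (a≤b+δ δ 0<δ)) (ℚ.<-irrefl refl)
    where
    0<a-b : 0ℚ < a - b
    0<a-b = subst (_< a - b) (ℚ.+-inverseʳ b) (ℚ.+-monoˡ-< (- b) (ℚ.≰⇒> a≰b))
    δ = ½ * (a - b)
    0<δ = half-pos 0<a-b
    split : b + δ + δ ≡ a
    split = trans (ℚ.+-assoc b δ δ) (trans (cong (b +_) (Defs.half+half (a - b))) (a+[b-a]≡b b a))
    gap : b + δ < a
    gap = subst₂ _<_ (ℚ.+-identityʳ (b + δ)) split (ℚ.+-monoʳ-< (b + δ) 0<δ)

  -- A sequence representing a real number of [0 , 1] may leave [0 , 1]: its terms are clamped, and
  -- 𝔼 changes little under the clamping.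

  lip : ℕ → ℚ
  lip zero    = 0ℚ
  lip (suc m) = (2ℚ + 2ℚ) * lip m + 1ℚ

  0≤lip : ∀ m → 0ℚ ≤ lip m
  0≤lip zero    = ≤-refl
  0≤lip (suc m) = 0≤+ (0≤* (0≤+ 0≤2 0≤2) (0≤lip m)) 0≤1

  𝔼≤1 : ∀ {q} → 0ℚ ≤ q → q ≤ 1ℚ → {f : Subset m → ℚ} → (∀ W → f W ≤ 1ℚ) → 𝔼 q f ≤ 1ℚ
  𝔼≤1 {m} {q} 0≤q q≤1 {f} f≤1 = subst (𝔼 q f ≤_) (𝔼-const {m} q 1ℚ) (∫-mono 0≤q (p≤q⇒0≤q-p q≤1) f≤1)

  ∣p-q∣≤1 : ∀ {p q} → 0ℚ ≤ p → p ≤ 1ℚ → 0ℚ ≤ q → q ≤ 1ℚ → ∣ p - q ∣ℚ ≤ 1ℚ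
  ∣p-q∣≤1 = Defs.∣-∣-interval {0ℚ} {1ℚ}

  ∣p∣≤2 : ∀ {p q d} → 0ℚ ≤ q → q ≤ 1ℚ → ∣ p - q ∣ℚ ≤ d → d ≤ 1ℚ → ∣ p ∣ℚ ≤ 2ℚ
  ∣p∣≤2 {p} {q} {d} 0≤q q≤1 p-q≤d d≤1 = begin
    ∣ p ∣ℚ              ≡⟨ cong ∣_∣ℚ (a+[b-a]≡b q p) ⟨
    ∣ q + (p - q) ∣ℚ    ≤⟨ ℚ.∣p+q∣≤∣p∣+∣q∣ q (p - q) ⟩
    ∣ q ∣ℚ + ∣ p - q ∣ℚ  ≤⟨ ℚ.+-mono-≤ (≤-trans (≤-reflexive (ℚ.0≤p⇒∣p∣≡p 0≤q)) q≤1) (≤-trans p-q≤d d≤1) ⟩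
    2ℚ                 ∎
    where open ℚ.≤-Reasoning

  -- Splitting off one coordinate leaves two smaller instances, with weights p and 1 - p of absolute
  -- value at most 2, and p - q times a difference of numbers in [0 , 1]: hence the recursion 4 l +
  -- 1 of `lip`.
  𝔼-lipschitz : ∀ {p q d} → 0ℚ ≤ q → q ≤ 1ℚ → ∣ p - q ∣ℚ ≤ d → d ≤ 1ℚ → {f : Subset m → ℚ} →
    (∀ W → 0ℚ ≤ f W) → (∀ W → f W ≤ 1ℚ) → ∣ 𝔼 p f - 𝔼 q f ∣ℚ ≤ lip m * d
  𝔼-lipschitz {zero} {d = d} 0≤q q≤1 p-q≤d d≤1 {f} 0≤f f≤1 =
    ≤-reflexive (trans (cong ∣_∣ℚ (ℚ.+-inverseʳ (f []))) (sym (ℚ.*-zeroˡ d)))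
  𝔼-lipschitz {suc m} {p} {q} {d} 0≤q q≤1 p-q≤d d≤1 {f} 0≤f f≤1 = begin
    ∣ (p * A + (1ℚ - p) * B) - (q * A′ + (1ℚ - q) * B′) ∣ℚ
      ≡⟨ cong ∣_∣ℚ (lemma p q A B A′ B′) ⟩
    ∣ (p * (A - A′) + (1ℚ - p) * (B - B′)) + (p - q) * (A′ - B′) ∣ℚ
      ≤⟨ ≤-trans (ℚ.∣p+q∣≤∣p∣+∣q∣ (p * (A - A′) + (1ℚ - p) * (B - B′)) ((p - q) * (A′ - B′)))
           (ℚ.+-monoˡ-≤ ∣ (p - q) * (A′ - B′) ∣ℚ (ℚ.∣p+q∣≤∣p∣+∣q∣ (p * (A - A′)) ((1ℚ - p) * (B - B′)))) ⟩
    (∣ p * (A - A′) ∣ℚ + ∣ (1ℚ - p) * (B - B′) ∣ℚ) + ∣ (p - q) * (A′ - B′) ∣ℚ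
      ≡⟨ cong₂ _+_ (cong₂ _+_ (ℚ.∣p*q∣≡∣p∣*∣q∣ p (A - A′)) (ℚ.∣p*q∣≡∣p∣*∣q∣ (1ℚ - p) (B - B′)))
           (ℚ.∣p*q∣≡∣p∣*∣q∣ (p - q) (A′ - B′)) ⟩
    (∣ p ∣ℚ * ∣ A - A′ ∣ℚ + ∣ 1ℚ - p ∣ℚ * ∣ B - B′ ∣ℚ) + ∣ p - q ∣ℚ * ∣ A′ - B′ ∣ℚ
      ≤⟨ ℚ.+-mono-≤ (ℚ.+-mono-≤
           (*-mono (ℚ.0≤∣p∣ p) 0≤lipd (∣p∣≤2 0≤q q≤1 p-q≤d d≤1)
               (𝔼-lipschitz 0≤q q≤1 p-q≤d d≤1 (0≤f ∘ (inside ∷_)) (f≤1 ∘ (inside ∷_))))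
           (*-mono (ℚ.0≤∣p∣ (1ℚ - p)) 0≤lipd ∣1-p∣≤2 (𝔼-lipschitz 0≤q q≤1 p-q≤d d≤1 (0≤f ∘ (outside ∷_))
               (f≤1 ∘ (outside ∷_)))))
           (*-mono (ℚ.0≤∣p∣ (p - q)) 0≤1 p-q≤d
             (∣p-q∣≤1 (0≤∫ 0≤q 0≤1-q (0≤f ∘ (inside ∷_))) (𝔼≤1 0≤q q≤1 (f≤1 ∘ (inside ∷_)))
                      (0≤∫ 0≤q 0≤1-q (0≤f ∘ (outside ∷_))) (𝔼≤1 0≤q q≤1 (f≤1 ∘ (outside ∷_))))) ⟩
    (2ℚ * (lip m * d) + 2ℚ * (lip m * d)) + d * 1ℚ
      ≡⟨ lemma′ 2ℚ (lip m) d ⟩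
    lip (suc m) * d ∎
    where
    open ℚ.≤-Reasoning
    A = 𝔼 p (f ∘ (inside ∷_))
    B = 𝔼 p (f ∘ (outside ∷_))
    A′ = 𝔼 q (f ∘ (inside ∷_))
    B′ = 𝔼 q (f ∘ (outside ∷_))
    0≤1-q = p≤q⇒0≤q-p q≤1
    0≤lipd : 0ℚ ≤ lip m * d
    0≤lipd = 0≤* (0≤lip m) (≤-trans (ℚ.0≤∣p∣ (p - q)) p-q≤d)
    flip : ∀ p q → (1ℚ - p) - (1ℚ - q) ≡ - (p - q)
    flip = solve-∀ ℚ-ring
    1-q≤1 : 1ℚ - q ≤ 1ℚ
    1-q≤1 = ℚ.+-monoʳ-≤ 1ℚ (ℚ.neg-antimono-≤ 0≤q)
    ∣1-p∣≤2 : ∣ 1ℚ - p ∣ℚ ≤ 2ℚ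
    ∣1-p∣≤2 = ∣p∣≤2 0≤1-q 1-q≤1 (subst (_≤ d) (sym (trans (cong ∣_∣ℚ (flip p q)) (ℚ.∣-p∣≡∣p∣ (p - q)))) p-q≤d) d≤1
    lemma : ∀ p q A B A′ B′ → (p * A + (1ℚ - p) * B) - (q * A′ + (1ℚ - q) * B′)
      ≡ (p * (A - A′) + (1ℚ - p) * (B - B′)) + (p - q) * (A′ - B′)
    lemma = solve-∀ ℚ-ring
    lemma′ : ∀ t l d → (t * (l * d) + t * (l * d)) + d * 1ℚ ≡ ((t + t) * l + 1ℚ) * d
    lemma′ = solve-∀ ℚ-ring

  -- The last component lets a lower bound for q pass to Q; its condition a ≤ 1 serves the case Q =
  -- 1.
  clamp : ∀ {q d} → 0ℚ ≤ q + d → q ≤ 1ℚ + d → 0ℚ ≤ d →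
    ∃ λ Q → 0ℚ ≤ Q × Q ≤ 1ℚ × ∣ q - Q ∣ℚ ≤ d × (∀ {a} → a ≤ q → a ≤ 1ℚ → a ≤ Q)
  clamp {q} {d} 0≤q+d q≤1+d 0≤d with ℚ.≤-total 0ℚ q | ℚ.≤-total q 1ℚ
  ... | inj₂ q≤0 | _        = 0ℚ , ≤-refl , 0≤1 ,
    Defs.∣-∣-interval ≤-refl (≤-trans q≤0 0≤q+d) q≤0 0≤q+d , λ a≤q _ → ≤-trans a≤q q≤0
  ... | inj₁ 0≤q | inj₂ 1≤q = 1ℚ , 0≤1 , ≤-refl ,
    Defs.∣-∣-interval 1≤q q≤1+d ≤-refl (a≤a+b {1ℚ} 0≤d) , λ _ a≤1 → a≤1
  ... | inj₁ 0≤q | inj₁ q≤1 = q , 0≤q , q≤1 ,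
    ≤-trans (≤-reflexive (cong ∣_∣ℚ (ℚ.+-inverseʳ q))) 0≤d , λ a≤q _ → a≤q

  wt : ℚ → Subset m → ℚ
  wt q []      = 1ℚ
  wt q (b ∷ W) = (if b then q else 1ℚ - q) * wt q W

  ∑-allSubsets : ∀ q (f : Subset m → ℚ) → ∑ (allSubsets m) (λ W → f W * wt q W) ≡ 𝔼 q f
  ∑-allSubsets {zero}  q f = trans (ℚ.+-identityʳ _) (ℚ.*-identityʳ (f []))
  ∑-allSubsets {suc m} q f = trans
    (∑-++ (map (inside ∷_) (allSubsets m)) (map (outside ∷_) (allSubsets m)) (λ W → f W * wt q W))
    (cong₂ _+_ (part inside q refl) (part outside (1ℚ - q) refl))
    where
    lemma : ∀ y z w → y * (z * w) ≡ z * (y * w)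
    lemma = solve-∀ ℚ-ring
    part : ∀ b c → (if b then q else 1ℚ - q) ≡ c →
      ∑ (map (b ∷_) (allSubsets m)) (λ W → f W * wt q W) ≡ c * 𝔼 q (f ∘ (b ∷_))
    part b c refl = trans (∑-map (b ∷_) (allSubsets m) (λ W → f W * wt q W))
      (trans (∑-cong (allSubsets m) (λ W → lemma (f (b ∷ W)) c (wt q W)))
        (trans (∑-*ˡ (allSubsets m) c (λ W → f (b ∷ W) * wt q W)) (cong (c *_) (∑-allSubsets q (f ∘ (b ∷_))))))

  -- Real sums and products are formed termwise, so each term of the probability is the same
  -- polynomial at a rational density.
  seq-Pr : ∀ (ρ : ℝ) {E : Pred (Subset m) 0ℓ} (E? : Decidable E) n →
    seq (Pr ρ E?) n ≡ 𝔼 (seq ρ n) (λ W → 𝟙 (E? W))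
  seq-Pr {m} ρ E? n = begin
    seq (Pr ρ E?) n
      ≡⟨ seq-sum (filter E? (allSubsets m)) ⟩
    ∑ (filter E? (allSubsets m)) (λ W → seq (weight ρ W) n)
      ≡⟨ ∑-cong (filter E? (allSubsets m)) seq-weight ⟩
    ∑ (filter E? (allSubsets m)) (wt (seq ρ n))
      ≡⟨ ∑-filter E? (allSubsets m) (wt (seq ρ n)) ⟩
    ∑ (allSubsets m) (λ W → 𝟙 (E? W) * wt (seq ρ n) W)
      ≡⟨ ∑-allSubsets (seq ρ n) (λ W → 𝟙 (E? W)) ⟩
    𝔼 (seq ρ n) (λ W → 𝟙 (E? W)) ∎
    where
    open ≡-Reasoning
    seq-sum : ∀ {m} (Ws : List (Subset m)) →
      seq (List.foldr Defs._+_ Defs.0ℝ (map (weight ρ) Ws)) n ≡ ∑ Ws (λ W → seq (weight ρ W) n)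
    seq-sum []       = refl
    seq-sum (W ∷ Ws) = cong (seq (weight ρ W) n +_) (seq-sum Ws)
    seq-weight : ∀ {m} (W : Subset m) → seq (weight ρ W) n ≡ wt (seq ρ n) W
    seq-weight []            = refl
    seq-weight (inside  ∷ W) = cong (seq ρ n *_) (seq-weight W)
    seq-weight (outside ∷ W) = cong ((1ℚ - seq ρ n) *_) (seq-weight W)

  -- A coloured copy inside W yields a rainbow edge, so the event fails only where `miss` is 1;
  -- `𝔼-miss≤` is applied with s = 4σ / k, the spread parameter of the coloured hypergraph.
  rainbow-probability : ∀ {n r k k′ σ Q} → k ≡ suc k′ → ∀ v j (H : MultiHypergraph n) → Bounded r H → r ℕ.≤ k →
    0ℚ ≤ σ → SpreadBy σ (ι (length (edges H))) (edges H) → r ℕ.≤ 2 ℕ.^ j ℕ.* suc v →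
    ι (8 ℕ.* j ℕ.+ 2 ℕ.* (suc v ℕ.* suc v)) * (ι 4 * recip k′ * σ) ≤ Q → Q ≤ 1ℚ →
    1ℚ - ι 3 * recip v ≤ 𝔼 Q (λ W → 𝟙 (containsRainbowEdge? H k W))
  rainbow-probability {n} {r} {_} {k′} {σ} {Q} refl v j H H-bounded r≤k 0≤σ H-spread r≤b d≤Q Q≤1 = begin
    1ℚ - ι 3 * recip v
      ≤⟨ ℚ.+-monoʳ-≤ 1ℚ (ℚ.neg-antimono-≤ (𝔼-miss≤ 0≤s v j F (0<∣coloured∣ r≤k (edges H) H-bounded (ℕ.s≤s ℕ.z≤n))
           (All.map (λ S≤r → ℕ.≤-trans S≤r r≤b) (coloured-bounded r≤k (edges H) H-bounded))
           (coloured-spread r≤k (edges H) H-bounded 0≤σ H-spread) d≤Q Q≤1)) ⟩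
    1ℚ - 𝔼 Q (miss F)
      ≡⟨ cong (_- 𝔼 Q (miss F)) (𝔼-const {n ℕ.* suc k′} Q 1ℚ) ⟨
    𝔼 {n ℕ.* suc k′} Q (λ _ → 1ℚ) - 𝔼 Q (miss F)
      ≤⟨ ℚ.+-monoˡ-≤ (- 𝔼 Q (miss F)) (∫-mono 0≤Q (p≤q⇒0≤q-p Q≤1) hit) ⟩
    𝔼 Q (λ W → miss F W + hits W) - 𝔼 Q (miss F)
      ≡⟨ cong (_- 𝔼 Q (miss F)) (∫-+ Q (1ℚ - Q) (miss F) hits) ⟩
    𝔼 Q (miss F) + 𝔼 Q hits - 𝔼 Q (miss F)
      ≡⟨ lemma (𝔼 Q (miss F)) (𝔼 Q hits) ⟩
    𝔼 Q hits ∎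
    where
    open ℚ.≤-Reasoning
    F = coloured r≤k (edges H) H-bounded
    0≤s = 0≤* (0≤* (0≤ι 4) (recip-nonNeg k′)) 0≤σ
    0≤Q = ≤-trans (0≤* (0≤ι (8 ℕ.* j ℕ.+ 2 ℕ.* (suc v ℕ.* suc v))) 0≤s) d≤Q
    hits : Subset (n ℕ.* suc k′) → ℚ
    hits W = 𝟙 (containsRainbowEdge? H (suc k′) W)
    lemma : ∀ x y → x + y - x ≡ y
    lemma = solve-∀ ℚ-ring
    hit : ∀ W → 1ℚ ≤ miss F W + hits W
    hit W = go (any? (_⊆? W) F)
      where
      go : (d : Dec (Any (_⊆ W) F)) → 1ℚ ≤ 𝟙 (¬? d) + hits W
      go (no _)  = a≤a+b {1ℚ} (0≤𝟙 (containsRainbowEdge? H (suc k′) W))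
      go (yes a) =
        let S , S∈F , S⊆W = find a
            e , cs , e∈H , cs∈ , S≡ = ∈-coloured⁻ r≤k (edges H) H-bounded S∈F
        in ≤-reflexive (sym (trans (ℚ.+-identityˡ (hits W)) (𝟙-true (containsRainbowEdge? H (suc k′) W)
             (colour⊆⇒rainbow H e∈H
               (ℕ.≤-trans (All.lookup H-bounded e∈H) (ℕ.≤-reflexive
                   (sym (Injections.injs-length (suc k′) (List.allFin (suc k′)) r cs∈))))
               (Injections.injs-unique (suc k′) (List.allFin (suc k′)) r cs∈) (subst (_⊆ W) S≡ S⊆W)))))

  harmonic-mono : ∀ {a b} → a ℕ.≤ b → harmonic a ≤ harmonic b
  harmonic-mono {a} {b} a≤b = subst (λ c → harmonic a ≤ harmonic c) (ℕ.m∸n+n≡m a≤b) (go (b ℕ.∸ a))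
    where
    go : ∀ d → harmonic a ≤ harmonic (d ℕ.+ a)
    go zero    = ≤-refl
    go (suc d) = ≤-trans (go d) (a≤a+b (recip-nonNeg (d ℕ.+ a)))

  -- Doubling a adds a new terms, each at least 1 / (2a).
  harmonic-double : ∀ a .{{_ : ℕ.NonZero a}} → harmonic a + ½ ≤ harmonic (a ℕ.+ a)
  harmonic-double (suc a) = subst (λ h → harmonic (suc a) + h ≤ harmonic (suc a ℕ.+ suc a)) (·-recip a 1)
    (harmonic-lower (suc a) (suc a) (1 ℕ.+ a ℕ.* 2) (ℕ.≤-reflexive (cong suc
      (trans (ℕ.+-suc a a) (cong suc (trans (cong (a ℕ.+_) (sym (ℕ.+-identityʳ a))) (ℕ.*-comm 2 a)))))))

  harmonic-2^ : ∀ L a .{{_ : ℕ.NonZero a}} → harmonic a + ι L * ½ ≤ harmonic (2 ℕ.^ L ℕ.* a)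
  harmonic-2^ zero    a = ≤-reflexive (trans (ℚ.+-identityʳ (harmonic a)) (cong harmonic (sym (ℕ.*-identityˡ a))))
  harmonic-2^ (suc L) a = begin
    harmonic a + ι (suc L) * ½         ≡⟨ cong (λ y → harmonic a + y * ½) (ι-suc L) ⟩
    harmonic a + (ι L + 1ℚ) * ½        ≡⟨ lemma (harmonic a) (ι L) ½ ⟩
    (harmonic a + ι L * ½) + ½         ≤⟨ ℚ.+-monoˡ-≤ ½ (harmonic-2^ L a) ⟩
    harmonic (2 ℕ.^ L ℕ.* a) + ½       ≤⟨ harmonic-double (2 ℕ.^ L ℕ.* a) {{ℕ.m*n≢0 (2 ℕ.^ L) a {{ℕ.m^n≢0 2 L}}}} ⟩
    harmonic (2 ℕ.^ L ℕ.* a ℕ.+ 2 ℕ.^ L ℕ.* a)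
      ≡⟨ cong harmonic (trans (sym (ℕ.*-distribʳ-+ a (2 ℕ.^ L) (2 ℕ.^ L)))
          (cong (λ t → (2 ℕ.^ L ℕ.+ t) ℕ.* a) (sym (ℕ.+-identityʳ (2 ℕ.^ L))))) ⟩
    harmonic (2 ℕ.^ suc L ℕ.* a)       ∎
    where
    open ℚ.≤-Reasoning
    lemma : ∀ a l h → a + (l + 1ℚ) * h ≡ (a + l * h) + h
    lemma = solve-∀ ℚ-ring

  -- Each of L doublings adds at least ½ to the harmonic sum, so the bound L / 2 holds for every
  -- term of the sequence and not merely for its limit.
  logSeq-lower : ∀ {L r} n → 2 ℕ.^ L ℕ.≤ r → ι L * ½ ≤ logSeq r n
  logSeq-lower {L} {r} n 2^L≤r = begin
    ι L * ½                                              ≡⟨ lemma (harmonic (suc n)) (ι L * ½) ⟩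
    harmonic (suc n) + ι L * ½ - harmonic (suc n)
      ≤⟨ ℚ.+-monoˡ-≤ (- harmonic (suc n)) (≤-trans (harmonic-2^ L (suc n)) (harmonic-mono (ℕ.*-monoˡ-≤ (suc n) 2^L≤r))) ⟩
    harmonic (r ℕ.* suc n) - harmonic (suc n)            ∎
    where
    open ℚ.≤-Reasoning
    lemma : ∀ a l → l ≡ a + l - a
    lemma = solve-∀ ℚ-ring

  module _ {P : ℕ → Set} (P? : Decidable P) where

    -- A search downwards from the bound, with 0 as default; therefore `largest-holds` asks for
    -- `P 0`.
    largest : ℕ → ℕ
    largest zero    = 0
    largest (suc b) = if does (P? (suc b)) then suc b else largest b

    largest-holds : P 0 → ∀ b → P (largest b)
    largest-holds P0 zero    = P0
    largest-holds P0 (suc b) with P? (suc b)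
    ... | yes p = p
    ... | no _  = largest-holds P0 b

    largest-max : ∀ {i} b → i ℕ.≤ b → P i → i ℕ.≤ largest b
    largest-max zero    i≤b Pi = i≤b
    largest-max {i} (suc b) i≤b Pi with P? (suc b)
    ... | yes _ = i≤b
    ... | no ¬p with ℕ.m≤n⇒m<n∨m≡n i≤b
    ...   | inj₁ (ℕ.s≤s i≤b′) = largest-max b i≤b′ Pi
    ...   | inj₂ refl         = contradiction Pi ¬p

-- Passage to the real numbers and choice of the constants.

module Reals where

  open import Data.Fin.Subset using (Subset; ∣_∣)
  open import Data.Fin.Subset.Properties using (_⊆?_)
  open import Data.List.Base using (length)
  open import Data.Nat.Base as ℕ using (ℕ; zero; suc)
  import Data.Nat.Properties as ℕ
  open import Data.Nat.Tactic.RingSolver renaming (solve-∀ to solve-∀ᴺ)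
  open import Data.Product.Base using (∃; _×_; _,_; proj₁; proj₂)
  open import Data.Rational.Base using (ℚ; 0ℚ; 1ℚ; ½; _+_; _*_; _-_; -_; _≤_; _<_; _⊓_) renaming (∣_∣ to ∣_∣ℚ)
  open import Data.Rational.Properties as ℚ using (≤-refl; ≤-reflexive; ≤-trans; <⇒≤)
  open import Data.Sum.Base using (inj₁; inj₂; [_,_]′)
  open import Level using (0ℓ)
  open import Relation.Binary.PropositionalEquality hiding ([_])
  open import Relation.Nullary.Negation using (contradiction)
  open import Relation.Nullary.Decidable using (yes; no)
  open import Relation.Unary using (Decidable; Pred)
  open import Tactic.RingSolver using (solve-∀)
  open import Defs using (ℚ-ring; recip; recip-nonNeg; recip-antimono; recip-archimedean; logSeq; log; shrink;
    Pr; seq; cauchy; ℝ; 0ℝ; 1ℝ; fromℚ; fromℕ; fromℕ-pos; _/_[_]; inv₀; inv₀-inverseʳ; inv₀-nonNeg;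
    MultiHypergraph; edges; degree; Bounded; Spread; containsRainbowEdge?)
  import Defs
  open Rationals
  open RandomSubsets
  open Fragments
  open Rounds
  open RainbowProbability

  private
    variable
      m : ℕ

  -- The constant factor 4 leaves room to replace the real number 1/κ by a rational σ.
  inverse-scale : ∀ κ → 0ℝ Defs.< κ → ∃ λ σ → 0ℚ < σ × ∃ λ N → ∀ n → N ℕ.≤ n →
    0ℚ ≤ inv₀ (seq κ n) × inv₀ (seq κ n) ≤ σ × σ ≤ ι 4 * inv₀ (seq κ n)
  inverse-scale κ (η , 0<η , N₁ , η≤κ) with cauchy κ η 0<η
  -- From N₀ on the terms of κ are at least η and differ by at most η, so any two are within a
  -- factor 2. Twice the reciprocal of one of them thus lies between 1 and 4 times the reciprocal of
  -- any other.
  ... | N₂ , close = 2ℚ * i₀ , 0<* (ℚ.<-≤-trans Defs.0<1 1≤2) 0<i₀ , N₀ , λ n N₀≤n →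
      let iₙ = inv₀ (seq κ n)
          0<κₙ = 0<κ n N₀≤n
          0≤iₙ = inv₀-nonNeg 0<κₙ
      in 0≤iₙ ,
         cross {seq κ n} {κ₀} 0≤iₙ (<⇒≤ 0<i₀) (near n N₀ N₀≤n ℕ.≤-refl) (inv₀-inverseʳ 0<κₙ) (inv₀-inverseʳ 0<κ₀) ,
         (begin
            2ℚ * i₀
              ≤⟨ *-monoˡ 0≤2 (cross {κ₀} {seq κ n} (<⇒≤ 0<i₀) 0≤iₙ (near N₀ n ℕ.≤-refl N₀≤n) (inv₀-inverseʳ 0<κ₀)
                  (inv₀-inverseʳ 0<κₙ)) ⟩
            2ℚ * (2ℚ * iₙ)    ≡⟨ ℚ.*-assoc 2ℚ 2ℚ iₙ ⟨
            ι 4 * iₙ          ∎)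
    where
    open ℚ.≤-Reasoning
    N₀ = N₁ ℕ.⊔ N₂
    κ₀ = seq κ N₀
    i₀ = inv₀ κ₀
    η≤ : ∀ n → N₀ ℕ.≤ n → η ≤ seq κ n
    η≤ n l = subst (_≤ seq κ n) (ℚ.+-identityˡ η) (η≤κ n (ℕ.m⊔n≤o⇒m≤o N₁ N₂ l))
    0<κ : ∀ n → N₀ ℕ.≤ n → 0ℚ < seq κ n
    0<κ n l = ℚ.<-≤-trans 0<η (η≤ n l)
    0<κ₀ = 0<κ N₀ ℕ.≤-refl
    0<i₀ : 0ℚ < i₀
    0<i₀ with 0ℚ ℚ.<? i₀
    ... | yes 0<i₀ = 0<i₀
    ... | no  0≮i₀ = contradiction (≤-trans (≤-reflexive (sym (inv₀-inverseʳ 0<κ₀)))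
                       (≤-trans (*-monoˡ (<⇒≤ 0<κ₀) (ℚ.≮⇒≥ 0≮i₀)) (≤-reflexive (ℚ.*-zeroʳ κ₀))))
                           (λ 1≤0 → ℚ.<-irrefl refl (ℚ.<-≤-trans Defs.0<1 1≤0))
    near : ∀ m n → N₀ ℕ.≤ m → N₀ ℕ.≤ n → seq κ n ≤ 2ℚ * seq κ m
    near m n lm ln = begin
      seq κ n                            ≡⟨ a+[b-a]≡b (seq κ m) (seq κ n) ⟨
      seq κ m + (seq κ n - seq κ m)
        ≤⟨ ℚ.+-monoʳ-≤ (seq κ m) (≤-trans (p≤∣p∣ _) (close n m (ℕ.m⊔n≤o⇒n≤o N₁ N₂ ln) (ℕ.m⊔n≤o⇒n≤o N₁ N₂ lm))) ⟩
      seq κ m + η                        ≤⟨ ℚ.+-monoʳ-≤ (seq κ m) (η≤ m lm) ⟩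
      seq κ m + seq κ m                  ≡⟨ double (seq κ m) ⟩
      2ℚ * seq κ m                       ∎
      where
      double : ∀ x → x + x ≡ (1ℚ + 1ℚ) * x
      double = solve-∀ ℚ-ring
      p≤∣p∣ : ∀ p → p ≤ ∣ p ∣ℚ
      p≤∣p∣ p with ℚ.≤-total 0ℚ p
      ... | inj₁ 0≤p = ≤-reflexive (sym (ℚ.0≤p⇒∣p∣≡p 0≤p))
      ... | inj₂ p≤0 = ≤-trans p≤0 (ℚ.0≤∣p∣ p)
    cross : ∀ {a b i j} → 0ℚ ≤ i → 0ℚ ≤ j → b ≤ 2ℚ * a → a * i ≡ 1ℚ → b * j ≡ 1ℚ → i ≤ 2ℚ * j
    cross {a} {b} {i} {j} 0≤i 0≤j b≤2a ai≡1 bj≡1 = begin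
      i                     ≡⟨ ℚ.*-identityˡ i ⟨
      1ℚ * i                ≡⟨ cong (_* i) bj≡1 ⟨
      (b * j) * i           ≤⟨ *-monoʳ 0≤i (*-monoʳ 0≤j b≤2a) ⟩
      (2ℚ * a * j) * i      ≡⟨ lemma 2ℚ a j i ⟩
      2ℚ * j * (a * i)      ≡⟨ trans (cong (2ℚ * j *_) ai≡1) (ℚ.*-identityʳ (2ℚ * j)) ⟩
      2ℚ * j                ∎
      where
      lemma : ∀ t a j i → (t * a * j) * i ≡ t * j * (a * i)
      lemma = solve-∀ ℚ-ring

  -- At a late index t the real inequality is a rational one up to δ, and there 1 / κ is at most σ.
  -- The degree does not depend on t, so δ can tend to 0.
  spread-rational : ∀ {n κ κ>0 σ N} (H : MultiHypergraph n) → Spread κ κ>0 H →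
    (∀ t → N ℕ.≤ t → 0ℚ ≤ inv₀ (seq κ t) × inv₀ (seq κ t) ≤ σ) → SpreadBy σ (ι (length (edges H))) (edges H)
  spread-rational {n} {κ} {κ>0} {σ} {N} H H-spread inv≤σ U = limit-≤ λ δ 0<δ →
    let N′ , ≤δ = H-spread U δ 0<δ
        t = N ℕ.⊔ N′
        0≤i , i≤σ = inv≤σ t (ℕ.m≤m⊔n N N′)
        a = 1ℚ * inv₀ (seq κ t)
    in begin
      ∑ (edges H) (sub U)                           ≡⟨ ∑-cong (edges H) (λ S → sym (𝟙-⊆? U S)) ⟩
      ∑ (edges H) (λ S → 𝟙 (U ⊆? S))                ≡⟨ ι-length-filter (U ⊆?_) (edges H) ⟨
      ι (degree H U)                                ≤⟨ ≤δ t (ℕ.m≤n⊔m N N′) ⟩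
      seq ((1ℝ / κ [ κ>0 ]) Defs.^ ∣ U ∣) t * ι ℓ + δ   ≡⟨ cong (λ y → y * ι ℓ + δ) (seq-^ (1ℝ / κ [ κ>0 ]) ∣ U ∣ t) ⟩
      pow a ∣ U ∣ * ι ℓ + δ
        ≤⟨ ℚ.+-monoˡ-≤ δ (*-monoʳ (0≤ι ℓ) (pow-mono (0≤* 0≤1 0≤i) (≤-trans (≤-reflexive (ℚ.*-identityˡ _)) i≤σ) ∣ U ∣)) ⟩
      pow σ ∣ U ∣ * ι ℓ + δ                         ∎
    where
    open ℚ.≤-Reasoning
    ℓ = length (edges H)
    seq-^ : ∀ x s t → seq (x Defs.^ s) t ≡ pow (seq x t) s
    seq-^ x zero    t = refl
    seq-^ x (suc s) t = cong (seq x t *_) (seq-^ x s t)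

  -- A late term of ρ is clamped to some Q in [0 , 1] to which the hypothesis applies; returning
  -- from Q to the term costs at most `lip m * d`, hence at most δ.
  Pr-lower : ∀ {ρ} {E : Pred (Subset m) 0ℓ} (E? : Decidable E) {q₀ ε N₀} →
    0ℝ Defs.≤ ρ → ρ Defs.≤ 1ℝ → (∀ n → N₀ ℕ.≤ n → q₀ ≤ seq ρ n) →
    (∀ Q → 0ℚ ≤ Q → q₀ ≤ Q → Q ≤ 1ℚ → 1ℚ - ε ≤ 𝔼 Q (λ W → 𝟙 (E? W))) →
    1ℝ Defs.- fromℚ ε Defs.≤ Pr ρ E?
  Pr-lower {m} {ρ} E? {q₀} {ε} {N₀} 0≤ρ ρ≤1 q₀≤ρ 𝔼≥ δ 0<δ =
    let N₁ , lo = 0≤ρ d 0<d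
        N₂ , hi = ρ≤1 d 0<d
    in N₀ ℕ.⊔ (N₁ ℕ.⊔ N₂) , λ n l →
    let n≥N₀ = ℕ.m⊔n≤o⇒m≤o N₀ (N₁ ℕ.⊔ N₂) l
        n≥N₁₂ = ℕ.m⊔n≤o⇒n≤o N₀ (N₁ ℕ.⊔ N₂) l
        q = seq ρ n
        Q , 0≤Q , Q≤1 , q-Q≤d , ≤Q = clamp (lo n (ℕ.m⊔n≤o⇒m≤o N₁ N₂ n≥N₁₂)) (hi n (ℕ.m⊔n≤o⇒n≤o N₁ N₂ n≥N₁₂)) (<⇒≤ 0<d)
    in begin
      1ℚ - ε              ≤⟨ 𝔼≥ Q 0≤Q (≤Q (q₀≤ρ n n≥N₀) q₀≤1) Q≤1 ⟩
      𝔼 Q f               ≡⟨ lemma (𝔼 Q f) (𝔼 q f) ⟩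
      𝔼 q f - (𝔼 q f - 𝔼 Q f)
        ≤⟨ ℚ.+-monoʳ-≤ (𝔼 q f) (≤-trans (-p≤∣p∣ (𝔼 q f - 𝔼 Q f))
             (≤-trans (𝔼-lipschitz 0≤Q Q≤1 q-Q≤d d≤1 (λ W → 0≤𝟙 (E? W)) (λ W → 𝟙≤1 (E? W))) lipd≤δ)) ⟩
      𝔼 q f + δ           ≡⟨ cong (_+ δ) (seq-Pr ρ E? n) ⟨
      seq (Pr ρ E?) n + δ ∎
    where
    open ℚ.≤-Reasoning
    f : Subset m → ℚ
    f W = 𝟙 (E? W)
    -- The 1 makes B positive, as `shrink` requires: `lip 0` is 0.
    B = lip m + 1ℚ
    0<B : 0ℚ < B
    0<B = ℚ.+-mono-≤-< (0≤lip m) Defs.0<1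
    η = proj₁ (shrink 0<B 0<δ)
    0<η = proj₁ (proj₂ (shrink 0<B 0<δ))
    Bη≡δ = proj₂ (proj₂ (shrink 0<B 0<δ))
    -- `𝔼-lipschitz` is available only for d ≤ 1.
    d = η ⊓ 1ℚ
    0<d : 0ℚ < d
    0<d with ℚ.≤-total η 1ℚ
    ... | inj₁ η≤1 = subst (0ℚ <_) (sym (ℚ.p≤q⇒p⊓q≡p η≤1)) 0<η
    ... | inj₂ 1≤η = subst (0ℚ <_) (sym (ℚ.p≥q⇒p⊓q≡q 1≤η)) Defs.0<1
    d≤1 = ℚ.p⊓q≤q η 1ℚ
    lipd≤δ : lip m * d ≤ δ
    lipd≤δ = begin
      lip m * d   ≤⟨ *-mono (0≤lip m) (<⇒≤ 0<η) (a≤a+b 0≤1) (ℚ.p⊓q≤p η 1ℚ) ⟩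
      B * η       ≡⟨ Bη≡δ ⟩
      δ           ∎
    q₀≤1 : q₀ ≤ 1ℚ
    q₀≤1 = limit-≤ λ δ 0<δ → let N , hi = ρ≤1 δ 0<δ in
      ≤-trans (q₀≤ρ (N₀ ℕ.⊔ N) (ℕ.m≤m⊔n N₀ N)) (hi (N₀ ℕ.⊔ N) (ℕ.m≤n⊔m N₀ N))
    lemma : ∀ x y → x ≡ y - (y - x)
    lemma = solve-∀ ℚ-ring
    -p≤∣p∣ : ∀ p → - p ≤ ∣ p ∣ℚ
    -p≤∣p∣ p with ℚ.≤-total 0ℚ p
    ... | inj₁ 0≤p = ≤-trans (ℚ.neg-antimono-≤ 0≤p) (ℚ.0≤∣p∣ p)
    ... | inj₂ p≤0 = ≤-trans (≤-reflexive (sym (ℚ.0≤p⇒∣p∣≡p (ℚ.neg-antimono-≤ p≤0)))) (≤-reflexive (ℚ.∣-p∣≡∣p∣ p))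

  n<2^n : ∀ n → n ℕ.< 2 ℕ.^ n
  n<2^n zero    = ℕ.s≤s ℕ.z≤n
  n<2^n (suc n) = begin-strict
    suc n                    ≤⟨ n<2^n n ⟩
    2 ℕ.^ n                  <⟨ ℕ.m<m+n (2 ℕ.^ n) (ℕ.≤-trans (ℕ.m^n>0 2 n) (ℕ.m≤m+n _ 0)) ⟩
    2 ℕ.^ suc n              ∎
    where open ℕ.≤-Reasoning

  -- Logarithms to base 2, rounded down. The search bound r is large enough because i < 2^i.
  ⌊log⌋ ⌊√log⌋ : ℕ → ℕ
  ⌊log⌋ r  = largest (λ i → 2 ℕ.^ i ℕ.≤? r) r
  ⌊√log⌋ r = largest (λ i → 2 ℕ.^ (i ℕ.* i) ℕ.≤? r) r

  ⌊√log⌋-lower : ∀ {r} N → 2 ℕ.^ (N ℕ.* N) ℕ.≤ r → N ℕ.≤ ⌊√log⌋ r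
  ⌊√log⌋-lower {r} N 2^N²≤r = largest-max (λ i → 2 ℕ.^ (i ℕ.* i) ℕ.≤? r) r
      (ℕ.≤-trans (N≤N*N N) (ℕ.≤-trans (ℕ.<⇒≤ (n<2^n (N ℕ.* N))) 2^N²≤r)) 2^N²≤r
    where
    N≤N*N : ∀ N → N ℕ.≤ N ℕ.* N
    N≤N*N zero    = ℕ.z≤n
    N≤N*N (suc N) = ℕ.m≤m+n (suc N) (N ℕ.* suc N)

  module _ (q : ℕ) where

    private
      r = suc q
      L = ⌊log⌋ r
      u = ⌊√log⌋ r

    2^⌊log⌋≤ : 2 ℕ.^ L ℕ.≤ r
    2^⌊log⌋≤ = largest-holds (λ i → 2 ℕ.^ i ℕ.≤? r) (ℕ.s≤s ℕ.z≤n) r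

    <2^1+⌊log⌋ : r ℕ.< 2 ℕ.^ suc L
    <2^1+⌊log⌋ with 2 ℕ.^ suc L ℕ.≤? r
    ... | no ≰  = ℕ.≰⇒> ≰
    ... | yes ≤ = contradiction
      (largest-max (λ i → 2 ℕ.^ i ℕ.≤? r) r (ℕ.≤-trans (ℕ.<⇒≤ (n<2^n (suc L))) ≤) ≤) (ℕ.<-irrefl refl)

    ⌊√log⌋²≤ : u ℕ.* u ℕ.≤ L
    ⌊√log⌋²≤ = largest-max (λ i → 2 ℕ.^ i ℕ.≤? r) r (ℕ.≤-trans (ℕ.<⇒≤ (n<2^n (u ℕ.* u))) 2^u²≤r) 2^u²≤r
      where
      2^u²≤r : 2 ℕ.^ (u ℕ.* u) ℕ.≤ r
      2^u²≤r = largest-holds (λ i → 2 ℕ.^ (i ℕ.* i) ℕ.≤? r) (ℕ.s≤s ℕ.z≤n) r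

  -- All terms are compared with L: the halving rounds contribute at most 16 L, and 3 + u ≤ 4 u
  -- leaves 32 u² ≤ 32 L for the last round.
  density≤ : ∀ {u L} → 1 ℕ.≤ u → u ℕ.* u ℕ.≤ L → 8 ℕ.* suc L ℕ.+ 2 ℕ.* ((3 ℕ.+ u) ℕ.* (3 ℕ.+ u)) ℕ.≤ 48 ℕ.* L
  density≤ {u} {L} 1≤u u²≤L = begin
    8 ℕ.* suc L ℕ.+ 2 ℕ.* ((3 ℕ.+ u) ℕ.* (3 ℕ.+ u))
      ≤⟨ ℕ.+-mono-≤ (ℕ.*-monoʳ-≤ 8 (ℕ.+-monoˡ-≤ L 1≤L)) (ℕ.*-monoʳ-≤ 2 (ℕ.*-mono-≤ 3+u≤4u 3+u≤4u)) ⟩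
    8 ℕ.* (L ℕ.+ L) ℕ.+ 2 ℕ.* ((4 ℕ.* u) ℕ.* (4 ℕ.* u))
      ≡⟨ lemma₁ L u ⟩
    16 ℕ.* L ℕ.+ 32 ℕ.* (u ℕ.* u)
      ≤⟨ ℕ.+-monoʳ-≤ (16 ℕ.* L) (ℕ.*-monoʳ-≤ 32 u²≤L) ⟩
    16 ℕ.* L ℕ.+ 32 ℕ.* L
      ≡⟨ lemma₂ L ⟩
    48 ℕ.* L ∎
    where
    open ℕ.≤-Reasoning
    1≤L : 1 ℕ.≤ L
    1≤L = ℕ.≤-trans (ℕ.*-mono-≤ 1≤u 1≤u) u²≤L
    3+u≤4u : 3 ℕ.+ u ℕ.≤ 4 ℕ.* u
    3+u≤4u = ℕ.≤-trans (ℕ.+-monoˡ-≤ u (ℕ.*-monoʳ-≤ 3 1≤u)) (ℕ.≤-reflexive (lemma u))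
      where
      lemma : ∀ u → 3 ℕ.* u ℕ.+ u ≡ 4 ℕ.* u
      lemma = solve-∀ᴺ
    lemma₁ : ∀ L u → 8 ℕ.* (L ℕ.+ L) ℕ.+ 2 ℕ.* ((4 ℕ.* u) ℕ.* (4 ℕ.* u)) ≡ 16 ℕ.* L ℕ.+ 32 ℕ.* (u ℕ.* u)
    lemma₁ = solve-∀ᴺ
    lemma₂ : ∀ L → 16 ℕ.* L ℕ.+ 32 ℕ.* L ≡ 48 ℕ.* L
    lemma₂ = solve-∀ᴺ

  -- 4 / (u + 4) for u = `⌊√log⌋ r`. It dominates the failure bound 3 / w at w = u + 3, and at u = 0
  -- it is 1, where the claim becomes trivial.
  errorℚ : ℕ → ℚ
  errorℚ r = ι 4 * recip (3 ℕ.+ ⌊√log⌋ r)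

  0≤errorℚ : ∀ r → 0ℚ ≤ errorℚ r
  0≤errorℚ r = 0≤* (0≤ι 4) (recip-nonNeg (3 ℕ.+ ⌊√log⌋ r))

  errorℚ≤1 : ∀ r → errorℚ r ≤ 1ℚ
  errorℚ≤1 r = ≤-trans (*-monoˡ (0≤ι 4) (recip-antimono (ℕ.m≤m+n 3 (⌊√log⌋ r)))) (≤-reflexive (ι*recip 3))

  3recip≤4recip : ∀ u → ι 3 * recip (2 ℕ.+ u) ≤ ι 4 * recip (3 ℕ.+ u)
  3recip≤4recip u = begin
    ι 3 * a                            ≡⟨ ℚ.*-identityʳ _ ⟨
    ι 3 * a * 1ℚ                       ≡⟨ cong (ι 3 * a *_) (ι*recip (3 ℕ.+ u)) ⟨
    ι 3 * a * (ι (4 ℕ.+ u) * b)        ≡⟨ lemma (ι 3) a (ι (4 ℕ.+ u)) b ⟩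
    (ι 3 * ι (4 ℕ.+ u)) * (a * b)      ≡⟨ cong (_* (a * b)) (ι-* 3 (4 ℕ.+ u)) ⟨
    ι (3 ℕ.* (4 ℕ.+ u)) * (a * b)
      ≤⟨ *-monoʳ (0≤* (recip-nonNeg (2 ℕ.+ u)) (recip-nonNeg (3 ℕ.+ u))) (ι-mono 3[4+u]≤4[3+u]) ⟩
    ι (4 ℕ.* (3 ℕ.+ u)) * (a * b)      ≡⟨ cong (_* (a * b)) (ι-* 4 (3 ℕ.+ u)) ⟩
    (ι 4 * ι (3 ℕ.+ u)) * (a * b)      ≡⟨ lemma′ (ι 4) (ι (3 ℕ.+ u)) a b ⟩
    ι 4 * b * (ι (3 ℕ.+ u) * a)        ≡⟨ trans (cong (ι 4 * b *_) (ι*recip (2 ℕ.+ u))) (ℚ.*-identityʳ _) ⟩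
    ι 4 * b                            ∎
    where
    open ℚ.≤-Reasoning
    a = recip (2 ℕ.+ u)
    b = recip (3 ℕ.+ u)
    lemma : ∀ t a w b → t * a * (w * b) ≡ (t * w) * (a * b)
    lemma = solve-∀ ℚ-ring
    lemma′ : ∀ t w a b → (t * w) * (a * b) ≡ t * b * (w * a)
    lemma′ = solve-∀ ℚ-ring
    3[4+u]≤4[3+u] : 3 ℕ.* (4 ℕ.+ u) ℕ.≤ 4 ℕ.* (3 ℕ.+ u)
    3[4+u]≤4[3+u] = ℕ.≤-trans (ℕ.m≤n+m (3 ℕ.* (4 ℕ.+ u)) u) (ℕ.≤-reflexive (eq u))
      where
      eq : ∀ u → u ℕ.+ 3 ℕ.* (4 ℕ.+ u) ≡ 4 ℕ.* (3 ℕ.+ u)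
      eq = solve-∀ᴺ

  inv₀-ι : ∀ {k k′} → k ≡ suc k′ → inv₀ (ι k) ≡ recip k′
  inv₀-ι {k} {k′} refl = begin
    i                         ≡⟨ ℚ.*-identityʳ i ⟨
    i * 1ℚ                    ≡⟨ cong (i *_) (ι*recip k′) ⟨
    i * (ι k * recip k′)      ≡⟨ lemma i (ι k) (recip k′) ⟩
    (ι k * i) * recip k′      ≡⟨ cong (_* recip k′) (inv₀-inverseʳ (0<ι k)) ⟩
    1ℚ * recip k′             ≡⟨ ℚ.*-identityˡ _ ⟩
    recip k′                  ∎
    where
    open ≡-Reasoning
    i = inv₀ (ι k)
    lemma : ∀ i k r → i * (k * r) ≡ (k * i) * r
    lemma = solve-∀ ℚ-ring

  constant : ℝ
  constant = fromℚ (ι 1544)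

  -- 1544 = 8 (192 + 1), where 192 L σ is needed, 8 bounds the loss in passing from log r / κ to L σ
  -- and one more L σ absorbs the error of the approximation.
  rate-lower : ∀ {q L σ N₀} {κ} (κ>0 : 0ℝ Defs.< κ) p → 1 ℕ.≤ L → 2 ℕ.^ L ℕ.≤ suc q → 0ℚ < σ →
    (∀ t → N₀ ℕ.≤ t → 0ℚ ≤ inv₀ (seq κ t) × inv₀ (seq κ t) ≤ σ × σ ≤ ι 4 * inv₀ (seq κ t)) →
    constant Defs.* log (suc q) / κ [ κ>0 ] Defs.≤ p →
    ∃ λ N → ∀ t → N ℕ.≤ t → ι (192 ℕ.* L) * σ ≤ seq p t
  rate-lower {q} {L} {σ} {N₀} {κ} κ>0 p 1≤L 2^L≤r 0<σ inv-bounds rate≤p =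
    let N , bound = rate≤p σ 0<σ in N₀ ℕ.⊔ N , λ t l →
    let 0≤i , _ , σ≤4i = inv-bounds t (ℕ.m⊔n≤o⇒m≤o N₀ N l)
        i = inv₀ (seq κ t)
    in 0≤q-p⇒p≤q (subst (0ℚ ≤_) (move (seq p t) σ (ι (192 ℕ.* L) * σ)) (p≤q⇒0≤q-p (begin
      ι (192 ℕ.* L) * σ + σ                   ≡⟨ cong (ι (192 ℕ.* L) * σ +_) (ℚ.*-identityˡ σ) ⟨
      ι (192 ℕ.* L) * σ + 1ℚ * σ              ≤⟨ ℚ.+-monoʳ-≤ (ι (192 ℕ.* L) * σ) (*-monoʳ (<⇒≤ 0<σ) (ι-mono 1≤L)) ⟩
      ι (192 ℕ.* L) * σ + ι L * σ             ≡⟨ cong (λ y → y * σ + ι L * σ) (ι-* 192 L) ⟩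
      ι 192 * ι L * σ + ι L * σ               ≡⟨ collect (ι 192) (ι L) σ ⟩
      (ι 192 + 1ℚ) * ι L * σ                  ≤⟨ *-monoˡ (0≤* (0≤ι 193) (0≤ι L)) σ≤4i ⟩
      ι 193 * ι L * (ι 4 * i)                 ≡⟨ regroup (ι 193) (ι L) (ι 4) i ⟩
      ι 193 * ι 4 * ι L * i                   ≡⟨ halve (ι L) i ⟩
      ι 1544 * (ι L * ½) * i                  ≤⟨ *-monoʳ 0≤i (*-monoˡ (0≤ι 1544) (logSeq-lower {L} t 2^L≤r)) ⟩
      ι 1544 * logSeq (suc q) t * i           ≤⟨ bound t (ℕ.m⊔n≤o⇒n≤o N₀ N l) ⟩
      seq p t + σ                             ∎)))
    where
    open ℚ.≤-Reasoning
    move : ∀ p s y → p + s - (y + s) ≡ p - y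
    move = solve-∀ ℚ-ring
    collect : ∀ a l s → a * l * s + l * s ≡ (a + 1ℚ) * l * s
    collect = solve-∀ ℚ-ring
    regroup : ∀ a l f i → a * l * (f * i) ≡ a * f * l * i
    regroup = solve-∀ ℚ-ring
    swap : ∀ a l h i → a * h * l * i ≡ a * (l * h) * i
    swap = solve-∀ ℚ-ring
    halve : ∀ l i → ι 193 * ι 4 * l * i ≡ ι 1544 * (l * ½) * i
    halve l i = swap (ι 1544) l ½ i

  error-vanishes : ∀ η → 0ℚ < η → ∃ λ R → ∀ r → R ℕ.≤ r → errorℚ r ≤ η
  error-vanishes η 0<η =
    let ζ , 0<ζ , 4ζ≡η = shrink (0<ι 4) 0<η
        N , recip≤ζ = recip-archimedean ζ 0<ζ
    -- From 2^(N²) on, `⌊√log⌋ r` is at least N.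
    in 2 ℕ.^ (N ℕ.* N) , λ r R≤r → ≤-trans
         (*-monoˡ (0≤ι 4) (≤-trans (recip-antimono (ℕ.≤-trans (⌊√log⌋-lower N R≤r) (ℕ.m≤n+m (⌊√log⌋ r) 3))) recip≤ζ))
         (≤-reflexive 4ζ≡η)

  -- The factor 1 / k is common to the coloured spread parameter 4σ / k and the density p / k; what
  -- remains is 48 · 4 = 192.
  density-bound : ∀ {D L σ y k k′} → k ≡ suc k′ → D ℕ.≤ 48 ℕ.* L → 0ℚ ≤ σ → ι (192 ℕ.* L) * σ ≤ y →
    ι D * (ι 4 * recip k′ * σ) ≤ y * inv₀ (ι k)
  density-bound {D} {L} {σ} {y} {k} {k′} k≡ D≤48L 0≤σ 192Lσ≤y = begin
    ι D * (ι 4 * recip k′ * σ)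
      ≤⟨ *-monoʳ (0≤* (0≤* (0≤ι 4) (recip-nonNeg k′)) 0≤σ) (ι-mono D≤48L) ⟩
    ι (48 ℕ.* L) * (ι 4 * recip k′ * σ)
      ≡⟨ lemma (ι (48 ℕ.* L)) (ι 4) (recip k′) σ ⟩
    ι (48 ℕ.* L) * ι 4 * σ * recip k′
      ≡⟨ cong (λ a → a * σ * recip k′) (trans (sym (ι-* (48 ℕ.* L) 4)) (cong ι (48*4 L))) ⟩
    ι (192 ℕ.* L) * σ * recip k′
      ≤⟨ *-monoʳ (recip-nonNeg k′) 192Lσ≤y ⟩
    y * recip k′
      ≡⟨ cong (y *_) (inv₀-ι k≡) ⟨
    y * inv₀ (ι k) ∎
    where
    open ℚ.≤-Reasoning
    lemma : ∀ a b c d → a * (b * c * d) ≡ a * b * d * c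
    lemma = solve-∀ ℚ-ring
    48*4 : ∀ L → 48 ℕ.* L ℕ.* 4 ≡ 192 ℕ.* L
    48*4 = solve-∀ᴺ

  -- Nonnegativity of expectations suffices, but the terms of ρ may be slightly negative: -1 is a
  -- lower bound from the index where 0 ≤ ρ holds up to 1.
  Pr-trivial : ∀ {ρ} {E : Pred (Subset m) 0ℓ} (E? : Decidable E) {ε} → 0ℝ Defs.≤ ρ → ρ Defs.≤ 1ℝ → 1ℚ ≤ ε →
    1ℝ Defs.- fromℚ ε Defs.≤ Pr ρ E?
  Pr-trivial {ρ = ρ} E? {ε} 0≤ρ ρ≤1 1≤ε = Pr-lower {ρ = ρ} E? {q₀ = - 1ℚ} {ε = ε} {N₀ = proj₁ (0≤ρ 1ℚ Defs.0<1)} 0≤ρ ρ≤1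
    (λ t l → 0≤q-p⇒p≤q (subst (0ℚ ≤_) (lemma (seq ρ t)) (proj₂ (0≤ρ 1ℚ Defs.0<1) t l)))
    (λ Q 0≤Q _ Q≤1 → ≤-trans (ℚ.+-monoʳ-≤ 1ℚ (ℚ.neg-antimono-≤ 1≤ε)) (0≤∫ 0≤Q (p≤q⇒0≤q-p Q≤1) (λ W → 0≤𝟙 (E? W))))
    where
    lemma : ∀ x → x + 1ℚ ≡ x - - 1ℚ
    lemma = solve-∀ ℚ-ring

  1≤errorℚ : ∀ r → ⌊√log⌋ r ≡ 0 → 1ℚ ≤ errorℚ r
  1≤errorℚ r u≡0 = ≤-reflexive (sym (trans (cong (λ u → ι 4 * recip (3 ℕ.+ u)) u≡0) (ι*recip 3)))

  module _ {n q : ℕ} {κ : ℝ} (κ>0 : 0ℝ Defs.< κ) (H : MultiHypergraph n)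
           (H-bounded : Bounded (suc q) H) (H-spread : Spread κ κ>0 H)
           (k : ℕ) .{{_ : ℕ.NonZero k}} (r≤k : suc q ℕ.≤ k) (1≤u : 1 ℕ.≤ ⌊√log⌋ (suc q)) where

    private
      L = ⌊log⌋ (suc q)
      u = ⌊√log⌋ (suc q)
      k′ = ℕ.pred k
      k≡ : k ≡ suc k′
      k≡ = sym (ℕ.suc-pred k)
      -- There are L + 1 halving rounds because L is rounded down: only r < 2^(L + 1) is certain.
      -- The cut-off is w = u + 3.
      D = 8 ℕ.* suc L ℕ.+ 2 ℕ.* ((3 ℕ.+ u) ℕ.* (3 ℕ.+ u))
      1≤L : 1 ℕ.≤ L
      1≤L = ℕ.≤-trans (ℕ.*-mono-≤ 1≤u 1≤u) (⌊√log⌋²≤ q)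
      r≤2^1+L*w : suc q ℕ.≤ 2 ℕ.^ suc L ℕ.* (3 ℕ.+ u)
      r≤2^1+L*w = ℕ.≤-trans (ℕ.<⇒≤ (<2^1+⌊log⌋ q)) (ℕ.m≤m*n (2 ℕ.^ suc L) (3 ℕ.+ u))

    rainbow-Pr-large : ∀ p → let ρ = p / fromℕ k [ fromℕ-pos k ] in
      0ℝ Defs.≤ ρ → ρ Defs.≤ 1ℝ → constant Defs.* log (suc q) / κ [ κ>0 ] Defs.≤ p →
      1ℝ Defs.- fromℚ (errorℚ (suc q)) Defs.≤ Pr ρ (containsRainbowEdge? H k)
    rainbow-Pr-large p 0≤ρ ρ≤1 rate≤p =
      Pr-lower {ρ = ρ} (containsRainbowEdge? H k) {q₀ = ι D * (ι 4 * recip k′ * σ)} {ε = errorℚ (suc q)} {N₀ = N}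
        0≤ρ ρ≤1 (λ t l → density-bound {D} {L} k≡ (density≤ 1≤u (⌊√log⌋²≤ q)) (<⇒≤ 0<σ) (192Lσ≤p t l))
        (λ Q _ q₀≤Q Q≤1 → ≤-trans (ℚ.+-monoʳ-≤ 1ℚ (ℚ.neg-antimono-≤ (3recip≤4recip u)))
          (rainbow-probability k≡ (2 ℕ.+ u) (suc L) H H-bounded r≤k (<⇒≤ 0<σ) spread r≤2^1+L*w q₀≤Q Q≤1))
      where
      ρ = p / fromℕ k [ fromℕ-pos k ]
      scale = inverse-scale κ κ>0
      σ = proj₁ scale
      0<σ = proj₁ (proj₂ scale)
      N₀ = proj₁ (proj₂ (proj₂ scale))
      inv-bounds : ∀ t → N₀ ℕ.≤ t → 0ℚ ≤ inv₀ (seq κ t) × inv₀ (seq κ t) ≤ σ × σ ≤ ι 4 * inv₀ (seq κ t)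
      inv-bounds = proj₂ (proj₂ (proj₂ scale))
      rate = rate-lower {q} {L} {σ} {N₀} {κ} κ>0 p 1≤L (2^⌊log⌋≤ q) 0<σ inv-bounds rate≤p
      N = proj₁ rate
      192Lσ≤p = proj₂ rate
      spread : SpreadBy σ (ι (length (edges H))) (edges H)
      spread = spread-rational {κ = κ} {κ>0} {N = N₀} H H-spread
          (λ t l → proj₁ (inv-bounds t l) , proj₁ (proj₂ (inv-bounds t l)))

  -- `⌊√log⌋ r` is 0 exactly for r < 2. Then log r is 0 and the hypothesis on p provides no positive
  -- density, but the error is 1; all the work concerns larger r.
  rainbow-Pr : ∀ (n r : ℕ) (κ : ℝ) (κ>0 : 0ℝ Defs.< κ) (H : MultiHypergraph n) → Bounded r H → Spread κ κ>0 H →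
    (k : ℕ) .{{_ : ℕ.NonZero k}} → r ℕ.≤ k → (p : ℝ) → let ρ = p / fromℕ k [ fromℕ-pos k ] in
    0ℝ Defs.≤ ρ → ρ Defs.≤ 1ℝ → constant Defs.* log r / κ [ κ>0 ] Defs.≤ p →
    1ℝ Defs.- fromℚ (errorℚ r) Defs.≤ Pr ρ (containsRainbowEdge? H k)
  rainbow-Pr n zero κ κ>0 H _ _ k _ p 0≤ρ ρ≤1 _ =
    Pr-trivial {ρ = p / fromℕ k [ fromℕ-pos k ]} (containsRainbowEdge? H k) {errorℚ 0} 0≤ρ ρ≤1 (1≤errorℚ 0 refl)
  rainbow-Pr n (suc q) κ κ>0 H H-bounded H-spread k r≤k p 0≤ρ ρ≤1 rate≤p = [ large , small ]′ (ℕ.≤-<-connex 1 u)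
    where
    u = ⌊√log⌋ (suc q)
    ρ = p / fromℕ k [ fromℕ-pos k ]
    Goal = 1ℝ Defs.- fromℚ (errorℚ (suc q)) Defs.≤ Pr ρ (containsRainbowEdge? H k)
    large : 1 ℕ.≤ u → Goal
    large 1≤u = rainbow-Pr-large {n} {q} {κ} κ>0 H H-bounded H-spread k r≤k 1≤u p 0≤ρ ρ≤1 rate≤p
    small : u ℕ.< 1 → Goal
    small u<1 = Pr-trivial {ρ = ρ} (containsRainbowEdge? H k) {errorℚ (suc q)} 0≤ρ ρ≤1
      (1≤errorℚ (suc q) (ℕ.n<1⇒n≡0 u<1))

-- Assembly: the constant, the error function and its limit.

open import Data.Nat.Base as ℕ using (ℕ)
open import Data.Product.Base using (Σ; ∃; _×_; _,_)
import Data.Rational.Base as ℚ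
import Data.Rational.Properties as ℚ
open import Relation.Binary.PropositionalEquality using (subst)
open import Defs
open Rationals using (ι; 0<ι)
open Reals

theorem8 : Σ ℝ λ C → 0ℝ < C × Σ (ℕ → ℝ) λ ε →
    (∀ r → 0ℝ ≤ ε r × ε r ≤ 1ℝ) ×
    (∀ δ → 0ℝ < δ → ∃ λ R → ∀ r → R ℕ.≤ r → ε r < δ) ×
    (∀ (n r : ℕ) (κ : ℝ) (κ>0 : 0ℝ < κ) (H : MultiHypergraph n) →
    Bounded r H → Spread κ κ>0 H →
    (k : ℕ) .{{_ : ℕ.NonZero k}} → r ℕ.≤ k →
    (p : ℝ) → let ρ = p / fromℕ k [ fromℕ-pos k ] in
    0ℝ ≤ ρ → ρ ≤ 1ℝ →
    C * log r / κ [ κ>0 ] ≤ p →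
    1ℝ - ε r ≤ Pr ρ (containsRainbowEdge? H k))
theorem8 =
  constant ,
  (ι 1544 , 0<ι 1544 , 0 , λ _ _ → ℚ.≤-reflexive (ℚ.+-identityˡ (ι 1544))) ,
  (λ r → fromℚ (errorℚ r)) ,
  (λ r → fromℚ-mono (0≤errorℚ r) , fromℚ-mono (errorℚ≤1 r)) ,
  (λ { δ (η , 0<η , N , η≤δ) →
       -- Strict inequality of reals demands a positive gap: one half of η bounds the error and the
       -- other half is the gap.
       let R , error≤½η = error-vanishes (ℚ.½ ℚ.* η) (half-pos 0<η)
       in R , λ r R≤r → ℚ.½ ℚ.* η , half-pos 0<η , N , λ n N≤n → ℚ.≤-trans
            (ℚ.≤-trans (ℚ.+-monoˡ-≤ (ℚ.½ ℚ.* η) (error≤½η r R≤r))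
              (ℚ.≤-reflexive (half+half η)))
            (subst (ℚ._≤ seq δ n) (ℚ.+-identityˡ η) (η≤δ n N≤n)) }) ,
  rainbow-Pr
  where
  fromℚ-mono : ∀ {a b} → a ℚ.≤ b → fromℚ a ≤ fromℚ b
  fromℚ-mono {a} {b} a≤b δ 0<δ = 0 , λ _ _ → ℚ.≤-trans a≤b
    (subst (ℚ._≤ b ℚ.+ δ) (ℚ.+-identityʳ b) (ℚ.+-monoʳ-≤ b (ℚ.<⇒≤ 0<δ)))
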